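{- Let $\mathcal{SIO}$ be the class of all finite permutations contained in the infinite increasing oscillation $2,4,1,6,3,8,5,10,7,\dots$. Then $\mathcal{SIO}$ has an exponential Wilf-collapse: if $c_n$ denotes the number of permutations of size $n$ in $\mathcal{SIO}$ and $w_n$ denotes the number of equivalence classes of Wilf-equivalence in $\mathcal{SIO}$ among those permutations of size $n$, then there is a constant $r$ with $0<r<1$ such that $w_n = o(r^n c_n)$ as $n \to \infty$.
   Context: A permutation $\pi$ of size $k$ is contained in a permutation (or infinite sequence of distinct numbers) $\tau$, written $\pi \leq \tau$, if $\tau$ has a subsequence of $k$ entries in the same relative order as $\pi$; otherwise $\tau$ avoids $\pi$. The infinite increasing oscillation is the sequence $(s_i)_{i\ge1}$ with $s_1=2$, $s_{2j}=2j+2$ for $j\ge1$ and $s_{2j+1}=2j-1$ for $j\geq 1$. Wilf-equivalence in $\mathcal{SIO}$: for $\alpha,\beta\in\mathcal{SIO}$, $\alpha$ and $\beta$ are Wilf-equivalent in $\mathcal{SIO}$ if for every $m$ the number of permutations of size $m$ in $\mathcal{SIO}$ avoiding $\alpha$ equals the number of permutations of size $m$ in $\mathcal{SIO}$ avoiding $\beta$. -}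

module Defs where

open import Data.Nat using (ℕ; zero; suc; _+_; _*_; _∸_; _≤_; _<_; z≤n; s≤s; _<?_)
open import Data.Nat.Properties
open import Data.Nat.Tactic.RingSolver using (solve-∀)
open import Data.Fin as Fin using (Fin; zero; suc; toℕ; fromℕ<)
import Data.Fin.Properties as Fin
import Data.Integer as ℤ
open import Data.List as List using (List; []; _∷_; length; filter; allFin; cartesianProductWith)
open import Data.List.Membership.Propositional using (_∈_)
open import Data.List.Membership.Propositional.Properties
  using (∈-allFin; ∈-cartesianProductWith⁺; ∈-filter⁺)
open import Data.List.Relation.Unary.All as All using (All; []; _∷_)
open import Data.List.Relation.Unary.All.Properties using (¬Any⇒All¬; all-filter)
open import Data.List.Relation.Unary.Any as Any using (Any; here; there)
open import Data.List.Relation.Unary.AllPairs using (AllPairs; []; _∷_)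
open import Data.Product using (∃; ∃-syntax; Σ-syntax; _×_; _,_; proj₁; proj₂)
open import Data.Rational as ℚ using (ℚ)
open import Data.Sum using (_⊎_; inj₁; inj₂; [_,_]′)
open import Data.Vec as Vec using (Vec; []; _∷_; lookup)
import Data.Vec.Functional as F
open import Data.Vec.Relation.Unary.AllPairs using (allPairs?)
open import Data.Vec.Relation.Unary.Unique.Propositional using (Unique)
open import Function using (_∘_; _⇔_; mk⇔; Equivalence)
open import Relation.Binary using (Rel; tri<; tri≈; tri>)
open import Relation.Binary.PropositionalEquality
open import Relation.Nullary using (¬_; Dec; yes; no; contradiction)
open import Relation.Nullary.Decidable using (map′; _×-dec_; _→-dec_; ¬?)
open import Relation.Nullary.Decidable.Core using (¬¬-excluded-middle)
open import Level using (0ℓ)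

------------------------------------------------------------------------
-- Pattern containment

-- A permutation of size n is a word in one-line notation, with entries
-- 0, …, n-1 instead of 1, …, n.  A word is a permutation when it is Unique.
Word : ℕ → Set
Word n = Vec (Fin n) n

entries : ∀ {n} → Word n → Fin n → ℕ
entries π i = toℕ (lookup π i)

-- e selects the positions of a subsequence of t (whose positions are
-- ordered by _≺_) having the same relative order as p.
Occurrence : ∀ {k} {I : Set} → Rel I 0ℓ → (Fin k → ℕ) → (I → ℕ) → (Fin k → I) → Set
Occurrence _≺_ p t e =
  (∀ i j → i Fin.< j → e i ≺ e j) × (∀ i j → p i < p j ⇔ t (e i) < t (e j))

_≼_ : ∀ {k n} → Word k → Word n → Set
π ≼ τ = ∃[ e ] Occurrence Fin._<_ (entries π) (entries τ) e

-- The infinite increasing oscillation 2, 4, 1, 6, 3, 8, 5, …, with positions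
-- counted from 0, so that osc i is s_{i+1}.
osc : ℕ → ℕ
osc 0 = 2
osc 1 = 4
osc 2 = 1
osc (suc (suc (suc i))) = 2 + osc (suc i)

-- s_{2j} = 2j + 2 and s_{2j+1} = 2j - 1 for j ≥ 1, with j = j′ + 1.
s-even : ∀ j′ → osc (1 + j′ * 2) ≡ suc j′ * 2 + 2
s-even zero = refl
s-even (suc j′) = cong (2 +_) (s-even j′)

s-odd : ∀ j′ → osc (2 + j′ * 2) ≡ suc j′ * 2 ∸ 1
s-odd zero = refl
s-odd (suc j′) = cong (2 +_) (s-odd j′)

SIO : ∀ {n} → Word n → Set
SIO π = Unique π × ∃[ e ] Occurrence _<_ (entries π) osc e

------------------------------------------------------------------------
-- Decidability of containment, needed to count by filtering

Occurrence? : ∀ {k} {I : Set} {_≺_ : Rel I 0ℓ} → (∀ x y → Dec (x ≺ y)) →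
              (p : Fin k → ℕ) (t : I → ℕ) → ∀ e → Dec (Occurrence _≺_ p t e)
Occurrence? _≺?_ p t e =
  Fin.all? (λ i → Fin.all? λ j → (i Fin.<? j) →-dec (e i ≺? e j)) ×-dec
  Fin.all? (λ i → Fin.all? λ j →
    map′ (λ (f , g) → mk⇔ f g) (λ h → Equivalence.to h , Equivalence.from h)
      (((p i <? p j) →-dec (t (e i) <? t (e j))) ×-dec
       ((t (e i) <? t (e j)) →-dec (p i <? p j))))

Occurrence-resp : ∀ {k} {I : Set} {_≺_ : Rel I 0ℓ} (p : Fin k → ℕ) (t : I → ℕ) {e e′} →
                  e ≗ e′ → Occurrence _≺_ p t e → Occurrence _≺_ p t e′
Occurrence-resp {_≺_ = _≺_} p t e≗e′ (inc , iso) =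
  (λ i j i<j → subst₂ _≺_ (e≗e′ i) (e≗e′ j) (inc i j i<j)) ,
  (λ i j → subst₂ (λ x y → p i < p j ⇔ t x < t y) (e≗e′ i) (e≗e′ j) (iso i j))

∃-function? : ∀ {k m} {P : (Fin k → Fin m) → Set} →
              (∀ {f g} → f ≗ g → P f → P g) → (∀ f → Dec (P f)) → Dec (∃ P)
∃-function? {zero} resp P? =
  map′ (λ p → F.[] , p) (λ (f , p) → resp (λ ()) p) (P? F.[])
∃-function? {suc k} {m} {P} resp P? =
  map′ (λ (x , f , p) → x F.∷ f , p)
       (λ (f , p) → f zero , f ∘ suc , resp (λ { zero → refl ; (suc _) → refl }) p)
       (Fin.any? λ x → ∃-function? {k} {m} {λ f → P (x F.∷ f)}
         (λ f≗g → resp λ { zero → refl ; (suc i) → f≗g i })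
         (λ f → P? (x F.∷ f)))

-- The deciders are abstract to keep counts from unfolding during type-checking.
abstract
  _≼?_ : ∀ {k n} (π : Word k) (τ : Word n) → Dec (π ≼ τ)
  π ≼? τ = ∃-function? (Occurrence-resp {_≺_ = Fin._<_} (entries π) (entries τ))
                       (Occurrence? Fin._<?_ (entries π) (entries τ))

osc-shift : ∀ t p → osc (t * 2 + suc p) ≡ t * 2 + osc (suc p)
osc-shift zero p = refl
osc-shift (suc t) p rewrite +-suc (t * 2) p =
  cong (2 +_) (trans (cong osc (sym (+-suc (t * 2) p))) (osc-shift t p))

osc-lower : ∀ p → p ≤ suc (osc p)
osc-lower 0 = z≤n
osc-lower 1 = s≤s z≤n
osc-lower 2 = s≤s (s≤s z≤n)
osc-lower (suc (suc (suc p))) = s≤s (s≤s (osc-lower (suc p)))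

osc-upper : ∀ p → osc p ≤ 3 + p
osc-upper 0 = s≤s (s≤s z≤n)
osc-upper 1 = ≤-refl
osc-upper 2 = s≤s z≤n
osc-upper (suc (suc (suc p))) = s≤s (s≤s (osc-upper (suc p)))

osc-far : ∀ {p q} → 5 + p ≤ q → osc p < osc q
osc-far {p} {q} 5+p≤q =
  ≤-trans (s≤s (osc-upper p)) (≤-pred (≤-trans 5+p≤q (osc-lower q)))

-- Entries of the oscillation at distance at least 5 are never inverted, so a
-- gap d in an occurrence may be shortened by an even amount as long as it
-- stays at least 5; this bounds the positions that have to be searched.
squash : ∀ d → ∃[ s ] ∃[ u ] (d ≡ u * 2 + s) × (s ≤ 6) × (u ≡ 0 ⊎ 5 ≤ s)
squash d with d <? 7
... | yes d<7 = d , 0 , refl , ≤-pred d<7 , inj₁ refl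
squash 0 | no ¬p = contradiction (s≤s z≤n) ¬p
squash (suc zero) | no ¬p = contradiction (s≤s (s≤s z≤n)) ¬p
squash (suc (suc d)) | no ¬p with squash d
... | s , u , eq , s≤6 , inj₂ 5≤s = s , suc u , cong (2 +_) eq , s≤6 , inj₂ 5≤s
... | s , _ , eq , s≤6 , inj₁ refl =
  s , 1 , cong (2 +_) eq , s≤6 , inj₂ (subst (5 ≤_) eq (≤-pred (≤-pred (≮⇒≥ ¬p))))

record Compressed {k} (e : Fin k → ℕ) (p′ t : ℕ) : Set where
  field
    e′ τ   : Fin k → ℕ
    shift  : ∀ i → e i ≡ τ i * 2 + e′ i
    bound  : ∀ i → e′ i ≤ p′ + 6 * k
    first  : ∀ i → τ i ≡ t ⊎ 5 + p′ ≤ e′ i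
    t≤τ    : ∀ i → t ≤ τ i
    p′≤e′  : ∀ i → p′ ≤ e′ i
    inc    : ∀ i j → i Fin.< j → e′ i < e′ j
    τ-mono : ∀ i j → i Fin.< j → τ i ≤ τ j
    gap    : ∀ i j → i Fin.< j → τ i ≡ τ j ⊎ 5 + e′ i ≤ e′ j

module Extend {k} (e : Fin (suc k) → ℕ) (p′ t s u : ℕ)
              (e₀≡ : e zero ≡ (t + u) * 2 + (p′ + s)) (s≤6 : s ≤ 6) (far : u ≡ 0 ⊎ 5 ≤ s)
              (inc : ∀ i j → i Fin.< j → e i < e j)
              (rest : Compressed (e ∘ suc) (p′ + s) (t + u)) where

  module R = Compressed rest

  e′ τ : Fin (suc k) → ℕ
  e′ zero = p′ + s
  e′ (suc i) = R.e′ i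
  τ zero = t + u
  τ (suc i) = R.τ i

  shift : ∀ i → e i ≡ τ i * 2 + e′ i
  shift zero = e₀≡
  shift (suc i) = R.shift i

  bound : ∀ i → e′ i ≤ p′ + 6 * suc k
  bound zero = +-monoʳ-≤ p′ (≤-trans s≤6 (m≤m*n 6 (suc k)))
  bound (suc i) = begin
    R.e′ i           ≤⟨ R.bound i ⟩
    p′ + s + 6 * k   ≡⟨ +-assoc p′ s (6 * k) ⟩
    p′ + (s + 6 * k) ≤⟨ +-monoʳ-≤ p′ (+-monoˡ-≤ (6 * k) s≤6) ⟩
    p′ + (6 + 6 * k) ≡⟨ cong (_+_ p′) (sym (*-suc 6 k)) ⟩
    p′ + 6 * suc k   ∎
    where open ≤-Reasoning

  first : ∀ i → τ i ≡ t ⊎ 5 + p′ ≤ e′ i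
  first zero =
    [ (λ u≡0 → inj₁ (trans (cong (_+_ t) u≡0) (+-identityʳ t))) ,
      (λ 5≤s → inj₂ (≤-trans (≤-reflexive (+-comm 5 p′)) (+-monoʳ-≤ p′ 5≤s))) ]′ far
  first (suc i) with first zero | R.first i
  ... | inj₂ f | _      = inj₂ (≤-trans f (R.p′≤e′ i))
  ... | inj₁ _ | inj₂ g = inj₂ (≤-trans (+-monoʳ-≤ 5 (m≤m+n p′ s)) g)
  ... | inj₁ a | inj₁ b = inj₁ (trans b a)

  t≤τ : ∀ i → t ≤ τ i
  t≤τ zero = m≤m+n t u
  t≤τ (suc i) = ≤-trans (m≤m+n t u) (R.t≤τ i)

  p′≤e′ : ∀ i → p′ ≤ e′ i
  p′≤e′ zero = m≤m+n p′ s
  p′≤e′ (suc i) = ≤-trans (m≤m+n p′ s) (R.p′≤e′ i)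

  inc′ : ∀ i j → i Fin.< j → e′ i < e′ j
  inc′ zero (suc j) _ with R.first j
  ... | inj₂ f = ≤-trans (+-monoˡ-≤ (p′ + s) (s≤s (z≤n {4}))) f
  ... | inj₁ τ≡ = +-cancelˡ-< ((t + u) * 2) (p′ + s) (R.e′ j)
    (subst₂ _<_ e₀≡ (trans (R.shift j) (cong (λ x → x * 2 + R.e′ j) τ≡))
      (inc zero (suc j) (s≤s z≤n)))
  inc′ (suc i) (suc j) (s≤s i<j) = R.inc i j i<j

  τ-mono : ∀ i j → i Fin.< j → τ i ≤ τ j
  τ-mono zero (suc j) _ = R.t≤τ j
  τ-mono (suc i) (suc j) (s≤s i<j) = R.τ-mono i j i<j

  gap : ∀ i j → i Fin.< j → τ i ≡ τ j ⊎ 5 + e′ i ≤ e′ j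
  gap zero (suc j) _ = [ inj₁ ∘ sym , inj₂ ]′ (R.first j)
  gap (suc i) (suc j) (s≤s i<j) = R.gap i j i<j

  extended : Compressed e p′ t
  extended = record
    { e′ = e′ ; τ = τ ; shift = shift ; bound = bound ; first = first ; t≤τ = t≤τ
    ; p′≤e′ = p′≤e′ ; inc = inc′ ; τ-mono = τ-mono ; gap = gap }

compress : ∀ {k} (e : Fin k → ℕ) p p′ t → p ≡ t * 2 + p′ →
           (∀ i → p ≤ e i) → (∀ i j → i Fin.< j → e i < e j) → Compressed e p′ t
compress {zero} e p p′ t _ _ _ = record
  { e′ = λ () ; τ = λ () ; shift = λ () ; bound = λ () ; first = λ () ; t≤τ = λ ()
  ; p′≤e′ = λ () ; inc = λ () ; τ-mono = λ () ; gap = λ () }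
compress {suc k} e p p′ t p≡ p≤e inc =
  let d , p+d≡e₀ = m≤n⇒∃[o]m+o≡n (p≤e zero)
      s , u , d≡ , s≤6 , far = squash d
      e₀≡ = trans (sym p+d≡e₀) (trans (cong₂ _+_ p≡ d≡) (rearrange t p′ u s))
  in Extend.extended e p′ t s u e₀≡ s≤6 far inc
       (compress (e ∘ suc) (e zero) (p′ + s) (t + u) e₀≡
         (λ i → <⇒≤ (inc zero (suc i) (s≤s z≤n)))
         (λ i j i<j → inc (suc i) (suc j) (s≤s i<j)))
  where
  rearrange : ∀ t p′ u s → (t * 2 + p′) + (u * 2 + s) ≡ (t + u) * 2 + (p′ + s)
  rearrange = solve-∀

module SameOrder {k} (e : Fin k → ℕ) (compressed : Compressed e 0 0) where

  module C = Compressed compressed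

  osc-e : ∀ i → osc (e i) ≡ C.τ i * 2 + osc (C.e′ i)
  osc-e i = trans (cong osc (C.shift i)) (eq (C.τ i) (C.e′ i) (C.first i))
    where
    eq : ∀ t q → t ≡ 0 ⊎ 5 ≤ q → osc (t * 2 + q) ≡ t * 2 + osc q
    eq t q (inj₁ refl) = refl
    eq t (suc q) (inj₂ _) = osc-shift t q

  far : ∀ i j → i Fin.< j → 5 + C.e′ i ≤ C.e′ j → 5 + e i ≤ e j
  far i j i<j g = begin
    5 + e i                  ≡⟨ cong (_+_ 5) (C.shift i) ⟩
    5 + (C.τ i * 2 + C.e′ i) ≡⟨ sym (+-assoc 5 (C.τ i * 2) (C.e′ i)) ⟩
    5 + C.τ i * 2 + C.e′ i   ≡⟨ cong (_+ C.e′ i) (+-comm 5 (C.τ i * 2)) ⟩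
    C.τ i * 2 + 5 + C.e′ i   ≡⟨ +-assoc (C.τ i * 2) 5 (C.e′ i) ⟩
    C.τ i * 2 + (5 + C.e′ i) ≤⟨ +-mono-≤ (*-monoˡ-≤ 2 (C.τ-mono i j i<j)) g ⟩
    C.τ j * 2 + C.e′ j       ≡⟨ sym (C.shift j) ⟩
    e j                      ∎
    where open ≤-Reasoning

  shifted : ∀ {x y x′ y′} a b → x ≡ a * 2 + x′ → y ≡ b * 2 + y′ → a ≡ b → x < y ⇔ x′ < y′
  shifted {x′ = x′} {y′} a _ refl refl refl =
    mk⇔ (+-cancelˡ-< (a * 2) x′ y′) (+-monoʳ-< (a * 2))

  pair : ∀ i j → i Fin.< j → (osc (e i) < osc (e j) ⇔ osc (C.e′ i) < osc (C.e′ j)) ×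
                             (osc (e j) < osc (e i) ⇔ osc (C.e′ j) < osc (C.e′ i))
  pair i j i<j with C.gap i j i<j
  ... | inj₁ τ≡ = shifted (C.τ i) (C.τ j) (osc-e i) (osc-e j) τ≡ ,
                  shifted (C.τ j) (C.τ i) (osc-e j) (osc-e i) (sym τ≡)
  ... | inj₂ g =
    mk⇔ (λ _ → lo) (λ _ → hi) ,
    mk⇔ (λ h → contradiction hi (<-asym h)) (λ h → contradiction lo (<-asym h))
    where
    lo = osc-far g
    hi = osc-far (far i j i<j g)

  same : ∀ i j → osc (e i) < osc (e j) ⇔ osc (C.e′ i) < osc (C.e′ j)
  same i j with Fin.<-cmp i j
  ... | tri< i<j _ _ = proj₁ (pair i j i<j)
  ... | tri> _ _ j<i = proj₂ (pair j i j<i)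
  ... | tri≈ _ refl _ = mk⇔ (λ h → contradiction h (<-irrefl refl))
                            (λ h → contradiction h (<-irrefl refl))

  bounded : ∀ {p} → Occurrence _<_ p osc e →
            ∃[ f ] Occurrence {I = Fin (suc (6 * k))} Fin._<_ p (osc ∘ toℕ) f
  bounded {p} (_ , iso) =
    f , (λ i j i<j → subst₂ _<_ (f≡ i) (f≡ j) (C.inc i j i<j)) ,
    (λ i j → subst₂ (λ x y → p i < p j ⇔ osc x < osc y) (f≡ i) (f≡ j)
      (mk⇔ (Equivalence.to (same i j) ∘ Equivalence.to (iso i j))
           (Equivalence.from (iso i j) ∘ Equivalence.from (same i j))))
    where
    f : Fin k → Fin (suc (6 * k))
    f i = fromℕ< (s≤s (C.bound i))
    f≡ : ∀ i → C.e′ i ≡ toℕ (f i)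
    f≡ i = sym (Fin.toℕ-fromℕ< (s≤s (C.bound i)))

in-osc? : ∀ {k} (p : Fin k → ℕ) → Dec (∃[ e ] Occurrence _<_ p osc e)
in-osc? p = map′
  (λ (f , o) → toℕ ∘ f , o)
  (λ (e , o) → SameOrder.bounded e (compress e 0 0 0 refl (λ _ → z≤n) (proj₁ o)) o)
  (∃-function? (Occurrence-resp {_≺_ = Fin._<_} p (osc ∘ toℕ))
               (Occurrence? Fin._<?_ p (osc ∘ toℕ)))

abstract
  SIO? : ∀ {n} (π : Word n) → Dec (SIO π)
  SIO? π = allPairs? (λ x y → ¬? (x Fin.≟ y)) π ×-dec in-osc? (entries π)

------------------------------------------------------------------------
-- Counting and Wilf-equivalence

-- All vectors of length n over Fin m, each listed once.
words : ∀ m n → List (Vec (Fin m) n)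
words m zero = [] ∷ []
words m (suc n) = cartesianProductWith _∷_ (allFin m) (words m n)

sio : ∀ n → List (Word n)
sio n = filter SIO? (words n n)

c : ℕ → ℕ
c n = length (sio n)

avoiders : ∀ {k} → Word k → ℕ → ℕ
avoiders α m = length (filter (λ σ → ¬? (α ≼? σ)) (sio m))

_∼_ : ∀ {k l} → Word k → Word l → Set
α ∼ β = ∀ m → avoiders α m ≡ avoiders β m

-- w is the number of Wilf-equivalence classes on the permutations of size n
-- in SIO.  This is a relation rather than a function of n because _∼_
-- quantifies over all sizes m and is not decided here.
WilfClasses : ℕ → ℕ → Set
WilfClasses n w =
  Σ[ reps ∈ List (Word n) ]
      length reps ≡ w
    × All SIO reps
    × AllPairs (λ α β → ¬ α ∼ β) reps
    × (∀ (π : Word n) → SIO π → Any (π ∼_) reps)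

¬¬-transversal : ∀ {A : Set} (P : A → Set) (_R_ : Rel A 0ℓ) → (∀ x → x R x) → (xs : List A) →
  All P xs →
  ¬ ¬ (Σ[ reps ∈ List A ]
          All P reps
        × AllPairs (λ x y → ¬ x R y) reps
        × All (λ x → Any (x R_) reps) xs)
¬¬-transversal P _R_ refl′ [] [] k = k ([] , [] , [] , [])
¬¬-transversal P _R_ refl′ (x ∷ xs) (px ∷ pxs) k =
  ¬¬-transversal P _R_ refl′ xs pxs λ (reps , ok , distinct , cover) →
    ¬¬-excluded-middle {A = Any (x R_) reps} λ
      { (yes a) → k (reps , ok , distinct , a ∷ cover)
      ; (no ¬a) → k (x ∷ reps , px ∷ ok , ¬Any⇒All¬ reps ¬a ∷ distinct ,
                     here (refl′ x) ∷ All.map there cover) }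

∈-words : ∀ {m n} (v : Vec (Fin m) n) → v ∈ words m n
∈-words [] = here refl
∈-words (x ∷ v) = ∈-cartesianProductWith⁺ _∷_ (∈-allFin x) (∈-words v)

-- Classically such a w always exists.
WilfClasses-exist : ∀ n → ¬ ¬ (∃[ w ] WilfClasses n w)
WilfClasses-exist n none =
  ¬¬-transversal {Word n} SIO _∼_ (λ _ _ → refl) (sio n) (all-filter SIO? (words n n))
    λ (reps , ok , distinct , cover) → none (length reps , reps , refl , ok , distinct ,
      λ π π∈SIO → All.lookup cover {π} (∈-filter⁺ SIO? {xs = words n n} (∈-words π) π∈SIO))

fromℕ : ℕ → ℚ
fromℕ n = (ℤ.+ n) ℚ./ 1

{-# OPTIONS --safe #-}

-- The inversion graph of the increasing oscillation is an infinite path, so a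
-- permutation in SIO is a sequence of runs of consecutive vertices of that
-- path; a run of at least three vertices comes in two forms, according to the
-- parity of its vertices (312 and 231 for three vertices).  Containment of a
-- sequence of runs is decided by a leftmost search.  The search for a run of
-- three vertices leaves a state that depends only on its parity, and the
-- number of ways to reach it depends only on whether the parity changes with
-- respect to the previous such run.  These numbers combine by convolution, which
-- is commutative, so the factors 312 ⊕ 312 ⊕ 231 and 312 ⊕ 231 ⊕ 231 may be
-- exchanged anywhere in a permutation without changing its Wilf class.
-- Rewriting the first to the second leaves at most a(n) classes, where
-- a(n+10) + a(n) ≤ 2 a(n+9) + a(n+7), whereas all sequences satisfy
-- f(n+3) = 2 f(n+2) + f(n) and therefore grow exponentially faster.
module Submission where

open import Defs
open import Data.Nat using (ℕ; _≥_)
open import Data.Product using (∃-syntax; _×_)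
open import Data.Rational using (ℚ; 0ℚ; 1ℚ; _<_; _≤_; _*_; +-*-rawSemiring)
open import Algebra.Definitions.RawSemiring +-*-rawSemiring using (_^_)

open import Algebra.Bundles using (CommutativeMonoid)
open import Data.Bool using (Bool; true; false; not; if_then_else_; _∧_)
import Data.Bool.Properties as Bool
open import Data.Fin as Fin using (Fin; zero; suc; toℕ; fromℕ<)
import Data.Fin.Properties as Fin
import Data.Integer as ℤ
import Data.Integer.Properties as ℤ
open import Data.List as List using (List; []; _∷_; _++_; length; map; filter; null; tabulate)
import Data.List.Properties as List
open import Data.List.Membership.Propositional using (_∈_)
open import Data.List.Membership.Propositional.Properties
open import Data.List.Membership.Propositional.Properties.WithK using (unique∧set⇒bag)
open import Data.List.Relation.Binary.BagAndSetEquality using (∼bag⇒↭)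
open import Data.List.Relation.Binary.Permutation.Propositional.Properties using (↭-length)
open import Data.List.Relation.Unary.All as All using (All; []; _∷_)
open import Data.List.Relation.Unary.AllPairs using (AllPairs; []; _∷_)
import Data.List.Relation.Unary.AllPairs.Properties as AllPairs
open import Data.List.Relation.Unary.Any as Any using (here; there)
import Data.List.Relation.Unary.Any.Properties as Any
import Data.List.Relation.Unary.Unique.Propositional as UniqueL
import Data.List.Relation.Unary.Unique.Propositional.Properties as UniqueL
open import Data.Nat as ℕ using (zero; suc; _+_; _∸_; z≤n; s≤s; NonZero)
open import Data.Nat.Induction using (<-rec)
import Data.Nat.Properties as ℕ
open import Data.Nat.Tactic.RingSolver using (solve-∀)
open import Data.Product using (Σ-syntax; _,_; proj₁; proj₂)
open import Data.Rational as ℚ using (mkℚ)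
import Data.Rational.Properties as ℚ
open import Data.Rational.Unnormalised as ℚᵘ using (mkℚᵘ; *≤*; *<*; *≡*)
import Data.Rational.Unnormalised.Properties as ℚᵘ
open import Data.Sum using (_⊎_; inj₁; inj₂; [_,_]′)
open import Data.Unit using (⊤; tt)
open import Data.Vec as Vec using ([]; _∷_; lookup)
import Data.Vec.Properties as Vec
open import Data.Vec.Relation.Unary.Unique.Propositional using (Unique)
import Data.Vec.Relation.Unary.Unique.Propositional.Properties as Unique
open import Function using (_∘_; _⇔_; mk⇔; Equivalence; Injective)
open import Relation.Binary using (tri<; tri≈; tri>)
open import Relation.Binary.PropositionalEquality
open import Relation.Nullary using (¬_; Dec; does; yes; no; contradiction)
open import Relation.Nullary.Decidable using (¬?; _×-dec_; _→-dec_; dec-true; dec-false)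
open import Relation.Unary using (Decidable)
open import Algebra.Properties.CommutativeSemigroup (CommutativeMonoid.commutativeSemigroup ℚ.*-1-commutativeMonoid)
  using (interchange; xy∙z≈xz∙y)

-- Only an upper bound on the number of classes is needed, so reduced codes may still be equivalent
-- to each other; it is enough that inequivalent permutations receive different ones. The obstacle
-- in encoding permutations by words is that a run of one or two vertices looks the same at both
-- parities. So only a run of three or more may be recorded as odd, which forces two continuations
-- after `D`. The convolution formula needs the part of a code after a hit to be arbitrary, that is,
-- no run of three vertices may be hit while forced letters remain. Growth rates are compared
-- without roots of characteristic polynomials. As a(n+9) ≤ 3⁹ a(n), the term a(n) gained in the
-- recurrence is a fixed share of its right side. It pays for multiplying a(n) by (u/v)ⁿ with u/v
-- slightly above 1, and the product still satisfies the recurrence of f as an inequality. With u =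
-- (l+1)² and v = l² this yields the factor (l/(l+1))ⁿ twice: one is rⁿ, the other tends to 0 and
-- absorbs all constants and ε.

-- Finite sets, ranks and standardization

injective⇒inverse : ∀ {n} (f : Fin n → Fin n) → Injective _≡_ _≡_ f → ∀ y → ∃[ x ] f x ≡ y
injective⇒inverse {suc n} f inj y with Fin.any? (λ x → f x Fin.≟ y)
... | yes hit = hit
-- If `y` is missed, punching it out of the codomain injects `Fin (suc n)` into `Fin n`.
... | no miss = contradiction (Fin.injective⇒≤ {f = λ x → Fin.punchOut (y≢ x)}
      (λ eq → inj (Fin.punchOut-injective (y≢ _) (y≢ _) eq))) ℕ.1+n≰n
  where
  y≢ : ∀ x → y ≢ f x
  y≢ x y≡ = miss (x , sym y≡)

-- Counting from below gives `i ≤ f i`; counting the `d` larger indices from the top gives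
-- `f i ≤ i`.
increasing⇒id : ∀ {n} (f : Fin n → Fin n) → (∀ i j → i Fin.< j → f i Fin.< f j) → ∀ i → f i ≡ i
increasing⇒id {n} f inc i = Fin.toℕ-injective (ℕ.≤-antisym upper (lower (toℕ i) i refl))
  where
  lower : ∀ a (i : Fin n) → toℕ i ≡ a → a ℕ.≤ toℕ (f i)
  lower zero i _ = z≤n
  lower (suc a) i i≡ = ℕ.≤-trans (s≤s (lower a j j≡)) (inc j i (subst₂ ℕ._<_ (sym j≡) (sym i≡) ℕ.≤-refl))
    where
    a<n : a ℕ.< n
    a<n = ℕ.<-trans (subst (a ℕ.<_) (sym i≡) ℕ.≤-refl) (Fin.toℕ<n i)
    j = fromℕ< a<n
    j≡ = Fin.toℕ-fromℕ< a<n
  below : ∀ d (i : Fin n) → suc (toℕ i) + d ≡ n → toℕ (f i) + d ℕ.< n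
  below zero i _ = subst (ℕ._< n) (sym (ℕ.+-identityʳ _)) (Fin.toℕ<n (f i))
  below (suc d) i i≡ = ℕ.≤-<-trans
    (ℕ.≤-trans (ℕ.≤-reflexive (ℕ.+-suc (toℕ (f i)) d))
      (ℕ.+-monoˡ-≤ d (inc i j (subst (toℕ i ℕ.<_) (sym j≡) ℕ.≤-refl))))
    (below d j (trans (cong (λ x → suc x + d) j≡) (trans (sym (ℕ.+-suc (suc (toℕ i)) d)) i≡)))
    where
    i<n : suc (toℕ i) ℕ.< n
    i<n = subst (suc (toℕ i) ℕ.<_) i≡ (ℕ.m<m+n (suc (toℕ i)) (s≤s z≤n))
    j = fromℕ< i<n
    j≡ = Fin.toℕ-fromℕ< i<n
  upper : toℕ (f i) ℕ.≤ toℕ i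
  upper = ℕ.+-cancelʳ-≤ d (toℕ (f i)) (toℕ i)
    (ℕ.≤-pred (subst (suc (toℕ (f i) + d) ℕ.≤_) (sym eq) (below d i eq)))
    where
    d = n ∸ suc (toℕ i)
    eq : suc (toℕ i) + d ≡ n
    eq = ℕ.m+[n∸m]≡n (Fin.toℕ<n i)

rank : ∀ {n} → (Fin n → ℕ) → ℕ → ℕ
rank {zero} q x = 0
rank {suc n} q x with q zero ℕ.<? x
... | yes _ = suc (rank (q ∘ suc) x)
... | no  _ = rank (q ∘ suc) x

rank-mono : ∀ {n} (q : Fin n → ℕ) {x y} → x ℕ.≤ y → rank q x ℕ.≤ rank q y
rank-mono {zero} q x≤y = z≤n
rank-mono {suc n} q {x} {y} x≤y with q zero ℕ.<? x | q zero ℕ.<? y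
... | yes _ | yes _ = s≤s (rank-mono (q ∘ suc) x≤y)
... | yes p | no ¬p = contradiction (ℕ.<-≤-trans p x≤y) ¬p
... | no  _ | yes _ = ℕ.m≤n⇒m≤1+n (rank-mono (q ∘ suc) x≤y)
... | no  _ | no  _ = rank-mono (q ∘ suc) x≤y

rank-strict : ∀ {n} (q : Fin n → ℕ) i {y} → q i ℕ.< y → rank q (q i) ℕ.< rank q y
rank-strict {suc n} q zero {y} q<y with q zero ℕ.<? q zero | q zero ℕ.<? y
... | yes p | _     = contradiction p (ℕ.<-irrefl refl)
... | no  _ | yes _ = s≤s (rank-mono (q ∘ suc) (ℕ.<⇒≤ q<y))
... | no  _ | no ¬p = contradiction q<y ¬p
rank-strict {suc n} q (suc i) {y} q<y with q zero ℕ.<? q (suc i) | q zero ℕ.<? y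
... | yes _ | yes _ = s≤s (rank-strict (q ∘ suc) i q<y)
... | yes p | no ¬p = contradiction (ℕ.<-trans p q<y) ¬p
... | no  _ | yes _ = ℕ.m≤n⇒m≤1+n (rank-strict (q ∘ suc) i q<y)
... | no  _ | no  _ = rank-strict (q ∘ suc) i q<y

rank≤n : ∀ {n} (q : Fin n → ℕ) x → rank q x ℕ.≤ n
rank≤n {zero} q x = z≤n
rank≤n {suc n} q x with q zero ℕ.<? x
... | yes _ = s≤s (rank≤n (q ∘ suc) x)
... | no  _ = ℕ.m≤n⇒m≤1+n (rank≤n (q ∘ suc) x)

order-reflecting : ∀ {A : Set} {f g : A → ℕ} → (∀ {x y} → g x ≡ g y → x ≡ y) →
  (∀ x y → g x ℕ.< g y → f x ℕ.< f y) → ∀ x y → f x ℕ.< f y → g x ℕ.< g y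
order-reflecting {f = f} {g} inj mono x y fx<fy with ℕ.<-cmp (g x) (g y)
... | tri< gx<gy _ _ = gx<gy
... | tri≈ _ gx≡gy _ = contradiction fx<fy (ℕ.<-irrefl (cong f (inj gx≡gy)))
... | tri> _ _ gy<gx = contradiction fx<fy (ℕ.<-asym (mono y x gy<gx))

-- Replacing each value by its rank gives the permutation order-isomorphic to `q`; the inverse `ρ⁻¹`
-- lists the indices by increasing value.
module Standardize {n} (q : Fin n → ℕ) (q-inj : ∀ {i j} → q i ≡ q j → i ≡ j) where

  rank<n : ∀ i → rank q (q i) ℕ.< n
  rank<n i = ℕ.<-≤-trans (rank-strict q i ℕ.≤-refl) (rank≤n q (suc (q i)))

  ρ : Fin n → Fin n
  ρ i = fromℕ< (rank<n i)

  ρ-mono : ∀ i j → q i ℕ.< q j → ρ i Fin.< ρ j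
  ρ-mono i j lt = subst₂ ℕ._<_ (sym (Fin.toℕ-fromℕ< (rank<n i))) (sym (Fin.toℕ-fromℕ< (rank<n j)))
    (rank-strict q i lt)

  ρ-reflects : ∀ i j → ρ i Fin.< ρ j → q i ℕ.< q j
  ρ-reflects = order-reflecting {f = toℕ ∘ ρ} {q} q-inj ρ-mono

  ρ-inj : Injective _≡_ _≡_ ρ
  ρ-inj {i} {j} eq with ℕ.<-cmp (q i) (q j)
  ... | tri< lt _ _ = contradiction (ρ-mono i j lt) (ℕ.<-irrefl (cong toℕ eq))
  ... | tri≈ _ q≡ _ = q-inj q≡
  ... | tri> _ _ gt = contradiction (ρ-mono j i gt) (ℕ.<-irrefl (cong toℕ (sym eq)))

  ρ⁻¹ : Fin n → Fin n
  ρ⁻¹ i = proj₁ (injective⇒inverse ρ ρ-inj i)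

  ρ-ρ⁻¹ : ∀ i → ρ (ρ⁻¹ i) ≡ i
  ρ-ρ⁻¹ i = proj₂ (injective⇒inverse ρ ρ-inj i)

  ρ⁻¹-ρ : ∀ i → ρ⁻¹ (ρ i) ≡ i
  ρ⁻¹-ρ i = ρ-inj (ρ-ρ⁻¹ (ρ i))

  ρ⁻¹-inj : ∀ {i j} → ρ⁻¹ i ≡ ρ⁻¹ j → i ≡ j
  ρ⁻¹-inj {i} {j} eq = trans (sym (ρ-ρ⁻¹ i)) (trans (cong ρ eq) (ρ-ρ⁻¹ j))

  sorted : ∀ i j → i Fin.< j → q (ρ⁻¹ i) ℕ.< q (ρ⁻¹ j)
  sorted i j i<j = ρ-reflects (ρ⁻¹ i) (ρ⁻¹ j) (subst₂ Fin._<_ (sym (ρ-ρ⁻¹ i)) (sym (ρ-ρ⁻¹ j)) i<j)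

  word : Word n
  word = Vec.tabulate ρ

  word-unique : Unique word
  word-unique = Unique.tabulate⁺ ρ-inj

  word-order : ∀ i j → entries word i ℕ.< entries word j ⇔ q i ℕ.< q j
  word-order i j = mk⇔
    (λ h → ρ-reflects i j (subst₂ Fin._<_ (eq i) (eq j) h))
    (λ h → subst₂ Fin._<_ (sym (eq i)) (sym (eq j)) (ρ-mono i j h))
    where
    eq : ∀ i → lookup word i ≡ ρ i
    eq = Vec.lookup∘tabulate ρ

-- The values of σ as a function of those of π is an increasing map of Fin n.
≼-same-size : ∀ {n} {π σ : Word n} → Unique π → π ≼ σ → π ≡ σ
≼-same-size {n} {π} {σ} uπ (e , inc , iso) =
  trans (sym (Vec.tabulate∘lookup π)) (trans (Vec.tabulate-cong same) (Vec.tabulate∘lookup σ))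
  where
  π⁻¹ : ∀ v → ∃[ i ] lookup π i ≡ v
  π⁻¹ = injective⇒inverse (lookup π) (λ {i} {j} → Unique.lookup-injective uπ i j)
  g : Fin n → Fin n
  g v = lookup σ (e (proj₁ (π⁻¹ v)))
  g-inc : ∀ u v → u Fin.< v → g u Fin.< g v
  g-inc u v u<v = Equivalence.to (iso _ _)
    (subst₂ Fin._<_ (sym (proj₂ (π⁻¹ u))) (sym (proj₂ (π⁻¹ v))) u<v)
  same : ∀ i → lookup π i ≡ lookup σ i
  same i = trans (sym (increasing⇒id g g-inc (lookup π i)))
    (cong (lookup σ) (trans (increasing⇒id e inc _)
      (Unique.lookup-injective uπ _ _ (proj₂ (π⁻¹ (lookup π i))))))

-- The path of the oscillation

-- The inversion graph of the increasing oscillation is a path.  The entry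
-- at vertex v of this path has position P v and value Q v.
P : ℕ → ℕ
P 0 = 0
P 1 = 2
P 2 = 1
P (suc (suc (suc v))) = 2 + P (suc v)

Q : ℕ → ℕ
Q v = osc (P v)

-- Being its own inverse, `P` also sends a position to its vertex, so an occurrence `e` visits the
-- vertices `P ∘ e`.
P-involutive : ∀ v → P (P v) ≡ v
P-involutive 0 = refl
P-involutive 1 = refl
P-involutive 2 = refl
P-involutive (suc (suc (suc v))) with P (suc v) | P-involutive (suc v)
... | suc w | eq = cong (2 +_) eq

P-injective : ∀ {u v} → P u ≡ P v → u ≡ v
P-injective {u} {v} eq = trans (sym (P-involutive u)) (trans (cong P eq) (P-involutive v))

P-suc : ∀ v → ∃[ w ] P (suc v) ≡ suc w
P-suc 0 = 1 , refl
P-suc 1 = 0 , refl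
P-suc (suc (suc v)) = suc (P (suc v)) , refl

Q-step : ∀ v → Q (2 + v) ≡ 2 + Q v
Q-step 0 = refl
Q-step (suc v) with P (suc v) | P-suc v
... | suc w | _ = refl

P-lower : ∀ v → v ℕ.≤ suc (P v)
P-lower 0 = z≤n
P-lower 1 = s≤s z≤n
P-lower 2 = s≤s (s≤s z≤n)
P-lower (suc (suc (suc v))) = s≤s (s≤s (P-lower (suc v)))

Q-positive : ∀ v → 1 ℕ.≤ Q v
Q-positive 0 = s≤s z≤n
Q-positive 1 = s≤s z≤n
Q-positive (suc (suc v)) = subst (1 ℕ.≤_) (sym (Q-step v)) (s≤s z≤n)

P-far : ∀ x d → P x ℕ.< P (x + (2 + d))
P-far 0 d = ℕ.≤-pred (ℕ.≤-trans (s≤s (s≤s z≤n)) (P-lower (2 + d)))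
P-far 1 0 = s≤s (s≤s (s≤s z≤n))
P-far 1 (suc d) = s≤s (s≤s (ℕ.≤-pred (ℕ.≤-trans (s≤s (s≤s z≤n)) (P-lower (2 + d)))))
P-far 2 d = s≤s (s≤s z≤n)
P-far (suc (suc (suc x))) d = s≤s (s≤s (P-far (suc x) d))

Q-far : ∀ x d → Q x ℕ.< Q (x + (2 + d))
Q-far 0 d = subst (2 ℕ.<_) (sym (Q-step d)) (s≤s (s≤s (Q-positive d)))
Q-far 1 d = subst (1 ℕ.<_) (sym (Q-step (suc d))) (s≤s (s≤s z≤n))
Q-far (suc (suc x)) d = subst₂ ℕ._<_ (sym (Q-step x)) (sym (Q-step (x + (2 + d))))
  (s≤s (s≤s (Q-far x d)))

even : ℕ → Bool
even 0 = true
even (suc n) = not (even n)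

even-2+ : ∀ n → even (2 + n) ≡ even n
even-2+ n = Bool.not-involutive (even n)

-- In every inversion the even vertex is the earlier and larger entry. This asymmetry is how
-- containment sees parity.
adjacent-even : ∀ x → even x ≡ true → P x ℕ.< P (suc x) × Q (suc x) ℕ.< Q x
adjacent-even 0 _ = s≤s z≤n , s≤s (s≤s z≤n)
adjacent-even 2 _ = s≤s (s≤s z≤n) , s≤s (s≤s (s≤s (s≤s z≤n)))
adjacent-even (suc (suc (suc x))) e
  with adjacent-even (suc x) (trans (sym (even-2+ (suc x))) e)
... | p , q = s≤s (s≤s p) ,
  subst₂ ℕ._<_ (sym (Q-step (2 + x))) (sym (Q-step (suc x))) (s≤s (s≤s q))

adjacent-odd : ∀ x → even x ≡ false → P (suc x) ℕ.< P x × Q x ℕ.< Q (suc x)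
adjacent-odd 1 _ = s≤s (s≤s z≤n) , s≤s (s≤s z≤n)
adjacent-odd (suc (suc (suc x))) o
  with adjacent-odd (suc x) (trans (sym (even-2+ (suc x))) o)
... | p , q = s≤s (s≤s p) ,
  subst₂ ℕ._<_ (sym (Q-step (suc x))) (sym (Q-step (2 + x))) (s≤s (s≤s q))

far : ∀ {x y} → 2 + x ℕ.≤ y → P x ℕ.< P y × Q x ℕ.< Q y
far {x} {y} le with ℕ.m≤n⇒∃[o]m+o≡n le
... | d , refl = subst (λ y → P x ℕ.< P y × Q x ℕ.< Q y) eq (P-far x d , Q-far x d)
  where
  eq : x + (2 + d) ≡ 2 + x + d
  eq = trans (sym (ℕ.+-assoc x 2 d)) (cong (_+ d) (ℕ.+-comm x 2))

data Position (x y : ℕ) : Set where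
  below    : 2 + x ℕ.≤ y → Position x y
  before   : y ≡ suc x → Position x y
  same     : x ≡ y → Position x y
  after    : x ≡ suc y → Position x y
  above    : 2 + y ℕ.≤ x → Position x y

position : ∀ x y → Position x y
position x y with ℕ.<-cmp x y
... | tri≈ _ x≡y _ = same x≡y
... | tri< x<y _ _ with ℕ.m≤n⇒m<n∨m≡n x<y
...   | inj₁ lt = below lt
...   | inj₂ eq = before (sym eq)
position x y | tri> _ _ y<x with ℕ.m≤n⇒m<n∨m≡n y<x
...   | inj₁ lt = above lt
...   | inj₂ eq = after (sym eq)

non-inverted⇒far : ∀ {x y} → P x ℕ.< P y → Q x ℕ.< Q y → 2 + x ℕ.≤ y
non-inverted⇒far {x} {y} p q with position x y
... | below le = le
... | same refl = contradiction p (ℕ.<-irrefl refl)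
... | above le = contradiction p (ℕ.<-asym (proj₁ (far le)))
... | before refl with even x in eq
...   | true = contradiction q (ℕ.<-asym (proj₂ (adjacent-even x eq)))
...   | false = contradiction p (ℕ.<-asym (proj₁ (adjacent-odd x eq)))
non-inverted⇒far {x} {y} p q | after refl with even y in eq
...   | true = contradiction p (ℕ.<-asym (proj₁ (adjacent-even y eq)))
...   | false = contradiction q (ℕ.<-asym (proj₂ (adjacent-odd y eq)))

inverted⇒adjacent : ∀ {x y} → P x ℕ.< P y → Q y ℕ.< Q x →
                    even x ≡ true × (y ≡ suc x ⊎ x ≡ suc y)
inverted⇒adjacent {x} {y} p q with position x y
... | below le = contradiction q (ℕ.<-asym (proj₂ (far le)))
... | same refl = contradiction p (ℕ.<-irrefl refl)
... | above le = contradiction p (ℕ.<-asym (proj₁ (far le)))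
... | before refl with even x in eq
...   | true = refl , inj₁ refl
...   | false = contradiction p (ℕ.<-asym (proj₁ (adjacent-odd x eq)))
inverted⇒adjacent {x} {y} p q | after refl with even y in eq
...   | true = contradiction p (ℕ.<-asym (proj₁ (adjacent-even y eq)))
...   | false = refl , inj₂ refl

Q-adjacent : ∀ x → Q x ≢ Q (suc x)
Q-adjacent x eq with even x in ev
... | true = ℕ.<⇒≢ (proj₂ (adjacent-even x ev)) (sym eq)
... | false = ℕ.<⇒≢ (proj₂ (adjacent-odd x ev)) eq

Q-injective : ∀ {x y} → Q x ≡ Q y → x ≡ y
Q-injective {x} {y} eq with position x y
... | below le = contradiction eq (ℕ.<⇒≢ (proj₂ (far le)))
... | before refl = contradiction eq (Q-adjacent x)
... | same x≡y = x≡y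
... | after refl = contradiction (sym eq) (Q-adjacent y)
... | above le = contradiction (sym eq) (ℕ.<⇒≢ (proj₂ (far le)))

-- Permutations drawn on vertices of the path

-- `π` is the pattern of the oscillation's entries at exactly the vertices of `S`. Containment of
-- drawn permutations then becomes a question about subsets of the path.
record Drawing {n} (π : Word n) (S : ℕ → Set) : Set where
  field
    vertex    : Fin n → ℕ
    vertex∈   : ∀ i → S (vertex i)
    index     : ∀ {x} → S x → ∃[ i ] vertex i ≡ x
    position< : ∀ i j → i Fin.< j → P (vertex i) ℕ.< P (vertex j)
    value<    : ∀ i j → entries π i ℕ.< entries π j ⇔ Q (vertex i) ℕ.< Q (vertex j)

  vertex-injective : ∀ {i j} → vertex i ≡ vertex j → i ≡ j
  vertex-injective {i} {j} eq with Fin.<-cmp i j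
  ... | tri< i<j _ _ = contradiction (position< i j i<j) (ℕ.<-irrefl (cong P eq))
  ... | tri≈ _ i≡j _ = i≡j
  ... | tri> _ _ j<i = contradiction (position< j i j<i) (ℕ.<-irrefl (cong P (sym eq)))

  position<⁻¹ : ∀ i j → P (vertex i) ℕ.< P (vertex j) → i Fin.< j
  position<⁻¹ = order-reflecting {f = P ∘ vertex} {toℕ} Fin.toℕ-injective position<

draw : ∀ {n} (V : Fin n → ℕ) → Injective _≡_ _≡_ V →
       Σ[ π ∈ Word n ] Unique π × Drawing π (λ x → ∃[ i ] V i ≡ x)
draw V V-inj = Val.word , Val.word-unique , record
  { vertex = W
  ; vertex∈ = λ i → Pos.ρ⁻¹ i , refl
  ; index = λ { (i , refl) → Pos.ρ i , cong V (Pos.ρ⁻¹-ρ i) }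
  ; position< = Pos.sorted
  ; value< = Val.word-order }
  where
  module Pos = Standardize (P ∘ V) (V-inj ∘ P-injective)
  -- These are the vertices in order of position; ranking their values gives the one-line notation.
  W = V ∘ Pos.ρ⁻¹
  module Val = Standardize (Q ∘ W) (Pos.ρ⁻¹-inj ∘ V-inj ∘ Q-injective)

Drawing-resp : ∀ {n} {π : Word n} {S T : ℕ → Set} → (∀ {x} → S x → T x) → (∀ {x} → T x → S x) →
               Drawing π S → Drawing π T
Drawing-resp S⊆T T⊆S d = record
  { vertex = vertex ; vertex∈ = S⊆T ∘ vertex∈ ; index = index ∘ T⊆S
  ; position< = position< ; value< = value< }
  where open Drawing d

lookup-injective : ∀ {xs : List ℕ} → AllPairs ℕ._<_ xs → Injective _≡_ _≡_ (List.lookup xs)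
lookup-injective (_ ∷ _) {zero} {zero} _ = refl
lookup-injective {x ∷ xs} (x< ∷ _) {zero} {suc j} eq =
  contradiction eq (ℕ.<⇒≢ (All.lookup x< (∈-lookup {xs = xs} j)))
lookup-injective {x ∷ xs} (x< ∷ _) {suc i} {zero} eq =
  contradiction (sym eq) (ℕ.<⇒≢ (All.lookup x< (∈-lookup {xs = xs} i)))
lookup-injective (_ ∷ xs<) {suc i} {suc j} eq = cong suc (lookup-injective xs< eq)

draw-list : ∀ {n} (xs : List ℕ) → AllPairs ℕ._<_ xs → length xs ≡ n →
            Σ[ π ∈ Word n ] Unique π × Drawing π (_∈ xs)
draw-list xs xs< refl with draw (List.lookup xs) (lookup-injective xs<)
... | π , uπ , d = π , uπ , Drawing-resp
  (λ { (i , refl) → ∈-lookup i }) (λ x∈ → Any.index x∈ , sym (Any.lookup-index x∈)) d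

drawing⇒SIO : ∀ {n} {π : Word n} {S} → Unique π → Drawing π S → SIO π
drawing⇒SIO uπ d = uπ , P ∘ vertex , position< , value<
  where open Drawing d

SIO⇒drawing : ∀ {n} {π : Word n} → SIO π →
              Σ[ xs ∈ List ℕ ] AllPairs ℕ._<_ xs × length xs ≡ n × Drawing π (_∈ xs)
SIO⇒drawing {n} {π} (uπ , e , inc , iso) =
  tabulate V , AllPairs.tabulate⁺-< (λ {i} {j} → S.sorted i j) , List.length-tabulate V , record
    { vertex = P ∘ e
    ; vertex∈ = λ i → subst (_∈ tabulate V) (cong (P ∘ e) (S.ρ⁻¹-ρ i)) (∈-tabulate⁺ (S.ρ i))
    ; index = λ x∈ → let i , eq = ∈-tabulate⁻ x∈ in S.ρ⁻¹ i , sym eq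
    ; position< = λ i j i<j → subst₂ ℕ._<_ (sym (P-involutive (e i))) (sym (P-involutive (e j))) (inc i j i<j)
    ; value< = λ i j → subst₂ (λ x y → entries π i ℕ.< entries π j ⇔ osc x ℕ.< osc y)
        (sym (P-involutive (e i))) (sym (P-involutive (e j))) (iso i j) }
  where
  Pe-inj : ∀ {i j} → P (e i) ≡ P (e j) → i ≡ j
  Pe-inj {i} {j} eq with Fin.<-cmp i j
  ... | tri< i<j _ _ = contradiction (inc i j i<j) (ℕ.<-irrefl (P-injective eq))
  ... | tri≈ _ i≡j _ = i≡j
  ... | tri> _ _ j<i = contradiction (inc j i j<i) (ℕ.<-irrefl (P-injective (sym eq)))
  module S = Standardize (P ∘ e) Pe-inj
  V = P ∘ e ∘ S.ρ⁻¹

-- An occurrence in terms of the path: non-inversions stay apart in the same order, and inversions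
-- stay adjacent with the even vertex going to the even one. Nothing asks `F` to keep the direction
-- of an adjacent pair.
record Morphism (S T : ℕ → Set) (F : ℕ → ℕ) : Set where
  field
    into     : ∀ {x} → S x → T (F x)
    apart    : ∀ {x y} → S x → S y → 2 + x ℕ.≤ y → 2 + F x ℕ.≤ F y
    adjacent : ∀ {x} → S x → S (suc x) →
               even (F x) ≡ even x × (F (suc x) ≡ suc (F x) ⊎ F x ≡ suc (F (suc x)))

  inverted : ∀ {x} → S x → S (suc x) → even x ≡ true →
             P (F x) ℕ.< P (F (suc x)) × Q (F (suc x)) ℕ.< Q (F x)
  inverted {x} sx sx′ ev with adjacent sx sx′
  ... | par , inj₁ eq rewrite eq = adjacent-even (F x) (trans par ev)
  ... | par , inj₂ eq = subst (λ z → P z ℕ.< P (F (suc x)) × Q (F (suc x)) ℕ.< Q z) (sym eq)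
    (adjacent-odd (F (suc x)) (flip (trans (cong even (sym eq)) (trans par ev))))
    where
    flip : ∀ {b} → not b ≡ true → b ≡ false
    flip {false} _ = refl

  inverted′ : ∀ {x} → S x → S (suc x) → even x ≡ false →
              P (F (suc x)) ℕ.< P (F x) × Q (F x) ℕ.< Q (F (suc x))
  inverted′ {x} sx sx′ od with adjacent sx sx′
  ... | par , inj₁ eq rewrite eq = adjacent-odd (F x) (trans par od)
  ... | par , inj₂ eq = subst (λ z → P (F (suc x)) ℕ.< P z × Q z ℕ.< Q (F (suc x))) (sym eq)
    (adjacent-even (F (suc x)) (flip (trans (cong even (sym eq)) (trans par od))))
    where
    flip : ∀ {b} → not b ≡ false → b ≡ true
    flip {true} _ = refl

  monotone : ∀ {x y} → S x → S y →
             (P x ℕ.< P y → P (F x) ℕ.< P (F y)) × (Q x ℕ.< Q y → Q (F x) ℕ.< Q (F y))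
  monotone {x} {y} sx sy with position x y
  ... | below le = (λ _ → proj₁ (far (apart sx sy le))) , (λ _ → proj₂ (far (apart sx sy le)))
  ... | same refl = (λ lt → contradiction lt (ℕ.<-irrefl refl)) , (λ lt → contradiction lt (ℕ.<-irrefl refl))
  ... | above le = (λ lt → contradiction lt (ℕ.<-asym (proj₁ (far le)))) ,
                   (λ lt → contradiction lt (ℕ.<-asym (proj₂ (far le))))
  ... | before refl with even x in eq
  ...   | true = (λ _ → proj₁ (inverted sx sy eq)) ,
                 (λ lt → contradiction lt (ℕ.<-asym (proj₂ (adjacent-even x eq))))
  ...   | false = (λ lt → contradiction lt (ℕ.<-asym (proj₁ (adjacent-odd x eq)))) ,
                  (λ _ → proj₂ (inverted′ sx sy eq))
  monotone {x} {y} sx sy | after refl with even y in eq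
  ...   | true = (λ lt → contradiction lt (ℕ.<-asym (proj₁ (adjacent-even y eq)))) ,
                 (λ _ → proj₂ (inverted sy sx eq))
  ...   | false = (λ _ → proj₁ (inverted′ sy sx eq)) ,
                  (λ lt → contradiction lt (ℕ.<-asym (proj₂ (adjacent-odd y eq))))

module _ {k n} {π : Word k} {τ : Word n} {S T : ℕ → Set} (dπ : Drawing π S) (dτ : Drawing τ T) where
  private
    module π = Drawing dπ
    module τ = Drawing dτ

  morphism⇒≼ : ∀ {F} → Morphism S T F → π ≼ τ
  morphism⇒≼ {F} mor = f , inc , λ i j → mk⇔ (mono i j)
    (λ lt → Equivalence.from (π.value< i j)
      (order-reflecting {f = entries τ ∘ f} {Q ∘ π.vertex} (π.vertex-injective ∘ Q-injective)
        (λ i j → mono i j ∘ Equivalence.from (π.value< i j)) i j lt))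
    where
    open Morphism mor
    f : Fin k → Fin n
    f i = proj₁ (τ.index (into (π.vertex∈ i)))
    f≡ : ∀ i → F (π.vertex i) ≡ τ.vertex (f i)
    f≡ i = sym (proj₂ (τ.index (into (π.vertex∈ i))))
    inc : ∀ i j → i Fin.< j → f i Fin.< f j
    inc i j i<j = τ.position<⁻¹ (f i) (f j) (subst₂ (λ x y → P x ℕ.< P y) (f≡ i) (f≡ j)
      (proj₁ (monotone (π.vertex∈ i) (π.vertex∈ j)) (π.position< i j i<j)))
    mono : ∀ i j → entries π i ℕ.< entries π j → entries τ (f i) ℕ.< entries τ (f j)
    mono i j lt = Equivalence.from (τ.value< (f i) (f j)) (subst₂ (λ x y → Q x ℕ.< Q y) (f≡ i) (f≡ j)
      (proj₂ (monotone (π.vertex∈ i) (π.vertex∈ j)) (Equivalence.to (π.value< i j) lt)))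

  ≼⇒morphism : π ≼ τ → ∃[ F ] Morphism S T F
  ≼⇒morphism (f , inc , iso) = F , record { into = into ; apart = apart ; adjacent = adjacent }
    where
    F : ℕ → ℕ
    F x with Fin.any? (λ i → π.vertex i ℕ.≟ x)
    ... | yes (i , _) = τ.vertex (f i)
    -- A default outside `S`, where a morphism is subject to no condition.
    ... | no _ = 0
    find : ∀ {x} → S x → ∃[ i ] π.vertex i ≡ x × F x ≡ τ.vertex (f i)
    find {x} sx with Fin.any? (λ i → π.vertex i ℕ.≟ x)
    ... | yes (i , eq) = i , eq , refl
    ... | no ¬i = contradiction (π.index sx) ¬i
    into : ∀ {x} → S x → T (F x)
    into sx with find sx
    ... | i , _ , eq = subst T (sym eq) (τ.vertex∈ (f i))
    P-mono : ∀ {x y} → S x → S y → P x ℕ.< P y → P (F x) ℕ.< P (F y)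
    P-mono sx sy lt with find sx | find sy
    ... | i , refl , eqi | j , refl , eqj = subst₂ (λ x y → P x ℕ.< P y) (sym eqi) (sym eqj)
      (τ.position< (f i) (f j) (inc i j (π.position<⁻¹ i j lt)))
    Q-mono : ∀ {x y} → S x → S y → Q x ℕ.< Q y → Q (F x) ℕ.< Q (F y)
    Q-mono sx sy lt with find sx | find sy
    ... | i , refl , eqi | j , refl , eqj = subst₂ (λ x y → Q x ℕ.< Q y) (sym eqi) (sym eqj)
      (Equivalence.to (τ.value< (f i) (f j)) (Equivalence.to (iso i j) (Equivalence.from (π.value< i j) lt)))
    apart : ∀ {x y} → S x → S y → 2 + x ℕ.≤ y → 2 + F x ℕ.≤ F y
    apart sx sy le = non-inverted⇒far (P-mono sx sy (proj₁ (far le))) (Q-mono sx sy (proj₂ (far le)))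
    adjacent : ∀ {x} → S x → S (suc x) →
               even (F x) ≡ even x × (F (suc x) ≡ suc (F x) ⊎ F x ≡ suc (F (suc x)))
    adjacent {x} sx sx′ with even x in eq
    ... | true with adjacent-even x eq
    ...   | p , q = inverted⇒adjacent (P-mono sx sx′ p) (Q-mono sx′ sx q)
    adjacent {x} sx sx′ | false with adjacent-odd x eq
    ...   | p , q with inverted⇒adjacent (P-mono sx′ sx p) (Q-mono sx sx′ q)
    ...     | par , inj₁ eq′ = trans (cong even eq′) (cong not par) , inj₂ eq′
    ...     | par , inj₂ eq′ = unflip (trans (sym (cong even eq′)) par) , inj₁ eq′
      where
      unflip : ∀ {b} → not b ≡ true → b ≡ false
      unflip {false} _ = refl

-- Runs and their embeddings

-- C continues the current run of path vertices; S b starts a new run at the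
-- next vertex of parity b (true for even) that leaves a gap.
data Micro : Set where
  C : Micro
  S : Bool → Micro

next : Bool → ℕ → ℕ
next b v with even v Bool.≟ b
... | yes _ = 2 + v
... | no _ = 3 + v

next-gap : ∀ b v → 2 + v ℕ.≤ next b v
next-gap b v with even v Bool.≟ b
... | yes _ = ℕ.≤-refl
... | no _ = ℕ.n≤1+n (2 + v)

even-next : ∀ b v → even (next b v) ≡ b
even-next b v with even v Bool.≟ b
... | yes eq = trans (even-2+ v) eq
... | no ne = trans (cong not (even-2+ v)) (sym (Bool.¬-not (ne ∘ sym)))

vertices : ℕ → List Micro → List ℕ
vertices v [] = []
vertices v (C ∷ m) = suc v ∷ vertices (suc v) m
vertices v (S b ∷ m) = next b v ∷ vertices (next b v) m

length-vertices : ∀ v m → length (vertices v m) ≡ length m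
length-vertices v [] = refl
length-vertices v (C ∷ m) = cong suc (length-vertices (suc v) m)
length-vertices v (S b ∷ m) = cong suc (length-vertices (next b v) m)

vertices> : ∀ {x} v m → x ∈ vertices v m → v ℕ.< x
vertices> v (C ∷ m) (here refl) = ℕ.≤-refl
vertices> v (C ∷ m) (there x∈) = ℕ.<-trans ℕ.≤-refl (vertices> (suc v) m x∈)
vertices> v (S b ∷ m) (here refl) = ℕ.<⇒≤ (next-gap b v)
vertices> v (S b ∷ m) (there x∈) = ℕ.<-trans (ℕ.<⇒≤ (next-gap b v)) (vertices> (next b v) m x∈)

vertices-S≥ : ∀ {x} v b m → x ∈ vertices v (S b ∷ m) → next b v ℕ.≤ x
vertices-S≥ v b m (here refl) = ℕ.≤-refl
vertices-S≥ v b m (there x∈) = ℕ.<⇒≤ (vertices> (next b v) m x∈)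

vertices-sorted : ∀ v m → AllPairs ℕ._<_ (vertices v m)
vertices-sorted v [] = []
vertices-sorted v (C ∷ m) = All.tabulate (vertices> (suc v) m) ∷ vertices-sorted (suc v) m
vertices-sorted v (S b ∷ m) = All.tabulate (vertices> (next b v) m) ∷ vertices-sorted (next b v) m

-- (n , e) is a run of n + 1 path vertices, the last of which has parity e.
-- The parity matters only for runs of at least three vertices.
Block : Set
Block = ℕ × Bool

runs : ℕ → Bool → List Micro → List Block
runs n e [] = (n , e) ∷ []
runs n e (C ∷ m) = runs (suc n) (not e) m
runs n e (S b ∷ m) = (n , e) ∷ runs 0 b m

parse : List Micro → List Block
parse [] = []
-- A leading continuation sits at vertex 1, which is odd.
parse (C ∷ m) = runs 0 false m
parse (S b ∷ m) = runs 0 b m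

Fits : (ℕ → Set) → ℕ → Block → ℕ → Set
Fits T lo (n , e) c = lo ℕ.≤ c × (∀ i → i ℕ.≤ n → T (c + i)) × (2 ℕ.≤ n → even (c + n) ≡ e)

Embeds : (ℕ → Set) → ℕ → List Block → Set
Embeds T lo [] = ⊤
Embeds T lo (b ∷ p) = ∃[ c ] Fits T lo b c × Embeds T (2 + (c + proj₁ b)) p

Embeds-anti : ∀ {T lo lo′} p → lo ℕ.≤ lo′ → Embeds T lo′ p → Embeds T lo p
Embeds-anti [] _ _ = tt
Embeds-anti (b ∷ p) le (c , (lo≤ , fit) , rest) = c , (ℕ.≤-trans le lo≤ , fit) , rest

adjacent-≤ : ∀ {x y} → y ≡ suc x ⊎ x ≡ suc y → y ℕ.≤ suc x
adjacent-≤ (inj₁ refl) = ℕ.≤-refl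
adjacent-≤ (inj₂ refl) = ℕ.m≤n⇒m≤1+n (ℕ.n≤1+n _)

-- A backward step would leave an adjacent step, of length one, to gain the distance of at least two
-- over both. The adjacent step is the next one or, at the end of the run, the previous one; this is
-- where `2 ≤ n` enters.
forward : ∀ n (G : ℕ → ℕ) → 2 ℕ.≤ n →
  (∀ j → suc j ℕ.≤ n → G (suc j) ≡ suc (G j) ⊎ G j ≡ suc (G (suc j))) →
  (∀ j → 2 + j ℕ.≤ n → 2 + G j ℕ.≤ G (2 + j)) →
  ∀ j → suc j ℕ.≤ n → G (suc j) ≡ suc (G j)
forward n G 2≤n adj apart j j<n with adj j j<n
... | inj₁ eq = eq
... | inj₂ eq with 2 + j ℕ.≤? n
...   | yes le = contradiction
  (ℕ.≤-trans (subst (λ x → 2 + x ℕ.≤ G (2 + j)) eq (apart j le)) (adjacent-≤ (adj (suc j) le)))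
  (ℕ.<⇒≱ (s≤s (s≤s (ℕ.n≤1+n _))))
forward n G 2≤n adj apart zero j<n | inj₂ eq | no ¬le = contradiction 2≤n ¬le
forward n G 2≤n adj apart (suc j) j<n | inj₂ eq | no ¬le = contradiction
  (ℕ.≤-trans (s≤s (apart j j<n)) (ℕ.≤-trans (ℕ.≤-reflexive (sym eq)) (adjacent-≤ (adj j (ℕ.<⇒≤ j<n)))))
  (ℕ.<⇒≱ (s≤s (s≤s (ℕ.n≤1+n _))))

even-+-cong : ∀ a c n → even a ≡ even c → even (a + n) ≡ even (c + n)
even-+-cong a c zero eq rewrite ℕ.+-identityʳ a | ℕ.+-identityʳ c = eq
even-+-cong a c (suc n) eq rewrite ℕ.+-suc a n | ℕ.+-suc c n = cong not (even-+-cong a c n eq)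

even-+-cancel : ∀ a c n → even (a + n) ≡ even (c + n) → even a ≡ even c
even-+-cancel a c zero eq rewrite ℕ.+-identityʳ a | ℕ.+-identityʳ c = eq
even-+-cancel a c (suc n) eq rewrite ℕ.+-suc a n | ℕ.+-suc c n = even-+-cancel a c n (Bool.not-injective eq)

-- A run of two vertices may be reversed, which exchanges the parities of its ends. From three
-- vertices on `forward` fixes the direction, and the parity of the last vertex is kept.
run-image : ∀ {D T F} → Morphism D T F → ∀ a n → (∀ j → j ℕ.≤ n → D (a + j)) →
  ∃[ c ] (∀ i → i ℕ.≤ n → ∃[ j ] j ℕ.≤ n × F (a + j) ≡ c + i) ×
         (2 ℕ.≤ n → even (c + n) ≡ even (a + n))
run-image {D} {T} {F} mor a n run = by-length n refl
  where
  Image : Set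
  Image = ∃[ c ] (∀ i → i ℕ.≤ n → ∃[ j ] j ℕ.≤ n × F (a + j) ≡ c + i) ×
                 (2 ℕ.≤ n → even (c + n) ≡ even (a + n))
  open Morphism mor
  G : ℕ → ℕ
  G j = F (a + j)
  adj : ∀ j → suc j ℕ.≤ n → even (G j) ≡ even (a + j) × (G (suc j) ≡ suc (G j) ⊎ G j ≡ suc (G (suc j)))
  adj j lt with run (suc j) lt
  ... | d rewrite ℕ.+-suc a j = adjacent (run j (ℕ.<⇒≤ lt)) d
  by-length : ∀ n′ → n′ ≡ n → Image
  by-length 0 refl = G 0 , (λ { 0 _ → 0 , z≤n , sym (ℕ.+-identityʳ _) }) , λ ()
  by-length 1 refl with proj₂ (adj 0 ℕ.≤-refl)
  ... | inj₁ eq = G 0 ,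
    (λ { 0 _ → 0 , z≤n , sym (ℕ.+-identityʳ _)
       ; 1 _ → 1 , ℕ.≤-refl , trans eq (ℕ.+-comm 1 _)
       ; (suc (suc _)) (s≤s ()) }) , λ { (s≤s ()) }
  ... | inj₂ eq = G 1 ,
    (λ { 0 _ → 1 , ℕ.≤-refl , sym (ℕ.+-identityʳ _)
       ; 1 _ → 0 , z≤n , trans eq (ℕ.+-comm 1 _)
       ; (suc (suc _)) (s≤s ()) }) , λ { (s≤s ()) }
  by-length (suc (suc n′)) refl = G 0 , (λ i i≤n → i , i≤n , line i i≤n) ,
    λ _ → trans (cong even (sym (line n ℕ.≤-refl))) par
    where
    step : ∀ j → suc j ℕ.≤ n → G (suc j) ≡ suc (G j)
    step = forward n G (s≤s (s≤s z≤n)) (λ j lt → proj₂ (adj j lt))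
      (λ j le → apart (run j (ℕ.<⇒≤ (ℕ.<⇒≤ le))) (run (2 + j) le)
        (ℕ.≤-reflexive (sym (trans (ℕ.+-suc a (suc j)) (cong suc (ℕ.+-suc a j))))))
    line : ∀ i → i ℕ.≤ n → G i ≡ G 0 + i
    line zero _ = sym (ℕ.+-identityʳ _)
    line (suc i) lt = trans (step i lt) (trans (cong suc (line i (ℕ.<⇒≤ lt))) (sym (ℕ.+-suc (G 0) i)))
    par : even (G n) ≡ even (a + n)
    par = trans (cong even (step (suc n′) ℕ.≤-refl)) (trans (cong not (proj₁ (adj (suc n′) ℕ.≤-refl)))
      (cong even (sym (ℕ.+-suc a (suc n′)))))

closed-run : ∀ {D T F} → Morphism D T F → ∀ {a n v lo} → v ≡ a + n →
  (∀ j → j ℕ.≤ n → D (a + j) × lo ℕ.≤ F (a + j)) →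
  ∃[ c ] Fits T lo (n , even v) c × ∃[ j ] j ℕ.≤ n × F (a + j) ≡ c + n
closed-run {T = T} mor {a} {n} {v} {lo} v≡ run
  with c , hit , par ← run-image mor a n (λ j → proj₁ ∘ run j)
  with j , j≤n , eq ← hit 0 z≤n =
  c ,
  ( subst (lo ℕ.≤_) (trans eq (ℕ.+-identityʳ c)) (proj₂ (run j j≤n))
  , (λ i i≤n → let j , j≤n , eq = hit i i≤n in subst T eq (into (proj₁ (run j j≤n))))
  , (λ 2≤n → trans (par 2≤n) (cong even (sym v≡))) ) ,
  hit n ℕ.≤-refl
  where open Morphism mor

-- The pattern is scanned with the current run from `a` to `v` in hand; its image becomes a block
-- once the run is closed.
morphism⇒embeds : ∀ {D T F} → Morphism D T F → ∀ m {a n v lo} → v ≡ a + n →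
  (∀ j → j ℕ.≤ n → D (a + j) × lo ℕ.≤ F (a + j)) →
  (∀ {x} → x ∈ vertices v m → D x × lo ℕ.≤ F x) → Embeds T lo (runs n (even v) m)
morphism⇒embeds {D} {T} {F} mor (C ∷ m) {a} {n} {v} {lo} v≡ run rest =
  morphism⇒embeds mor m (trans (cong suc v≡) (sym (ℕ.+-suc a n)))
    (λ j j≤ → run′ j (ℕ.m≤n⇒m<n∨m≡n j≤)) (rest ∘ there)
  where
  run′ : ∀ j → j ℕ.< suc n ⊎ j ≡ suc n → D (a + j) × lo ℕ.≤ F (a + j)
  run′ j (inj₁ lt) = run j (ℕ.≤-pred lt)
  run′ j (inj₂ refl) = subst (λ x → D x × lo ℕ.≤ F x) (trans (cong suc v≡) (sym (ℕ.+-suc a n)))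
    (rest (here refl))
morphism⇒embeds {D} {T} {F} mor m@[] {a} {n} {v} {lo} v≡ run rest =
  let c , fits , _ = closed-run mor v≡ run in c , fits , tt
morphism⇒embeds {D} {T} {F} mor (S b ∷ m) {a} {n} {v} {lo} v≡ run rest
  with c , fits , j , j≤n , top ← closed-run mor v≡ run =
  c , fits , subst (λ e → Embeds T (2 + (c + n)) (runs 0 e m)) (even-next b v)
    (morphism⇒embeds mor m (sym (ℕ.+-identityʳ (next b v)))
      (λ { zero z≤n → later (here (ℕ.+-identityʳ _)) })
      (later ∘ there))
  where
  open Morphism mor
  later : ∀ {x} → x ∈ vertices v (S b ∷ m) → D x × 2 + (c + n) ℕ.≤ F x
  later {x} x∈ = proj₁ (rest x∈) , subst (λ z → 2 + z ℕ.≤ F x) top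
    (apart (proj₁ (run j j≤n)) (proj₁ (rest x∈))
      (ℕ.≤-trans (s≤s (s≤s (ℕ.≤-trans (ℕ.+-monoʳ-≤ a j≤n) (ℕ.≤-reflexive (sym v≡)))))
        (ℕ.≤-trans (next-gap b v) (vertices-S≥ v b m x∈))))

Points : ℕ → ℕ → ℕ → List Micro → ℕ → Set
Points a n v m x = (∃[ j ] j ℕ.≤ n × x ≡ a + j) ⊎ x ∈ vertices v m

-- A run of two vertices may have to be reversed.
run-map : ∀ {T lo} a {n e c} → Fits T lo (n , e) c → e ≡ even (a + n) →
  ∃[ F ] Morphism (λ x → ∃[ j ] j ℕ.≤ n × x ≡ a + j) T F ×
         (∀ j → j ℕ.≤ n → c ℕ.≤ F (a + j) × F (a + j) ℕ.≤ c + n)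
run-map {T} a {n} {e} {c} (_ , T∋ , par) e≡ = from-offsets n refl
  where
  Result : Set
  Result = ∃[ F ] Morphism (λ x → ∃[ j ] j ℕ.≤ n × x ≡ a + j) T F ×
                  (∀ j → j ℕ.≤ n → c ℕ.≤ F (a + j) × F (a + j) ℕ.≤ c + n)
  Offsets : (ℕ → ℕ) → Set
  Offsets G = (∀ j → j ℕ.≤ n → ∃[ i ] i ℕ.≤ n × G j ≡ c + i) ×
    (∀ j k → 2 + j ℕ.≤ k → k ℕ.≤ n → 2 + G j ℕ.≤ G k) ×
    (∀ j → suc j ℕ.≤ n → even (G j) ≡ even (a + j) × (G (suc j) ≡ suc (G j) ⊎ G j ≡ suc (G (suc j))))
  assemble : ∀ G → Offsets G → Result
  assemble G (hit , apart , adj) = F , record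
    { into = λ { (j , j≤n , refl) → let i , i≤n , eq = hit j j≤n in
        subst T (sym (trans (F≡ j) eq)) (T∋ i i≤n) }
    ; apart = λ { (j , j≤n , refl) (k , k≤n , refl) le → subst₂ (λ x y → 2 + x ℕ.≤ y) (sym (F≡ j)) (sym (F≡ k))
        (apart j k (ℕ.+-cancelˡ-≤ a (2 + j) k (ℕ.≤-trans (ℕ.≤-reflexive (shift j)) le)) k≤n) }
    ; adjacent = λ { (j , j≤n , refl) (k , k≤n , eq) →
        adjacent j k (ℕ.+-cancelˡ-≡ a k (suc j) (trans (sym eq) (sym (ℕ.+-suc a j)))) k≤n eq } } ,
    λ j j≤n → let i , i≤n , eq = hit j j≤n in
      subst (c ℕ.≤_) (sym (trans (F≡ j) eq)) (ℕ.m≤m+n c i) ,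
      subst (ℕ._≤ c + n) (sym (trans (F≡ j) eq)) (ℕ.+-monoʳ-≤ c i≤n)
    where
    F : ℕ → ℕ
    F x = G (x ∸ a)
    F≡ : ∀ j → F (a + j) ≡ G j
    F≡ j = cong G (ℕ.m+n∸m≡n a j)
    shift : ∀ j → a + (2 + j) ≡ 2 + (a + j)
    shift j = trans (ℕ.+-suc a (suc j)) (cong suc (ℕ.+-suc a j))
    adjacent : ∀ j k → k ≡ suc j → k ℕ.≤ n → suc (a + j) ≡ a + k → even (F (a + j)) ≡ even (a + j) ×
      (F (suc (a + j)) ≡ suc (F (a + j)) ⊎ F (a + j) ≡ suc (F (suc (a + j))))
    adjacent j k refl k≤n eq rewrite eq | F≡ j | F≡ (suc j) = adj j k≤n
  parallel : even c ≡ even a ⊎ n ≡ 0 → Offsets (c +_)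
  parallel par≡ = (λ j j≤n → j , j≤n , refl) ,
    (λ j k le _ → ℕ.≤-trans (ℕ.≤-reflexive (sym (trans (ℕ.+-suc c (suc j)) (cong suc (ℕ.+-suc c j)))))
      (ℕ.+-monoʳ-≤ c le)) ,
    λ j j<n → par′ j j<n par≡ , inj₁ (ℕ.+-suc c j)
    where
    par′ : ∀ j → suc j ℕ.≤ n → even c ≡ even a ⊎ n ≡ 0 → even (c + j) ≡ even (a + j)
    par′ j _ (inj₁ eq) = even-+-cong c a j eq
    par′ j () (inj₂ refl)
  swap : ℕ → ℕ
  swap zero = suc c
  swap (suc _) = c
  from-offsets : ∀ n′ → n′ ≡ n → Result
  from-offsets 0 refl = assemble (c +_) (parallel (inj₂ refl))
  from-offsets (suc (suc n′)) refl = assemble (c +_)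
    (parallel (inj₁ (even-+-cancel c a n (trans (par (s≤s (s≤s z≤n))) e≡))))
  from-offsets 1 refl with even c Bool.≟ even a
  ... | yes eq = assemble (c +_) (parallel (inj₁ eq))
  ... | no ne = assemble swap
    ( (λ { zero _ → 1 , ℕ.≤-refl , ℕ.+-comm 1 c ; (suc _) _ → 0 , z≤n , sym (ℕ.+-identityʳ c) })
    , (λ j k le k≤1 → contradiction (ℕ.≤-trans le k≤1) λ { (s≤s ()) })
    , λ { zero _ → trans (sym (Bool.¬-not (ne ∘ sym))) (cong even (sym (ℕ.+-identityʳ a))) , inj₂ refl
        ; (suc _) (s≤s ()) } )

-- The maps of the separate runs are glued at `v`. The image of the first run ends by `c + n`, and
-- the lower bound returned by the recursion puts all later images at least two vertices beyond it.
embeds⇒morphism : ∀ {T} m {a n v lo} → v ≡ a + n → Embeds T lo (runs n (even v) m) →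
  ∃[ F ] Morphism (Points a n v m) T F × (∀ {x} → Points a n v m x → lo ℕ.≤ F x)
embeds⇒morphism {T} [] {a} {lo = lo} v≡ (c , fits , _)
  with F , mor , bounds ← run-map {T} {lo} a fits (cong even v≡) = F ,
  record { into = λ { (inj₁ r) → into mor r }
         ; apart = λ { (inj₁ r) (inj₁ r′) → apart mor r r′ }
         ; adjacent = λ { (inj₁ r) (inj₁ r′) → adjacent mor r r′ } } ,
  λ { (inj₁ (j , j≤n , refl)) → ℕ.≤-trans (proj₁ fits) (proj₁ (bounds j j≤n)) }
  where open Morphism
embeds⇒morphism {T} (C ∷ m) {a} {n} {v} v≡ emb
  with F , mor , low ← embeds⇒morphism {T} m {a} {suc n} {suc v} (trans (cong suc v≡) (sym (ℕ.+-suc a n))) emb = F ,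
  record { into = into mor ∘ regroup
         ; apart = λ r r′ → apart mor (regroup r) (regroup r′)
         ; adjacent = λ r r′ → adjacent mor (regroup r) (regroup r′) } ,
  low ∘ regroup
  where
  open Morphism
  regroup : ∀ {x} → Points a n v (C ∷ m) x → Points a (suc n) (suc v) m x
  regroup (inj₁ (j , j≤n , eq)) = inj₁ (j , ℕ.m≤n⇒m≤1+n j≤n , eq)
  regroup (inj₂ (here refl)) = inj₁ (suc n , ℕ.≤-refl , trans (cong suc v≡) (sym (ℕ.+-suc a n)))
  regroup (inj₂ (there x∈)) = inj₂ x∈
embeds⇒morphism {T} (S b ∷ m) {a} {n} {v} {lo} v≡ (c , fits , emb)
  with G , G-mor , bounds ← run-map {T} {lo} a fits (cong even v≡)
  with H , H-mor , low ← embeds⇒morphism {T} m {next b v} {0} {next b v} (sym (ℕ.+-identityʳ _))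
    (subst (λ e → Embeds T (2 + (c + n)) (runs 0 e m)) (sym (even-next b v)) emb) =
  F , record { into = into ; apart = apart ; adjacent = adjacent } , low′
  where
  module G = Morphism G-mor
  module H = Morphism H-mor
  Run Later : ℕ → Set
  Run x = ∃[ j ] j ℕ.≤ n × x ≡ a + j
  Later x = x ∈ vertices v (S b ∷ m)
  later : ∀ {x} → Later x → Points (next b v) 0 (next b v) m x
  later (here refl) = inj₁ (0 , z≤n , sym (ℕ.+-identityʳ _))
  later (there x∈) = inj₂ x∈
  run≤ : ∀ {x} → Run x → x ℕ.≤ v
  run≤ (j , j≤n , refl) = ℕ.≤-trans (ℕ.+-monoʳ-≤ a j≤n) (ℕ.≤-reflexive (sym v≡))
  later≥ : ∀ {x} → Later x → 2 + v ℕ.≤ x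
  later≥ x∈ = ℕ.≤-trans (next-gap b v) (vertices-S≥ v b m x∈)
  F : ℕ → ℕ
  F x with x ℕ.≤? v
  ... | yes _ = G x
  ... | no _ = H x
  F-run : ∀ {x} → x ℕ.≤ v → F x ≡ G x
  F-run {x} le with x ℕ.≤? v
  ... | yes _ = refl
  ... | no ¬le = contradiction le ¬le
  F-later : ∀ {x} → 2 + v ℕ.≤ x → F x ≡ H x
  F-later {x} le with x ℕ.≤? v
  ... | yes x≤v = contradiction (ℕ.≤-trans le x≤v) (ℕ.<⇒≱ (ℕ.n≤1+n _))
  ... | no _ = refl
  into : ∀ {x} → Points a n v (S b ∷ m) x → T (F x)
  into (inj₁ r) = subst T (sym (F-run (run≤ r))) (G.into r)
  into (inj₂ l) = subst T (sym (F-later (later≥ l))) (H.into (later l))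
  apart : ∀ {x y} → Points a n v (S b ∷ m) x → Points a n v (S b ∷ m) y → 2 + x ℕ.≤ y → 2 + F x ℕ.≤ F y
  apart (inj₁ r) (inj₁ r′) rewrite F-run (run≤ r) | F-run (run≤ r′) = G.apart r r′
  apart (inj₁ r@(j , j≤n , refl)) (inj₂ l) _ rewrite F-run (run≤ r) | F-later (later≥ l) =
    ℕ.≤-trans (s≤s (s≤s (proj₂ (bounds j j≤n)))) (low (later l))
  apart (inj₂ l) (inj₁ r) le = contradiction
    (ℕ.≤-trans (ℕ.≤-trans (s≤s (s≤s (later≥ l))) le) (run≤ r))
    (ℕ.<⇒≱ (ℕ.m≤n+m (suc v) 3))
  apart (inj₂ l) (inj₂ l′) rewrite F-later (later≥ l) | F-later (later≥ l′) = H.apart (later l) (later l′)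
  adjacent : ∀ {x} → Points a n v (S b ∷ m) x → Points a n v (S b ∷ m) (suc x) →
    even (F x) ≡ even x × (F (suc x) ≡ suc (F x) ⊎ F x ≡ suc (F (suc x)))
  adjacent (inj₁ r) (inj₁ r′) rewrite F-run (run≤ r) | F-run (run≤ r′) = G.adjacent r r′
  adjacent (inj₁ r) (inj₂ l) = contradiction (ℕ.≤-trans (later≥ l) (s≤s (run≤ r))) (ℕ.<⇒≱ ℕ.≤-refl)
  adjacent (inj₂ l) (inj₁ r) = contradiction (ℕ.≤-trans (s≤s (later≥ l)) (run≤ r))
    (ℕ.<⇒≱ (ℕ.m≤n+m (suc v) 2))
  adjacent (inj₂ l) (inj₂ l′) rewrite F-later (later≥ l) | F-later (later≥ l′) = H.adjacent (later l) (later l′)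
  low′ : ∀ {x} → Points a n v (S b ∷ m) x → lo ℕ.≤ F x
  low′ (inj₁ r@(j , j≤n , refl)) rewrite F-run (run≤ r) = ℕ.≤-trans (proj₁ fits) (proj₁ (bounds j j≤n))
  low′ (inj₂ l) rewrite F-later (later≥ l) = ℕ.≤-trans
    (ℕ.≤-trans (proj₁ fits) (ℕ.≤-trans (ℕ.m≤m+n c n) (ℕ.m≤n+m (c + n) 2))) (low (later l))

embeds⇒morphism₀ : ∀ {T lo} m → Embeds T lo (parse m) → ∃[ F ] Morphism (_∈ vertices 0 m) T F
embeds⇒morphism₀ [] _ = (λ x → x) , record { into = λ () ; apart = λ () ; adjacent = λ () }
embeds⇒morphism₀ (C ∷ m) emb with F , mor , _ ← embeds⇒morphism m {1} {0} refl emb = F ,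
  record { into = into ∘ point ; apart = λ x y → apart (point x) (point y)
         ; adjacent = λ x y → adjacent (point x) (point y) }
  where
  open Morphism mor
  point : ∀ {x} → x ∈ vertices 0 (C ∷ m) → Points 1 0 1 m x
  point (here refl) = inj₁ (0 , z≤n , refl)
  point (there x∈) = inj₂ x∈
embeds⇒morphism₀ {T} {lo} (S b ∷ m) emb with F , mor , _ ←
  embeds⇒morphism m {next b 0} {0} (sym (ℕ.+-identityʳ _))
    (subst (λ e → Embeds T lo (runs 0 e m)) (sym (even-next b 0)) emb) = F ,
  record { into = into ∘ point ; apart = λ x y → apart (point x) (point y)
         ; adjacent = λ x y → adjacent (point x) (point y) }
  where
  open Morphism mor
  point : ∀ {x} → x ∈ vertices 0 (S b ∷ m) → Points (next b 0) 0 (next b 0) m x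
  point (here refl) = inj₁ (0 , z≤n , sym (ℕ.+-identityʳ _))
  point (there x∈) = inj₂ x∈

morphism⇒embeds₀ : ∀ {T F} m → (∀ {x} → T x → 1 ℕ.≤ x) → Morphism (_∈ vertices 0 m) T F →
                   Embeds T 1 (parse m)
morphism⇒embeds₀ [] _ mor = tt
morphism⇒embeds₀ {T} {F} (C ∷ m) pos mor = morphism⇒embeds mor m {1} {0} refl
  (λ { zero z≤n → here refl , pos (into (here refl)) }) (λ x∈ → there x∈ , pos (into (there x∈)))
  where open Morphism mor
morphism⇒embeds₀ {T} {F} (S b ∷ m) pos mor = subst (λ e → Embeds T 1 (runs 0 e m)) (even-next b 0)
  (morphism⇒embeds mor m (sym (ℕ.+-identityʳ (next b 0)))
    (λ { zero z≤n → here (ℕ.+-identityʳ _) , pos (into (here (ℕ.+-identityʳ _))) })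
    (λ x∈ → there x∈ , pos (into (there x∈))))
  where open Morphism mor

-- Leftmost search

-- The leftmost embedding of a sequence of runs, found by reading the text once.
-- The last k ∸ 1 vertices read are consecutive and free, and the last one has
-- parity t; k = 0 means that it has just been used, so that a continuation
-- of its run is too close to be used as well.
Hit : Block → ℕ → Bool → Set
Hit (n , e) k t = 2 + n ℕ.≤ k × (2 ℕ.≤ n → t ≡ e)

hit? : ∀ b k t → Dec (Hit b k t)
hit? (n , e) k t = (2 + n ℕ.≤? k) ×-dec ((2 ℕ.≤? n) →-dec (t Bool.≟ e))

accepts proceed : List Block → ℕ → Bool → List Micro → Bool

accepts [] k t m = true
accepts (b ∷ p) k t [] = false
accepts p@(_ ∷ _) k t (C ∷ m) = proceed p (suc k) (not t) m
-- The vertex starting a run is one free vertex, hence the counter 2.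
accepts p@(_ ∷ _) k t (S c ∷ m) = proceed p 2 c m

proceed [] k t m = true
proceed (b ∷ p) k t m = if does (hit? b k t) then accepts p 0 t m else accepts (b ∷ p) k t m

proceed-hit : ∀ b p {k t} m → Hit b k t → proceed (b ∷ p) k t m ≡ accepts p 0 t m
proceed-hit b p {k} {t} m h =
  cong (λ x → if x then accepts p 0 t m else accepts (b ∷ p) k t m) (dec-true (hit? b k t) h)

proceed-miss : ∀ b p {k t} m → ¬ Hit b k t → proceed (b ∷ p) k t m ≡ accepts (b ∷ p) k t m
proceed-miss b p {k} {t} m ¬h =
  cong (λ x → if x then accepts p 0 t m else accepts (b ∷ p) k t m) (dec-false (hit? b k t) ¬h)

module Reading (T : ℕ → Set) where

  Unread : ℕ → List Micro → Set
  Unread v m = (∀ {x} → v ℕ.< x → T x → x ∈ vertices v m) × (∀ {x} → x ∈ vertices v m → T x)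

  Free : ℕ → ℕ → Set
  Free lo v = ∀ {x} → lo ℕ.≤ x → x ℕ.≤ v → T x

  Missed : ℕ → ℕ → List Block → Set
  Missed lo v [] = ⊤
  Missed lo v (b ∷ _) = ∀ c → Fits T lo b c → v ℕ.< c + proj₁ b

  unread-C : ∀ {v m} → Unread v (C ∷ m) → Unread (suc v) m
  unread-C {v} {m} (⊆ , ⊇) = (λ lt Tx → tail lt (⊆ (ℕ.<-trans ℕ.≤-refl lt) Tx)) , ⊇ ∘ there
    where
    tail : ∀ {x} → suc v ℕ.< x → x ∈ vertices v (C ∷ m) → x ∈ vertices (suc v) m
    tail lt (here refl) = contradiction lt (ℕ.<-irrefl refl)
    tail lt (there x∈) = x∈

  unread-S : ∀ {v b m} → Unread v (S b ∷ m) → Unread (next b v) m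
  unread-S {v} {b} {m} (⊆ , ⊇) =
    (λ lt Tx → tail lt (⊆ (ℕ.<-trans (ℕ.<⇒≤ (next-gap b v)) lt) Tx)) , ⊇ ∘ there
    where
    tail : ∀ {x} → next b v ℕ.< x → x ∈ vertices v (S b ∷ m) → x ∈ vertices (next b v) m
    tail lt (here refl) = contradiction lt (ℕ.<-irrefl refl)
    tail lt (there x∈) = x∈

  -- A placement that ends after `v` cannot begin at or before `v + 1`, since it would then use
  -- `v + 1`, which lies in the gap.
  skip-gap : ∀ {v b m lo B c} → Unread v (S b ∷ m) → Fits T lo B c → v ℕ.< c + proj₁ B → next b v ℕ.≤ c
  skip-gap {v} {b} {m} {c = c} (⊆ , _) (_ , T∋ , _) v< with c ℕ.≤? suc v
  ... | yes c≤ with i , eq ← ℕ.m≤n⇒∃[o]m+o≡n c≤ =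
    contradiction (ℕ.≤-trans (next-gap b v) (vertices-S≥ v b m (⊆ ℕ.≤-refl
      (subst T eq (T∋ i (ℕ.+-cancelˡ-≤ c i _ (ℕ.≤-trans (ℕ.≤-reflexive eq) v<)))))))
      (ℕ.<⇒≱ ℕ.≤-refl)
  ... | no c≰ = vertices-S≥ v b m (⊆ (ℕ.<⇒≤ (ℕ.≰⇒> c≰)) (subst T (ℕ.+-identityʳ c) (T∋ 0 z≤n)))

  -- By `lo + k ≡ 2 + v`, `lo` is the first vertex that the next block may use: the free stretch
  -- from `lo` to `v` has `k ∸ 1` vertices, and `lo = 2 + v` after a hit. `Missed` says that no
  -- placement was overlooked, so a hit ends no later than the block does in the given embedding,
  -- and the later blocks keep their room by `Embeds-anti`.
  accepts-complete : ∀ p {lo} k v m → lo + k ≡ 2 + v → Unread v m → Missed lo v p →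
                     Embeds T lo p → accepts p k (even v) m ≡ true
  proceed-complete : ∀ p {lo} k v m → lo + k ≡ 2 + v → Unread v m →
                   (∀ u → v ≡ suc u → Missed lo u p) →
                   1 ℕ.≤ v → Embeds T lo p → proceed p k (even v) m ≡ true

  accepts-complete [] k v m _ _ _ _ = refl
  accepts-complete ((n , e) ∷ p) k v [] _ (⊆ , _) miss (c , fits@(_ , T∋ , _) , _) =
    contradiction (⊆ (miss c fits) (T∋ n ℕ.≤-refl)) λ ()
  accepts-complete p@(_ ∷ _) {lo} k v (C ∷ m) lo+k unread miss emb =
    proceed-complete p (suc k) (suc v) m (trans (ℕ.+-suc lo k) (cong suc lo+k)) (unread-C unread)
      (λ { u refl → miss }) (s≤s z≤n) emb
  accepts-complete (b ∷ p) {lo} k v (S a ∷ m) lo+k unread miss (c , fits@(_ , fit) , emb) =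
    subst (λ t → proceed (b ∷ p) 2 t m ≡ true) (even-next a v)
      (proceed-complete (b ∷ p) 2 (next a v) m (ℕ.+-comm (next a v) 2) (unread-S unread)
        (λ u eq c (le , _) → ℕ.≤-trans (ℕ.≤-reflexive (sym eq)) (ℕ.≤-trans le (ℕ.m≤m+n c _)))
        (ℕ.≤-trans (s≤s z≤n) (next-gap a v))
        (c , (skip-gap {B = b} unread fits (miss c fits) , fit) , emb))

  proceed-complete [] k v m _ _ _ _ _ = refl
  proceed-complete ((n , e) ∷ p) {lo} k (suc v) m lo+k unread miss _ emb@(c , fits , rest)
    with hit? (n , e) k (even (suc v))
  ... | yes hit = trans (proceed-hit (n , e) p m hit)
    (accepts-complete p 0 (suc v) m (ℕ.+-identityʳ _) unread (missed p)
      (Embeds-anti p (s≤s (s≤s (miss v refl c fits))) rest))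
    where
    missed : ∀ p → Missed (2 + suc v) (suc v) p
    missed [] = tt
    missed (b ∷ _) c (le , _) = ℕ.≤-trans (ℕ.≤-trans (ℕ.n≤1+n _) le) (ℕ.m≤m+n c _)
  ... | no ¬hit = trans (proceed-miss (n , e) p m ¬hit)
    (accepts-complete ((n , e) ∷ p) k (suc v) m lo+k unread missed emb)
    where
    missed : ∀ c → Fits T lo (n , e) c → suc v ℕ.< c + n
    missed c fits@(lo≤c , _ , par) = ℕ.≤∧≢⇒< (miss v refl c fits) λ eq →
      ¬hit (ℕ.+-cancelˡ-≤ c (2 + n) k (begin
        c + (2 + n)    ≡⟨ trans (ℕ.+-suc c (suc n)) (cong suc (ℕ.+-suc c n)) ⟩
        2 + (c + n)    ≡⟨ cong (2 +_) (sym eq) ⟩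
        2 + suc v      ≡⟨ sym lo+k ⟩
        lo + k         ≤⟨ ℕ.+-monoˡ-≤ k lo≤c ⟩
        c + k          ∎) , λ 2≤n → trans (cong even eq) (par 2≤n))
      where open ℕ.≤-Reasoning

  accepts-sound : ∀ p {lo} k v m → lo + k ≡ 2 + v → Unread v m → Free lo v →
                  accepts p k (even v) m ≡ true → Embeds T lo p
  proceed-sound : ∀ p {lo} k v m → lo + k ≡ 2 + v → Unread v m → Free lo v →
                proceed p k (even v) m ≡ true → Embeds T lo p

  accepts-sound [] k v m _ _ _ _ = tt
  accepts-sound p@(_ ∷ _) {lo} k v (C ∷ m) lo+k unread free acc =
    proceed-sound p (suc k) (suc v) m (trans (ℕ.+-suc lo k) (cong suc lo+k)) (unread-C unread)
      (λ lo≤x x≤v → free′ lo≤x (ℕ.m≤n⇒m<n∨m≡n x≤v)) acc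
    where
    free′ : ∀ {x} → lo ℕ.≤ x → x ℕ.< suc v ⊎ x ≡ suc v → T x
    free′ lo≤x (inj₁ lt) = free lo≤x (ℕ.≤-pred lt)
    free′ _ (inj₂ refl) = proj₂ unread (here refl)
  accepts-sound p@(_ ∷ _) {lo} k v (S a ∷ m) lo+k unread free acc =
    Embeds-anti p (ℕ.≤-trans (ℕ.≤-trans (ℕ.m≤m+n lo k) (ℕ.≤-reflexive lo+k)) (next-gap a v))
      (proceed-sound p 2 (next a v) m (ℕ.+-comm (next a v) 2) (unread-S unread)
        (λ le ge → subst T (ℕ.≤-antisym le ge) (proj₂ unread (here refl)))
        (subst (λ t → proceed p 2 t m ≡ true) (sym (even-next a v)) acc))

  proceed-sound [] k v m _ _ _ _ = tt
  proceed-sound ((n , e) ∷ p) {lo} k v m lo+k unread free acc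
    with hit? (n , e) k (even v)
  ... | no ¬hit = accepts-sound ((n , e) ∷ p) k v m lo+k unread free
          (trans (sym (proceed-miss (n , e) p m ¬hit)) acc)
  ... | yes hit@(2+n≤k , par) = d , (lo≤d , (λ i i≤n → free (ℕ.≤-trans lo≤d (ℕ.m≤m+n d i))
          (ℕ.≤-trans (ℕ.+-monoʳ-≤ d i≤n) (ℕ.≤-reflexive d+n≡v))) ,
          λ 2≤n → trans (cong even d+n≡v) (par 2≤n)) ,
        subst (λ x → Embeds T (2 + x) p) (sym d+n≡v)
          (accepts-sound p 0 v m (ℕ.+-identityʳ _) unread
            (λ le ge → contradiction (ℕ.≤-trans le ge) (ℕ.<⇒≱ (ℕ.n≤1+n _)))
            (trans (sym (proceed-hit (n , e) p m hit)) acc))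
    where
    -- The block is placed so as to end at the vertex just read.
    d = v ∸ n
    lo+n≤v : lo + n ℕ.≤ v
    lo+n≤v = ℕ.+-cancelˡ-≤ 2 (lo + n) v (begin
      2 + (lo + n)   ≡⟨ sym (trans (ℕ.+-suc lo (suc n)) (cong suc (ℕ.+-suc lo n))) ⟩
      lo + (2 + n)   ≤⟨ ℕ.+-monoʳ-≤ lo 2+n≤k ⟩
      lo + k         ≡⟨ lo+k ⟩
      2 + v          ∎)
      where open ℕ.≤-Reasoning
    d+n≡v : d + n ≡ v
    d+n≡v = ℕ.m∸n+n≡m (ℕ.≤-trans (ℕ.m≤n+m n lo) lo+n≤v)
    lo≤d : lo ℕ.≤ d
    lo≤d = ℕ.+-cancelʳ-≤ n lo d (ℕ.≤-trans lo+n≤v (ℕ.≤-reflexive (sym d+n≡v)))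

open Reading using (accepts-complete; accepts-sound)

embeds⇔accepts : ∀ p m → (Embeds (_∈ vertices 0 m) 1 p → accepts p 1 true m ≡ true) ×
                         (accepts p 1 true m ≡ true → Embeds (_∈ vertices 0 m) 1 p)
-- Before reading, `v = 0` is even and counter 1 stands for an empty free stretch, so `lo = 1`.
embeds⇔accepts p m =
  accepts-complete _ p 1 0 m refl ((λ _ x∈ → x∈) , (λ x∈ → x∈)) (missed p) ,
  accepts-sound _ p 1 0 m refl ((λ _ x∈ → x∈) , (λ x∈ → x∈))
    (λ le ge → contradiction (ℕ.≤-trans le ge) λ ())
  where
  missed : ∀ p → Reading.Missed (_∈ vertices 0 m) 1 0 p
  missed [] = tt
  missed (b ∷ _) c (le , _) = ℕ.≤-trans le (ℕ.m≤m+n c _)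

-- Codes of permutations in SIO

-- Code j n: the remaining n letters of the description of a permutation, the
-- first j of which are bound to be continuations.  N starts a run at an even
-- vertex, D starts a run of at least three vertices at an odd one.
data Code : ℕ → ℕ → Set where
  end : Code 0 0
  N : ∀ {n} → Code 0 n → Code 0 (suc n)
  C : ∀ {n} → Code 0 n → Code 0 (suc n)
  D : ∀ {n} → Code 2 n → Code 0 (suc n)
  C′ : ∀ {j n} → Code j n → Code (suc j) (suc n)

micros : ∀ {j n} → Code j n → List Micro
micros end = []
micros (N w) = S true ∷ micros w
micros (C w) = C ∷ micros w
micros (D w) = S false ∷ micros w
micros (C′ w) = C ∷ micros w

length-micros : ∀ {j n} (w : Code j n) → length (micros w) ≡ n
length-micros end = refl
length-micros (N w) = cong suc (length-micros w)
length-micros (C w) = cong suc (length-micros w)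
length-micros (D w) = cong suc (length-micros w)
length-micros (C′ w) = cong suc (length-micros w)

-- A leading `C` would begin an odd run, which `N` or `D` already records; excluding it makes the
-- code of a permutation unique.
starts : ∀ {j n} → Code j n → Bool
starts (C _) = false
starts _ = true

blocks : ∀ {n} → Code 0 n → List Block
blocks w = parse (micros w)

drawing : ∀ {n} (w : Code 0 n) → Σ[ π ∈ Word n ] Unique π × Drawing π (_∈ vertices 0 (micros w))
drawing w = draw-list _ (vertices-sorted 0 (micros w))
  (trans (length-vertices 0 (micros w)) (length-micros w))

perm : ∀ {n} → Code 0 n → Word n
perm w = proj₁ (drawing w)

perm-unique : ∀ {n} (w : Code 0 n) → Unique (perm w)
perm-unique w = proj₁ (proj₂ (drawing w))

perm-drawing : ∀ {n} (w : Code 0 n) → Drawing (perm w) (_∈ vertices 0 (micros w))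
perm-drawing w = proj₂ (proj₂ (drawing w))

perm-SIO : ∀ {n} (w : Code 0 n) → SIO (perm w)
perm-SIO w = drawing⇒SIO (perm-unique w) (perm-drawing w)

≼⇒accepts : ∀ {k n} (p : Code 0 k) (w : Code 0 n) → perm p ≼ perm w → accepts (blocks p) 1 true (micros w) ≡ true
≼⇒accepts p w le with F , mor ← ≼⇒morphism (perm-drawing p) (perm-drawing w) le =
  proj₁ (embeds⇔accepts (blocks p) (micros w)) (morphism⇒embeds₀ (micros p) (vertices> 0 (micros w)) mor)

accepts⇒≼ : ∀ {k n} (p : Code 0 k) (w : Code 0 n) → accepts (blocks p) 1 true (micros w) ≡ true → perm p ≼ perm w
accepts⇒≼ p w acc = morphism⇒≼ (perm-drawing p) (perm-drawing w)
  (proj₂ (embeds⇒morphism₀ (micros p) (proj₂ (embeds⇔accepts (blocks p) (micros w)) acc)))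

-- Uniqueness of codes

size : List Block → ℕ
size [] = 0
size ((n , _) ∷ p) = suc n + size p

size-runs : ∀ n e m → size (runs n e m) ≡ suc n + length m
size-runs n e [] = refl
size-runs n e (C ∷ m) = trans (size-runs (suc n) (not e) m) (cong suc (sym (ℕ.+-suc n (length m))))
size-runs n e (S b ∷ m) = cong (suc n +_) (size-runs 0 b m)

-- Blocks take their vertices from the `k ∸ 1` free ones and from the unread letters.
accepts-size : ∀ p k t m → accepts p k t m ≡ true → size p ℕ.≤ length m + (k ∸ 1)
proceed-size : ∀ p k t m → proceed p k t m ≡ true → size p ℕ.≤ length m + (k ∸ 1)

accepts-size [] k t m _ = z≤n
accepts-size p@(_ ∷ _) k t (C ∷ m) acc = ℕ.≤-trans (proceed-size p (suc k) (not t) m acc)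
  (ℕ.≤-trans (ℕ.+-monoʳ-≤ (length m) (ℕ.≤-trans (ℕ.m≤n+m∸n k 1) ℕ.≤-refl))
    (ℕ.≤-reflexive (ℕ.+-suc (length m) (k ∸ 1))))
accepts-size p@(_ ∷ _) k t (S c ∷ m) acc = ℕ.≤-trans (proceed-size p 2 c m acc)
  (ℕ.≤-trans (ℕ.≤-reflexive (ℕ.+-comm (length m) 1)) (ℕ.m≤m+n (suc (length m)) (k ∸ 1)))

proceed-size [] k t m _ = z≤n
proceed-size ((n , e) ∷ p) k t m acc with hit? (n , e) k t
... | yes hit@(2+n≤k , _) = ℕ.≤-trans
  (ℕ.+-mono-≤ (ℕ.∸-monoˡ-≤ 1 2+n≤k)
    (accepts-size p 0 t m (trans (sym (proceed-hit (n , e) p m hit)) acc)))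
  (ℕ.≤-reflexive (trans (cong (k ∸ 1 +_) (ℕ.+-identityʳ (length m))) (ℕ.+-comm (k ∸ 1) (length m))))
... | no ¬hit = accepts-size ((n , e) ∷ p) k t m (trans (sym (proceed-miss (n , e) p m ¬hit)) acc)

flips : ℕ → Bool → Bool
flips zero t = t
flips (suc d) t = flips d (not t)

flips-not : ∀ d t → flips d (not t) ≡ not (flips d t)
flips-not zero t = refl
flips-not (suc d) t = flips-not d (not t)

runs-head : ∀ n e m → ∃[ d ] ∃[ p ] runs n e m ≡ (d + n , flips d e) ∷ p
runs-head n e [] = 0 , [] , refl
runs-head n e (C ∷ m) with d , p , eq ← runs-head (suc n) (not e) m =
  suc d , p , trans eq (cong (λ x → (x , flips d (not e)) ∷ p) (ℕ.+-suc d n))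
runs-head n e (S b ∷ m) = 0 , runs 0 b m , refl

-- A run of the wrong parity has to be longer by one vertex.
misaligned-size : ∀ {n e} p k d t m → 2 ℕ.≤ n → k + d ≡ n → flips d t ≡ not e →
  accepts ((n , e) ∷ p) (2 + k) t m ≡ true → suc (size ((n , e) ∷ p)) ℕ.≤ length m + suc k
misaligned-size {n} {e} p k zero t (C ∷ m) _ k≡ mis acc
  rewrite ℕ.+-identityʳ k | k≡ = s≤s (ℕ.≤-trans
    (ℕ.+-monoʳ-≤ (suc n) (accepts-size p 0 (not t) m
      (trans (sym (proceed-hit (n , e) p m (ℕ.n≤1+n (2 + n) , λ _ → trans (cong not mis) (Bool.not-involutive e)))) acc)))
    (ℕ.≤-reflexive (trans (cong (suc n +_) (ℕ.+-identityʳ (length m))) (ℕ.+-comm (suc n) (length m)))))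
misaligned-size {n} {e} p k (suc d) t (C ∷ m) 2≤n k≡ mis acc =
  ℕ.≤-trans (misaligned-size p (suc k) d (not t) m 2≤n (trans (sym (ℕ.+-suc k d)) k≡) mis
      (trans (sym (proceed-miss (n , e) p m ¬hit)) acc))
    (ℕ.≤-reflexive (ℕ.+-suc (length m) (suc k)))
  where
  ¬hit : ¬ Hit (n , e) (3 + k) (not t)
  ¬hit (le , par) = late d k≡ mis
    where
    late : ∀ d → k + suc d ≡ n → flips d (not t) ≡ not e → _
    late zero _ mis = contradiction (trans (sym mis) (par 2≤n)) (Bool.not-¬ refl ∘ sym)
    late (suc d) k≡ _ = contradiction
      (ℕ.≤-trans (s≤s (s≤s (ℕ.≤-trans (ℕ.≤-reflexive (sym (ℕ.+-suc k (suc d)))) (ℕ.≤-reflexive k≡)))) le)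
      (ℕ.<⇒≱ (s≤s (s≤s (s≤s (ℕ.m<m+n k (s≤s z≤n))))))
misaligned-size {n} {e} p k d t (S c ∷ m) 2≤n _ _ acc =
  s≤s (ℕ.≤-trans (accepts-size ((n , e) ∷ p) 2 c m
      (trans (sym (proceed-miss (n , e) p m λ (le , _) → contradiction (ℕ.≤-trans (s≤s (s≤s 2≤n)) le) λ { (s≤s (s≤s ())) })) acc))
    (ℕ.+-monoʳ-≤ (length m) (s≤s z≤n)))

proceed-C : ∀ k e m t m′ → proceed (runs (suc k) e m) (2 + k) t (C ∷ m′) ≡
                           proceed (runs (suc k) e m) (3 + k) (not t) m′
proceed-C k e m t m′ with d , p , eq ← runs-head (suc k) e m rewrite eq =
  proceed-miss _ p (C ∷ m′) λ (le , _) → contradiction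
    (ℕ.≤-trans (ℕ.+-monoʳ-≤ 2 (ℕ.m≤n+m (suc k) d)) le) (ℕ.<⇒≱ ℕ.≤-refl)

proceed-S : ∀ k e m t c m′ → proceed (runs (suc k) e m) (2 + k) t (S c ∷ m′) ≡
                             proceed (runs (suc k) e m) 2 c m′
proceed-S k e m t c m′ with d , p , eq ← runs-head (suc k) e m rewrite eq =
  proceed-miss _ p (S c ∷ m′) λ (le , _) → contradiction
    (ℕ.≤-trans (ℕ.+-monoʳ-≤ 2 (ℕ.m≤n+m (suc k) d)) le) (ℕ.<⇒≱ ℕ.≤-refl)

accepts-S : ∀ e m k t c m′ → accepts (runs 0 e m) k t (S c ∷ m′) ≡ proceed (runs 0 e m) 2 c m′
accepts-S e m k t c m′ with d , p , eq ← runs-head 0 e m rewrite eq = refl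

new-run : ∀ k e b m c m′ → proceed (runs k e (S b ∷ m)) (2 + k) e (S c ∷ m′) ≡ proceed (runs 0 b m) 2 c m′
new-run k e b m c m′ = trans (proceed-hit (k , e) (runs 0 b m) (S c ∷ m′) (ℕ.≤-refl , λ _ → refl))
  (accepts-S b m 0 e c m′)

too-long : ∀ {j j′ n k e t} (w : Code j n) (w′ : Code j′ n) →
           ¬ proceed (runs (suc k) e (micros w)) 2 t (micros w′) ≡ true
too-long {n = n} {k} {e} {t} w w′ acc = contradiction
  (subst₂ ℕ._≤_ (trans (size-runs (suc k) e (micros w)) (cong (2 + k +_) (length-micros w)))
    (cong (_+ 1) (length-micros w′)) (proceed-size (runs (suc k) e (micros w)) 2 t (micros w′) acc))
  (ℕ.<⇒≱ (s≤s (ℕ.≤-trans (ℕ.≤-reflexive (ℕ.+-comm n 1)) (s≤s (ℕ.m≤n+m n k)))))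

wrong-parity : ∀ {n} (w : Code 2 n) (w′ : Code 0 n) → ¬ proceed (runs 0 false (micros w)) 2 true (micros w′) ≡ true
wrong-parity {suc (suc n)} (C′ (C′ w)) w′ acc with runs-head 2 false (micros w) | size-runs 2 false (micros w)
... | d , p , eq | sz rewrite eq = contradiction
  (subst₂ (λ x y → suc x ℕ.≤ y + 1) (trans sz (cong (3 +_) (length-micros w))) (length-micros w′)
    (misaligned-size p 0 (d + 2) true (micros w′) (ℕ.m≤n+m 2 d) refl mis
      (trans (sym (proceed-miss _ p (micros w′) λ (le , _) →
        contradiction (ℕ.≤-trans (ℕ.+-monoʳ-≤ 2 (ℕ.m≤n+m 2 d)) le) λ { (s≤s (s≤s ())) })) acc)))
  (ℕ.<⇒≱ (s≤s (ℕ.≤-reflexive (cong (2 +_) (ℕ.+-comm n 1)))))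
  where
  mis : flips (d + 2) true ≡ not (flips d false)
  mis rewrite ℕ.+-comm d 2 = flips-not d false

-- The two codes are read in lockstep: the open run of the pattern matches the free stretch of the
-- text in length and parity. As equally many letters remain, no text vertex may be wasted. At the
-- first differing letter the acceptance whose pattern has the continuing run, or the odd one,
-- fails: by `too-long` if the text starts a new run, by `wrong-parity` if both do.
synchronised : ∀ {j n} (w w′ : Code j n) k e →
  proceed (runs k e (micros w)) (2 + k) e (micros w′) ≡ true →
  proceed (runs k e (micros w′)) (2 + k) e (micros w) ≡ true → w ≡ w′
synchronised end end _ _ _ _ = refl
synchronised (N w) (N w′) k e h h′ = cong N (synchronised w w′ 0 true
  (trans (sym (new-run k e true (micros w) true (micros w′))) h)
  (trans (sym (new-run k e true (micros w′) true (micros w))) h′))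
synchronised (D w) (D w′) k e h h′ = cong D (synchronised w w′ 0 false
  (trans (sym (new-run k e false (micros w) false (micros w′))) h)
  (trans (sym (new-run k e false (micros w′) false (micros w))) h′))
synchronised (C w) (C w′) k e h h′ = cong C (synchronised w w′ (suc k) (not e)
  (trans (sym (proceed-C k (not e) (micros w) e (micros w′))) h)
  (trans (sym (proceed-C k (not e) (micros w′) e (micros w))) h′))
synchronised (C′ w) (C′ w′) k e h h′ = cong C′ (synchronised w w′ (suc k) (not e)
  (trans (sym (proceed-C k (not e) (micros w) e (micros w′))) h)
  (trans (sym (proceed-C k (not e) (micros w′) e (micros w))) h′))
synchronised (N w) (D w′) k e _ h′ =
  contradiction (trans (sym (new-run k e false (micros w′) true (micros w))) h′) (wrong-parity w′ w)
synchronised (D w) (N w′) k e h _ =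
  contradiction (trans (sym (new-run k e false (micros w) true (micros w′))) h) (wrong-parity w w′)
synchronised (C w) (N w′) k e h _ = contradiction
  (trans (sym (proceed-S k (not e) (micros w) e true (micros w′))) h) (too-long w w′)
synchronised (C w) (D w′) k e h _ = contradiction
  (trans (sym (proceed-S k (not e) (micros w) e false (micros w′))) h) (too-long w w′)
synchronised (N w) (C w′) k e _ h′ = contradiction
  (trans (sym (proceed-S k (not e) (micros w′) e true (micros w))) h′) (too-long w′ w)
synchronised (D w) (C w′) k e _ h′ = contradiction
  (trans (sym (proceed-S k (not e) (micros w′) e false (micros w))) h′) (too-long w′ w)

perm-injective : ∀ {n} (w w′ : Code 0 n) → starts w ≡ true → starts w′ ≡ true → perm w ≡ perm w′ → w ≡ w′
perm-injective {n} w w′ st st′ eq = by-letter w w′ st st′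
  (≼⇒accepts w w′ (subst (perm w ≼_) eq (≼-refl (perm w))))
  (≼⇒accepts w′ w (subst (_≼ perm w) eq (≼-refl (perm w))))
  where
  ≼-refl : ∀ (π : Word n) → π ≼ π
  ≼-refl π = (λ i → i) , (λ _ _ lt → lt) , λ _ _ → mk⇔ (λ lt → lt) (λ lt → lt)
  by-letter : ∀ {n} (w w′ : Code 0 n) → starts w ≡ true → starts w′ ≡ true →
    accepts (blocks w) 1 true (micros w′) ≡ true → accepts (blocks w′) 1 true (micros w) ≡ true → w ≡ w′
  by-letter end end _ _ _ _ = refl
  by-letter (N w) (N w′) _ _ h h′ = cong N (synchronised w w′ 0 true
    (trans (sym (accepts-S true (micros w) 1 true true (micros w′))) h)
    (trans (sym (accepts-S true (micros w′) 1 true true (micros w))) h′))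
  by-letter (D w) (D w′) _ _ h h′ = cong D (synchronised w w′ 0 false
    (trans (sym (accepts-S false (micros w) 1 true false (micros w′))) h)
    (trans (sym (accepts-S false (micros w′) 1 true false (micros w))) h′))
  by-letter (N w) (D w′) _ _ _ h′ = contradiction
    (trans (sym (accepts-S false (micros w′) 1 true true (micros w))) h′) (wrong-parity w′ w)
  by-letter (D w) (N w′) _ _ h _ = contradiction
    (trans (sym (accepts-S false (micros w) 1 true true (micros w′))) h) (wrong-parity w w′)

-- Existence of codes

runs-parse : ∀ {l} (w : Code 0 (suc l)) n e → starts w ≡ true → runs n e (micros w) ≡ (n , e) ∷ parse (micros w)
runs-parse (N w) n e _ = refl
runs-parse (D w) n e _ = refl

module Describe (T : ℕ → Set) where

  continued : ∀ xs {v c n} → AllPairs ℕ._<_ (v ∷ xs) → All T xs → c + n ≡ v → (∀ i → i ℕ.≤ n → T (c + i)) →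
    Σ[ w ∈ Code 0 (length xs) ] Embeds T c (runs n (even v) (micros w))
  started : ∀ x xs → AllPairs ℕ._<_ (x ∷ xs) → All T (x ∷ xs) →
    Σ[ w ∈ Code 0 (suc (length xs)) ] starts w ≡ true × Embeds T x (blocks w)

  one : ∀ {x} → T x → ∀ i → i ℕ.≤ 0 → T (x + i)
  one Tx zero z≤n = subst T (sym (ℕ.+-identityʳ _)) Tx

  extend : ∀ {c n y} → T y → c + suc n ≡ y → (∀ i → i ℕ.≤ n → T (c + i)) → ∀ i → i ℕ.≤ suc n → T (c + i)
  extend {c} {n} {y} Ty eq run i i≤ with ℕ.m≤n⇒m<n∨m≡n i≤
  ... | inj₁ lt = run i (ℕ.≤-pred lt)
  ... | inj₂ refl = subst T (sym eq) Ty

  close : ∀ {l} (w : Code 0 (suc l)) {c n e y} → starts w ≡ true → Fits T c (n , e) c → 2 + (c + n) ℕ.≤ y →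
    Embeds T y (blocks w) → Embeds T c (runs n e (micros w))
  close w {c} {n} {e} st fits le emb rewrite runs-parse w n e st =
    c , fits , Embeds-anti (blocks w) le emb

  continued [] {v} {c} {n} _ _ v≡ run = end , c , (ℕ.≤-refl , run , λ _ → cong even v≡) , tt
  continued (y ∷ ys) {v} {c} {n} ((v<y ∷ _) ∷ sorted) (Ty ∷ Tys) v≡ run with ℕ.m≤n⇒m<n∨m≡n v<y
  ... | inj₂ refl = let w , emb = continued ys {suc v} {c} {suc n} sorted Tys c+n≡ (extend Ty c+n≡ run) in C w , emb
    where c+n≡ = trans (ℕ.+-suc c n) (cong suc v≡)
  ... | inj₁ lt = let w , st , emb = started y ys sorted (Ty ∷ Tys) in
    w , close w st (ℕ.≤-refl , run , λ _ → cong even v≡) (subst (λ z → 2 + z ℕ.≤ y) (sym v≡) lt) emb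

  started x xs sorted (Tx ∷ Txs) with even x in ev
  ... | true = let w , emb = continued xs {x} {x} {0} sorted Txs (ℕ.+-identityʳ x) (one Tx) in
    N w , refl , subst (λ e → Embeds T x (runs 0 e (micros w))) ev emb
  -- An odd run of one or two vertices is recorded by `N`, since `Fits` tests parity only from three
  -- vertices on.
  started x [] _ (Tx ∷ _) | false = N end , refl , x , (ℕ.≤-refl , one Tx , λ ()) , tt
  started x (y ∷ ys) ((x<y ∷ _) ∷ sorted) (Tx ∷ Ty ∷ Tys) | false with ℕ.m≤n⇒m<n∨m≡n x<y
  ... | inj₁ lt = let w , st , emb = started y ys sorted (Ty ∷ Tys) in
    N w , refl , close w st (ℕ.≤-refl , one Tx , λ ()) (subst (λ z → 2 + z ℕ.≤ y) (sym (ℕ.+-identityʳ x)) lt) emb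
  started x (y ∷ []) _ (Tx ∷ Ty ∷ []) | false | inj₂ refl = N (C end) , refl ,
    x , (ℕ.≤-refl , extend Ty (ℕ.+-comm x 1) (one Tx) , λ { (s≤s ()) }) , tt
  started x (y ∷ z ∷ zs) (_ ∷ (y<z ∷ _) ∷ sorted) (Tx ∷ Ty ∷ Tz ∷ Tzs) | false | inj₂ refl
    with ℕ.m≤n⇒m<n∨m≡n y<z
  ... | inj₁ lt = let w , st , emb = started z zs sorted (Tz ∷ Tzs) in
    N (C w) , refl , close w st (ℕ.≤-refl , extend Ty (ℕ.+-comm x 1) (one Tx) , λ { (s≤s ()) })
      (subst (λ v → 2 + v ℕ.≤ z) (ℕ.+-comm 1 x) lt) emb
  ... | inj₂ refl = let w , emb = continued zs {z} {x} {2} sorted Tzs (ℕ.+-comm x 2)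
                          (extend Tz (ℕ.+-comm x 2) (extend Ty (ℕ.+-comm x 1) (one Tx))) in
    D (C′ (C′ w)) , refl ,
    subst (λ e → Embeds T x (runs 2 e (micros w))) (trans (even-2+ x) ev) emb

describe : ∀ xs → AllPairs ℕ._<_ xs →
  Σ[ w ∈ Code 0 (length xs) ] starts w ≡ true × ∃[ lo ] Embeds (_∈ xs) lo (blocks w)
describe [] _ = end , refl , 0 , tt
describe (x ∷ xs) sorted =
  let w , st , emb = Describe.started (_∈ (x ∷ xs)) x xs sorted (All.tabulate (λ x∈ → x∈)) in
  w , st , x , emb

-- An embedding of the code's blocks into the vertices of `π` is enough: containment between
-- permutations of the same size is equality.
perm-surjective : ∀ {n} {π : Word n} → SIO π → Σ[ w ∈ Code 0 n ] starts w ≡ true × perm w ≡ π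
perm-surjective {n} {π} sio with xs , sorted , refl , dπ ← SIO⇒drawing sio
  with w , st , lo , emb ← describe xs sorted = w , st ,
  ≼-same-size (perm-unique w) (morphism⇒≼ (perm-drawing w) dπ (proj₂ (embeds⇒morphism₀ (micros w) emb)))

-- Counting codes

-- Counting recurses on the first letter, so that recurrences such as `allCodes-suc` hold by
-- computation.
count : ∀ j n → (Code j n → Bool) → ℕ
count zero zero p = if p end then 1 else 0
count zero (suc n) p = count 0 n (p ∘ N) + count 0 n (p ∘ C) + count 2 n (p ∘ D)
count (suc j) zero p = 0
count (suc j) (suc n) p = count j n (p ∘ C′)

count-cong : ∀ j n {p q : Code j n → Bool} → p ≗ q → count j n p ≡ count j n q
count-cong zero zero p≗q = cong (if_then 1 else 0) (p≗q end)
count-cong zero (suc n) p≗q = cong₂ _+_ (cong₂ _+_ (count-cong 0 n (p≗q ∘ N)) (count-cong 0 n (p≗q ∘ C)))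
  (count-cong 2 n (p≗q ∘ D))
count-cong (suc j) zero p≗q = refl
count-cong (suc j) (suc n) p≗q = count-cong j n (p≗q ∘ C′)

count-split : ∀ j n (p q : Code j n → Bool) →
  count j n (λ w → p w ∧ not (q w)) + count j n (λ w → p w ∧ q w) ≡ count j n p
count-split zero zero p q with p end | q end
... | true | true = refl
... | true | false = refl
... | false | _ = refl
count-split zero (suc n) p q = trans
  (regroup (count 0 n (out ∘ N)) (count 0 n (out ∘ C)) (count 2 n (out ∘ D))
               (count 0 n (inn ∘ N)) (count 0 n (inn ∘ C)) (count 2 n (inn ∘ D)))
  (cong₂ _+_ (cong₂ _+_ (count-split 0 n (p ∘ N) (q ∘ N)) (count-split 0 n (p ∘ C) (q ∘ C)))
    (count-split 2 n (p ∘ D) (q ∘ D)))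
  where
  out inn : Code 0 (suc n) → Bool
  out w = p w ∧ not (q w)
  inn w = p w ∧ q w
  regroup : ∀ a b c a′ b′ c′ → (a + b + c) + (a′ + b′ + c′) ≡ (a + a′) + (b + b′) + (c + c′)
  regroup = solve-∀
count-split (suc j) zero p q = refl
count-split (suc j) (suc n) p q = count-split j n (p ∘ C′) (q ∘ C′)

select : ∀ j n → (Code j n → Bool) → List (Code j n)
select zero zero p = if p end then end ∷ [] else []
select zero (suc n) p = map N (select 0 n (p ∘ N)) ++ map C (select 0 n (p ∘ C)) ++ map D (select 2 n (p ∘ D))
select (suc j) zero p = []
select (suc j) (suc n) p = map C′ (select j n (p ∘ C′))

length-select : ∀ j n p → length (select j n p) ≡ count j n p
length-select zero zero p with p end
... | true = refl
... | false = refl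
length-select zero (suc n) p = begin
  length (map N xs ++ map C ys ++ map D zs)                      ≡⟨ List.length-++ (map N xs) ⟩
  length (map N xs) + length (map C ys ++ map D zs)              ≡⟨ cong (length (map N xs) +_) (List.length-++ (map C ys)) ⟩
  length (map N xs) + (length (map C ys) + length (map D zs))    ≡⟨ sym (ℕ.+-assoc (length (map N xs)) _ _) ⟩
  length (map N xs) + length (map C ys) + length (map D zs)
    ≡⟨ cong₂ _+_ (cong₂ _+_ (trans (List.length-map N xs) (length-select 0 n (p ∘ N)))
         (trans (List.length-map C ys) (length-select 0 n (p ∘ C))))
         (trans (List.length-map D zs) (length-select 2 n (p ∘ D))) ⟩
  count 0 (suc n) p ∎
  where
  open ≡-Reasoning
  xs = select 0 n (p ∘ N)
  ys = select 0 n (p ∘ C)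
  zs = select 2 n (p ∘ D)
length-select (suc j) zero p = refl
length-select (suc j) (suc n) p = trans (List.length-map C′ (select j n (p ∘ C′))) (length-select j n (p ∘ C′))

∈-select⁺ : ∀ {j n} p (w : Code j n) → p w ≡ true → w ∈ select j n p
∈-select⁺ p end eq rewrite eq = here refl
∈-select⁺ p (N w) eq = ∈-++⁺ˡ (∈-map⁺ N (∈-select⁺ (p ∘ N) w eq))
∈-select⁺ {n = suc n} p (C w) eq = ∈-++⁺ʳ (map N (select 0 n (p ∘ N))) (∈-++⁺ˡ (∈-map⁺ C (∈-select⁺ (p ∘ C) w eq)))
∈-select⁺ {n = suc n} p (D w) eq = ∈-++⁺ʳ (map N (select 0 n (p ∘ N)))
  (∈-++⁺ʳ (map C (select 0 n (p ∘ C))) (∈-map⁺ D (∈-select⁺ (p ∘ D) w eq)))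
∈-select⁺ p (C′ w) eq = ∈-map⁺ C′ (∈-select⁺ (p ∘ C′) w eq)

∈-select⁻ : ∀ {j n} p {w : Code j n} → w ∈ select j n p → p w ≡ true
∈-select⁻ {zero} {zero} p {end} w∈ with p end
... | true = refl
∈-select⁻ {zero} {suc n} p w∈ with ∈-++⁻ (map N (select 0 n (p ∘ N))) w∈
... | inj₁ w∈ with v , v∈ , refl ← ∈-map⁻ N w∈ = ∈-select⁻ (p ∘ N) v∈
... | inj₂ w∈ with ∈-++⁻ (map C (select 0 n (p ∘ C))) w∈
...   | inj₁ w∈ with v , v∈ , refl ← ∈-map⁻ C w∈ = ∈-select⁻ (p ∘ C) v∈
...   | inj₂ w∈ with v , v∈ , refl ← ∈-map⁻ D w∈ = ∈-select⁻ (p ∘ D) v∈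
∈-select⁻ {suc j} {suc n} p w∈ with v , v∈ , refl ← ∈-map⁻ C′ w∈ = ∈-select⁻ (p ∘ C′) v∈

select-unique : ∀ j n p → UniqueL.Unique (select j n p)
select-unique zero zero p with p end
... | true = [] ∷ []
... | false = []
select-unique zero (suc n) p = UniqueL.++⁺ (UniqueL.map⁺ (λ { refl → refl }) (select-unique 0 n (p ∘ N)))
  (UniqueL.++⁺ (UniqueL.map⁺ (λ { refl → refl }) (select-unique 0 n (p ∘ C)))
    (UniqueL.map⁺ (λ { refl → refl }) (select-unique 2 n (p ∘ D)))
    λ (c∈ , d∈) → C≠D (∈-map⁻ C c∈) (∈-map⁻ D d∈))
  λ (n∈ , cd∈) → N≠CD (∈-map⁻ N n∈) (∈-++⁻ (map C (select 0 n (p ∘ C))) cd∈)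
  where
  C≠D : ∀ {w : Code 0 (suc n)} {xs ys} → (∃[ u ] u ∈ xs × w ≡ C u) → ¬ (∃[ v ] v ∈ ys × w ≡ D v)
  C≠D (_ , _ , refl) (_ , _ , ())
  N≠CD : ∀ {w : Code 0 (suc n)} {xs} → (∃[ u ] u ∈ xs × w ≡ N u) →
    ¬ (w ∈ map C (select 0 n (p ∘ C)) ⊎ w ∈ map D (select 2 n (p ∘ D)))
  N≠CD (_ , _ , refl) (inj₁ c∈) with () ← proj₂ (proj₂ (∈-map⁻ C c∈))
  N≠CD (_ , _ , refl) (inj₂ d∈) with () ← proj₂ (proj₂ (∈-map⁻ D d∈))
select-unique (suc j) zero p = []
select-unique (suc j) (suc n) p = UniqueL.map⁺ (λ { refl → refl }) (select-unique j n (p ∘ C′))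

-- From counts of permutations to counts of codes

words-unique : ∀ m n → UniqueL.Unique (words m n)
words-unique m zero = [] ∷ []
words-unique m (suc n) = UniqueL.cartesianProductWith⁺ _∷_ (λ { refl → refl , refl })
  (UniqueL.allFin⁺ m) (words-unique m n)

map-unique : ∀ {A B : Set} {f : A → B} {xs} → (∀ {x y} → x ∈ xs → y ∈ xs → f x ≡ f y → x ≡ y) →
             UniqueL.Unique xs → UniqueL.Unique (map f xs)
map-unique inj [] = []
map-unique {f = f} {x ∷ xs} inj (x∉ ∷ uxs) =
  All.tabulate (λ y∈ eq → let z , z∈ , y≡ = ∈-map⁻ f y∈ in
    contradiction (inj (here refl) (there z∈) (trans eq y≡)) (All.lookup x∉ z∈)) ∷
  map-unique (λ x∈ y∈ → inj (there x∈) (there y∈)) uxs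

∧-true : ∀ {a b} → a ∧ b ≡ true → a ≡ true × b ≡ true
∧-true {true} eq = refl , eq

-- Both lists are free of repetitions and have the same members, by injectivity and surjectivity of
-- `perm`, so they are rearrangements of each other.
count-sio : ∀ {m} {R : Word m → Set} (R? : Decidable R) (q : Code 0 m → Bool) →
  (∀ w → q w ≡ true ⇔ R (perm w)) →
  length (filter R? (sio m)) ≡ count 0 m (λ w → starts w ∧ q w)
count-sio {m} {R} R? q q⇔R = trans (↭-length (∼bag⇒↭ (unique∧set⇒bag
    (UniqueL.filter⁺ R? (UniqueL.filter⁺ SIO? (words-unique m m)))
    (map-unique (λ {x} {y} x∈ y∈ → perm-injective x y (proj₁ (∧-true (∈-select⁻ s x∈))) (proj₁ (∧-true (∈-select⁻ s y∈))))
      (select-unique 0 m s))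
    (mk⇔ to from))))
  (trans (List.length-map perm (select 0 m s)) (length-select 0 m s))
  where
  s : Code 0 m → Bool
  s w = starts w ∧ q w
  to : ∀ {π} → π ∈ filter R? (sio m) → π ∈ map perm (select 0 m s)
  to π∈ with π∈sio , r ← ∈-filter⁻ R? {xs = sio m} π∈
    with w , st , refl ← perm-surjective (proj₂ (∈-filter⁻ SIO? {xs = words m m} π∈sio)) =
    ∈-map⁺ perm (∈-select⁺ s w (cong₂ _∧_ st (Equivalence.from (q⇔R w) r)))
  from : ∀ {π} → π ∈ map perm (select 0 m s) → π ∈ filter R? (sio m)
  from π∈ with w , w∈ , refl ← ∈-map⁻ perm π∈ = ∈-filter⁺ R? {xs = sio m}
    (∈-filter⁺ SIO? {xs = words m m} (∈-words (perm w)) (perm-SIO w))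
    (Equivalence.to (q⇔R w) (proj₂ (∧-true {starts w} (∈-select⁻ s w∈))))

contains : List Block → ∀ {n} → Code 0 n → Bool
contains p w = accepts p 1 true (micros w)

avoiders-count : ∀ {k} (p : Code 0 k) m →
  avoiders (perm p) m ≡ count 0 m (λ w → starts w ∧ not (contains (blocks p) w))
avoiders-count p m = count-sio {m} (λ σ → ¬? (perm p ≼? σ)) (λ w → not (contains (blocks p) w))
  (λ w → mk⇔ (λ eq le → case-not eq (≼⇒accepts p w le))
             (λ ¬le → cong not (Bool.¬-not (λ eq → ¬le (accepts⇒≼ p w eq)))))
  where
  case-not : ∀ {b} → not b ≡ true → ¬ b ≡ true
  case-not {true} () _
  case-not {false} _ ()

-- Patterns contained in equally many codes

-- If the next j letters are bound to be continuations, then they end no later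
-- than the first hit of a run of three vertices; so such a hit is always
-- followed by an unconstrained code.
Aligned : ℕ → ℕ → Set
Aligned k j = j ≡ 0 ⊎ k + j ℕ.≤ 4

-- All aligned search states are included, not only the initial one, so that the relation survives
-- putting a block in front.
record _≈_ (p p′ : List Block) : Set where
  field
    accepts≈ : ∀ k t j n → Aligned k j →
      count j n (λ w → accepts p k t (micros w)) ≡ count j n (λ w → accepts p′ k t (micros w))
    proceed≈ : ∀ k t j n → Aligned k j →
      count j n (λ w → proceed p k t (micros w)) ≡ count j n (λ w → proceed p′ k t (micros w))

open _≈_

count-false : ∀ j n → count j n (λ _ → false) ≡ 0
count-false zero zero = refl
count-false zero (suc n) rewrite count-false 0 n | count-false 2 n = refl
count-false (suc j) zero = refl
count-false (suc j) (suc n) = count-false j n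

-- Until `b` is hit the two searches make the same moves, so their counts can differ only through
-- the codes that follow the hit.
≈-extend : ∀ b {p p′} → (∀ k t j n → Aligned k j → Hit b k t →
    count j n (λ w → accepts p 0 t (micros w)) ≡ count j n (λ w → accepts p′ 0 t (micros w))) →
  (b ∷ p) ≈ (b ∷ p′)
≈-extend b {p} {p′} hyp = record { accepts≈ = acc ; proceed≈ = λ k t j n → pro k t j n (acc k t j n) }
  where
  pro : ∀ k t j n → (Aligned k j → count j n (λ w → accepts (b ∷ p) k t (micros w)) ≡
                                   count j n (λ w → accepts (b ∷ p′) k t (micros w))) → Aligned k j →
    count j n (λ w → proceed (b ∷ p) k t (micros w)) ≡ count j n (λ w → proceed (b ∷ p′) k t (micros w))
  pro k t j n ih al with hit? b k t
  ... | yes hit = trans (count-cong j n (λ w → proceed-hit b p (micros w) hit))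
    (trans (hyp k t j n al hit) (sym (count-cong j n (λ w → proceed-hit b p′ (micros w) hit))))
  ... | no ¬hit = trans (count-cong j n (λ w → proceed-miss b p (micros w) ¬hit))
    (trans (ih al) (sym (count-cong j n (λ w → proceed-miss b p′ (micros w) ¬hit))))
  acc : ∀ k t j n → Aligned k j →
    count j n (λ w → accepts (b ∷ p) k t (micros w)) ≡ count j n (λ w → accepts (b ∷ p′) k t (micros w))
  acc k t zero zero _ = refl
  acc k t zero (suc n) _ = cong₂ _+_ (cong₂ _+_
    (pro 2 true 0 n (acc 2 true 0 n) (inj₁ refl))
    (pro (suc k) (not t) 0 n (acc (suc k) (not t) 0 n) (inj₁ refl)))
    -- After `D` the counter is 2 and two continuations are forced; the bound 4 in `Aligned` is this
    -- sum.
    (pro 2 false 2 n (acc 2 false 2 n) (inj₂ ℕ.≤-refl))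
  acc k t (suc j) zero _ = refl
  acc k t (suc j) (suc n) (inj₂ le) = pro (suc k) (not t) j n (acc (suc k) (not t) j n)
    (inj₂ (ℕ.≤-trans (ℕ.≤-reflexive (sym (ℕ.+-suc k j))) le))

≈-∷ : ∀ b {p p′} → p ≈ p′ → (b ∷ p) ≈ (b ∷ p′)
≈-∷ b eq = ≈-extend b λ k t j n al _ → accepts≈ eq 0 t j n (reset al)
  where
  reset : ∀ {k j} → Aligned k j → Aligned 0 j
  reset (inj₁ eq) = inj₁ eq
  reset {k} (inj₂ le) = inj₂ (ℕ.≤-trans (ℕ.m≤n+m _ k) le)

-- Avoiding and containing codes together are all codes with `starts`, whatever the pattern, so
-- equal containment counts suffice. The first letters `N` and `D` both lead to aligned states.
≈⇒∼ : ∀ {k} (p p′ : Code 0 k) → blocks p ≈ blocks p′ → perm p ∼ perm p′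
≈⇒∼ p p′ eq m = ℕ.+-cancelʳ-≡ _ _ _ (trans (split p) (sym (trans (cong (avoiders (perm p′) m +_) (equinumerous m)) (split p′))))
  where
  contained : ∀ {k} → Code 0 k → ℕ → ℕ
  contained p m = count 0 m (λ w → starts w ∧ contains (blocks p) w)
  split : ∀ {k} (p : Code 0 k) → avoiders (perm p) m + contained p m ≡ count 0 m starts
  split p = trans (cong (_+ contained p m) (avoiders-count p m)) (count-split 0 m starts (contains (blocks p)))
  accepts-S′ : ∀ q c m′ → accepts q 1 true (S c ∷ m′) ≡ proceed q 2 c m′
  accepts-S′ [] c m′ = refl
  accepts-S′ (_ ∷ _) c m′ = refl
  equinumerous : ∀ m → contained p m ≡ contained p′ m
  equinumerous zero = accepts≈ eq 1 true 0 0 (inj₁ refl)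
  equinumerous (suc n) = cong₂ _+_ (cong (_+ count 0 n (λ _ → false))
      (trans (count-cong 0 n (λ w → accepts-S′ (blocks p) true (micros w)))
        (trans (proceed≈ eq 2 true 0 n (inj₁ refl)) (sym (count-cong 0 n (λ w → accepts-S′ (blocks p′) true (micros w)))))))
      (trans (count-cong 2 n (λ w → accepts-S′ (blocks p) false (micros w)))
        (trans (proceed≈ eq 2 false 2 n (inj₂ ℕ.≤-refl)) (sym (count-cong 2 n (λ w → accepts-S′ (blocks p′) false (micros w))))))

-- Convolution of counts and the exchange of parities

infixr 7 _⊛_

-- The Cauchy product of two sequences.
_⊛_ : (ℕ → ℕ) → (ℕ → ℕ) → ℕ → ℕ
(f ⊛ g) zero = f 0 ℕ.* g 0
(f ⊛ g) (suc n) = f 0 ℕ.* g (suc n) + ((f ∘ suc) ⊛ g) n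

⊛-cong : ∀ {f f′ g g′} → f ≗ f′ → g ≗ g′ → f ⊛ g ≗ f′ ⊛ g′
⊛-cong f≗ g≗ zero = cong₂ ℕ._*_ (f≗ 0) (g≗ 0)
⊛-cong f≗ g≗ (suc n) = cong₂ _+_ (cong₂ ℕ._*_ (f≗ 0) (g≗ (suc n))) (⊛-cong (f≗ ∘ suc) g≗ n)

⊛-+ : ∀ f f′ g n → ((λ i → f i + f′ i) ⊛ g) n ≡ (f ⊛ g) n + (f′ ⊛ g) n
⊛-+ f f′ g zero = ℕ.*-distribʳ-+ (g 0) (f 0) (f′ 0)
⊛-+ f f′ g (suc n) = trans (cong ((f 0 + f′ 0) ℕ.* g (suc n) +_) (⊛-+ (f ∘ suc) (f′ ∘ suc) g n))
  (rearrange (f 0) (f′ 0) (g (suc n)) (((f ∘ suc) ⊛ g) n) (((f′ ∘ suc) ⊛ g) n))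
  where
  rearrange : ∀ a b c x y → (a + b) ℕ.* c + (x + y) ≡ a ℕ.* c + x + (b ℕ.* c + y)
  rearrange = solve-∀

⊛-zero : ∀ {f} → (∀ i → f i ≡ 0) → ∀ g n → (f ⊛ g) n ≡ 0
⊛-zero f≡0 g zero rewrite f≡0 0 = refl
⊛-zero f≡0 g (suc n) rewrite f≡0 0 = ⊛-zero (f≡0 ∘ suc) g n

-- Splitting off the first term of `f` and then of `g` leads to the index reduced by two, hence the
-- two base cases.
⊛-swap : ∀ f g h n → (f ⊛ (g ⊛ h)) n ≡ (g ⊛ (f ⊛ h)) n
⊛-swap f g h zero = rearrange (f 0) (g 0) (h 0)
  where
  rearrange : ∀ a b c → a ℕ.* (b ℕ.* c) ≡ b ℕ.* (a ℕ.* c)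
  rearrange = solve-∀
⊛-swap f g h (suc zero)
  rewrite ⊛-swap (f ∘ suc) g h 0 = rearrange (f 0) (g 0) (f 1) (g 1) (h 0) (h 1)
  where
  rearrange : ∀ a b a′ b′ c c′ → a ℕ.* (b ℕ.* c′ + b′ ℕ.* c) + b ℕ.* (a′ ℕ.* c) ≡ b ℕ.* (a ℕ.* c′ + a′ ℕ.* c) + b′ ℕ.* (a ℕ.* c)
  rearrange = solve-∀
⊛-swap f g h (suc (suc n)) = begin
  f 0 ℕ.* (g 0 ℕ.* h₂ + G) + ((f ∘ suc) ⊛ (g ⊛ h)) (suc n)
    ≡⟨ cong (f 0 ℕ.* (g 0 ℕ.* h₂ + G) +_) (⊛-swap (f ∘ suc) g h (suc n)) ⟩
  f 0 ℕ.* (g 0 ℕ.* h₂ + G) + (g 0 ℕ.* F + ((g ∘ suc) ⊛ ((f ∘ suc) ⊛ h)) n)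
    ≡⟨ cong (λ x → f 0 ℕ.* (g 0 ℕ.* h₂ + G) + (g 0 ℕ.* F + x)) (⊛-swap (g ∘ suc) (f ∘ suc) h n) ⟩
  f 0 ℕ.* (g 0 ℕ.* h₂ + G) + (g 0 ℕ.* F + ((f ∘ suc) ⊛ ((g ∘ suc) ⊛ h)) n)
    ≡⟨ rearrange (f 0) (g 0) h₂ F G _ ⟩
  g 0 ℕ.* (f 0 ℕ.* h₂ + F) + (f 0 ℕ.* G + ((f ∘ suc) ⊛ ((g ∘ suc) ⊛ h)) n)
    ≡⟨ cong (g 0 ℕ.* (f 0 ℕ.* h₂ + F) +_) (sym (⊛-swap (g ∘ suc) f h (suc n))) ⟩
  g 0 ℕ.* (f 0 ℕ.* h₂ + F) + ((g ∘ suc) ⊛ (f ⊛ h)) (suc n) ∎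
  where
  open ≡-Reasoning
  h₂ = h (suc (suc n))
  F = ((f ∘ suc) ⊛ h) (suc n)
  G = ((g ∘ suc) ⊛ h) (suc n)
  rearrange : ∀ a b c x y z → a ℕ.* (b ℕ.* c + y) + (b ℕ.* x + z) ≡ b ℕ.* (a ℕ.* c + x) + (a ℕ.* y + z)
  rearrange = solve-∀

-- The text ends exactly where the block b is first found.
finishes halts : Block → ℕ → Bool → List Micro → Bool

finishes b k t [] = false
finishes b k t (C ∷ m) = halts b (suc k) (not t) m
finishes b k t (S c ∷ m) = halts b 2 c m

halts b k t m = if does (hit? b k t) then null m else finishes b k t m

halts-hit : ∀ b {k t} m → Hit b k t → halts b k t m ≡ null m
halts-hit b {k} {t} m h = cong (if_then null m else finishes b k t m) (dec-true (hit? b k t) h)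

halts-miss : ∀ b {k t} m → ¬ Hit b k t → halts b k t m ≡ finishes b k t m
halts-miss b {k} {t} m ¬h = cong (if_then null m else finishes b k t m) (dec-false (hit? b k t) ¬h)

found : Block → ℕ → Bool → ℕ → ℕ
found b k t n = count 0 n (λ w → finishes b k t (micros w))

halted : Block → ℕ → Bool → ℕ → ℕ
halted b k t n = count 0 n (λ w → halts b k t (micros w))

accepted : List Block → ℕ → Bool → ℕ → ℕ
accepted p k t n = count 0 n (λ w → accepts p k t (micros w))

-- The unit of the Cauchy product.
null-only : ℕ → ℕ
null-only n = count 0 n (λ w → null (micros w))

null-only-suc : ∀ n → null-only (suc n) ≡ 0
null-only-suc n rewrite count-false 0 n | count-false 2 n = refl

⊛-null : ∀ g n → (null-only ⊛ g) n ≡ g n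
⊛-null g zero = ℕ.*-identityˡ (g 0)
⊛-null g (suc n) = trans (cong (1 ℕ.* g (suc n) +_) (⊛-zero null-only-suc g n))
  (trans (ℕ.+-identityʳ _) (ℕ.*-identityˡ (g (suc n))))

proceeded : List Block → ℕ → Bool → ℕ → ℕ
proceeded p k t n = count 0 n (λ w → proceed p k t (micros w))

triple : Bool → Block
triple e = 2 , e

module _ (e : Bool) (p : List Block) where
  private
    b = triple e

  proceeded-halted : ∀ k t n → accepted (b ∷ p) k t n ≡ (found b k t ⊛ accepted p 0 e) n →
                     proceeded (b ∷ p) k t n ≡ (halted b k t ⊛ accepted p 0 e) n
  proceeded-halted k t n ih with hit? b k t
  ... | yes hit@(_ , par) with refl ← par (s≤s (s≤s z≤n)) =
    trans (count-cong 0 n (λ w → proceed-hit b p (micros w) hit))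
      (sym (trans (⊛-cong (λ i → count-cong 0 i (λ w → halts-hit b (micros w) hit)) (λ _ → refl) n) (⊛-null _ n)))
  ... | no ¬hit = trans (count-cong 0 n (λ w → proceed-miss b p (micros w) ¬hit))
    (trans ih (sym (⊛-cong (λ i → count-cong 0 i (λ w → halts-miss b (micros w) ¬hit)) (λ _ → refl) n)))

  -- An accepted code is cut uniquely where `b` is first hit. The state there is counter 0 and
  -- parity `e`, whatever `k` and `t` were, and the rest of the code is arbitrary.
  accepted-found : ∀ k t n → accepted (b ∷ p) k t n ≡ (found b k t ⊛ accepted p 0 e) n
  accepted-found k t zero = refl
  accepted-found k t (suc n) = begin
    accepted (b ∷ p) 2 true n + proceeded (b ∷ p) (suc k) (not t) n + count 2 n (λ w → accepts (b ∷ p) 2 false (micros w))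
      ≡⟨ cong₂ _+_ (cong₂ _+_ (accepted-found 2 true n)
           (proceeded-halted (suc k) (not t) n (accepted-found (suc k) (not t) n))) (forced n) ⟩
    (found b 2 true ⊛ g) n + (halted b (suc k) (not t) ⊛ g) n + (after-D ⊛ g) n
      ≡⟨ cong (_+ (after-D ⊛ g) n) (sym (⊛-+ (found b 2 true) (halted b (suc k) (not t)) g n)) ⟩
    ((λ i → found b 2 true i + halted b (suc k) (not t) i) ⊛ g) n + (after-D ⊛ g) n
      ≡⟨ sym (⊛-+ (λ i → found b 2 true i + halted b (suc k) (not t) i) after-D g n) ⟩
    (found b k t ⊛ g) (suc n) ∎
    where
    open ≡-Reasoning
    g = accepted p 0 e
    after-D : ℕ → ℕ
    after-D n = count 2 n (λ w → finishes b 2 false (micros w))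
    forced : ∀ n → count 2 n (λ w → accepts (b ∷ p) 2 false (micros w)) ≡ (after-D ⊛ g) n
    forced 0 = refl
    forced 1 = refl
    -- The first forced letter raises the counter to 3, too small for a hit; the second reaches 4
    -- and restores the parity.
    forced (suc (suc n)) = proceeded-halted 4 false n (accepted-found 4 false n)

-- Exchange the parities of all runs of the text.
found-flip : ∀ k t n → found (triple false) k t n ≡ found (triple true) k (not t) n
found-flip k t zero = refl
found-flip k t (suc n) = begin
  found o 2 true n + halted o (suc k) (not t) n + count 2 n (λ w → finishes o 2 false (micros w))
    ≡⟨ swap-last (found o 2 true n) (halted o (suc k) (not t) n) (d-o n) ⟩
  (found o 2 true n + d-o n) + halted o (suc k) (not t) n
    ≡⟨ cong₂ _+_ (fresh n (found-flip 2 false n) (λ { m refl → found-flip 4 true m })) halted-flip ⟩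
  (found e 2 true n + d-e n) + halted e (suc k) (not (not t)) n
    ≡⟨ sym (swap-last (found e 2 true n) (halted e (suc k) (not (not t)) n) (d-e n)) ⟩
  found e 2 true n + halted e (suc k) (not (not t)) n + count 2 n (λ w → finishes e 2 false (micros w)) ∎
  where
  open ≡-Reasoning
  o = triple false
  e = triple true
  d-o d-e : ℕ → ℕ
  d-o n = count 2 n (λ w → finishes o 2 false (micros w))
  d-e n = count 2 n (λ w → finishes e 2 false (micros w))
  swap-last : ∀ a b c → a + b + c ≡ (a + c) + b
  swap-last = solve-∀
  halted-flip : halted o (suc k) (not t) n ≡ halted e (suc k) (not (not t)) n
  halted-flip with hit? o (suc k) (not t)
  ... | yes hit@(le , par) = trans (count-cong 0 n (λ w → halts-hit o (micros w) hit))
    (sym (count-cong 0 n (λ w → halts-hit e (micros w) (le , λ 2≤2 → cong not (par 2≤2)))))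
  ... | no ¬hit = trans (count-cong 0 n (λ w → halts-miss o (micros w) ¬hit))
    (trans (found-flip (suc k) (not t) n) (sym (count-cong 0 n (λ w → halts-miss e (micros w)
      λ (le , par) → ¬hit (le , λ 2≤2 → Bool.not-injective (par 2≤2))))))
  -- Only runs of at least three vertices change sides: `N` followed by two `C` trades places with
  -- `D`, while runs of one or two vertices stay with `N`. So two further letters must be unfolded.
  fresh : ∀ n → found o 2 false n ≡ found e 2 true n →
          (∀ m → n ≡ suc (suc m) → found o 4 true m ≡ found e 4 false m) →
          found o 2 true n + d-o n ≡ found e 2 true n + d-e n
  fresh 0 _ _ = refl
  fresh 1 _ _ = refl
  fresh (suc (suc m)) ih₂ ih₄ rewrite sym ih₂ | sym (ih₄ m refl) =
    rearrange (found o 2 true (suc m)) (found o 2 true m) (found o 4 true m) (d-o m) (d-o (suc m)) (null-only m)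
    where
    rearrange : ∀ a b c d x z → (a + (b + c + d) + x) + z ≡ (a + (b + z + d) + x) + c
    rearrange = solve-∀

-- Relative to the preceding run, the second and third runs keep and change the
-- parity on the left, and change and keep it on the right.
parity-swap : ∀ q → (triple false ∷ triple false ∷ triple true ∷ q) ≈ (triple false ∷ triple true ∷ triple true ∷ q)
parity-swap q = ≈-extend o reached
  where
  open ≡-Reasoning
  o = triple false
  e = triple true
  swapped : ∀ n → accepted (o ∷ e ∷ q) 0 false n ≡ accepted (e ∷ e ∷ q) 0 false n
  swapped n = begin
    accepted (o ∷ e ∷ q) 0 false n
      ≡⟨ accepted-found false (e ∷ q) 0 false n ⟩
    (found o 0 false ⊛ accepted (e ∷ q) 0 false) n
      ≡⟨ ⊛-cong (found-flip 0 false) (accepted-found true q 0 false) n ⟩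
    (found e 0 true ⊛ (found e 0 false ⊛ accepted q 0 true)) n
      ≡⟨ ⊛-swap (found e 0 true) (found e 0 false) (accepted q 0 true) n ⟩
    (found e 0 false ⊛ (found e 0 true ⊛ accepted q 0 true)) n
      ≡⟨ ⊛-cong {f = found e 0 false} (λ _ → refl) (λ i → sym (accepted-found true q 0 true i)) n ⟩
    (found e 0 false ⊛ accepted (e ∷ q) 0 true) n
      ≡⟨ sym (accepted-found true (e ∷ q) 0 false n) ⟩
    accepted (e ∷ e ∷ q) 0 false n ∎
  reached : ∀ k t j n → Aligned k j → Hit o k t →
    count j n (λ w → accepts (o ∷ e ∷ q) 0 t (micros w)) ≡ count j n (λ w → accepts (e ∷ e ∷ q) 0 t (micros w))
  reached k t zero n _ (_ , par) with refl ← par (s≤s (s≤s z≤n)) = swapped n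
  -- A hit of three vertices needs counter 4, so alignment leaves no forced letters.
  reached k t (suc j) n (inj₂ k+j≤4) (4≤k , _) = contradiction
    (ℕ.≤-trans (ℕ.+-monoˡ-≤ (suc j) 4≤k) k+j≤4) (ℕ.<⇒≱ (ℕ.m<m+n 4 (s≤s z≤n)))

-- Normal forms

infix 4 _⟶_

-- The last N closes the third run, so root replaces 312 ⊕ 312 ⊕ 231 by
-- 312 ⊕ 231 ⊕ 231.
data _⟶_ : ∀ {j n} → Code j n → Code j n → Set where
  root : ∀ {n} (u : Code 0 n) →
    D (C′ (C′ (D (C′ (C′ (N (C (C (N u))))))))) ⟶ D (C′ (C′ (N (C (C (N (C (C (N u)))))))))
  in-N : ∀ {n} {w w′ : Code 0 n} → w ⟶ w′ → N w ⟶ N w′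
  in-C : ∀ {n} {w w′ : Code 0 n} → w ⟶ w′ → C w ⟶ C w′
  in-D : ∀ {n} {w w′ : Code 2 n} → w ⟶ w′ → D w ⟶ D w′
  in-C′ : ∀ {j n} {w w′ : Code j n} → w ⟶ w′ → C′ w ⟶ C′ w′

runs-⟶ : ∀ {j n} {w w′ : Code j n} → w ⟶ w′ → ∀ k e → runs k e (micros w) ≈ runs k e (micros w′)
runs-⟶ (root u) k e = ≈-∷ (k , e) (parity-swap (runs 0 true (micros u)))
runs-⟶ (in-N s) k e = ≈-∷ (k , e) (runs-⟶ s 0 true)
runs-⟶ (in-C s) k e = runs-⟶ s (suc k) (not e)
runs-⟶ (in-D s) k e = ≈-∷ (k , e) (runs-⟶ s 0 false)
runs-⟶ (in-C′ s) k e = runs-⟶ s (suc k) (not e)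

⟶⇒∼ : ∀ {n} {w w′ : Code 0 n} → w ⟶ w′ → perm w ∼ perm w′
⟶⇒∼ {w = w} {w′} s = ≈⇒∼ w w′ (by-letter s)
  where
  by-letter : ∀ {n} {w w′ : Code 0 n} → w ⟶ w′ → blocks w ≈ blocks w′
  by-letter (root u) = parity-swap (runs 0 true (micros u))
  by-letter (in-N s) = runs-⟶ s 0 true
  by-letter (in-C s) = runs-⟶ s 0 false
  by-letter (in-D s) = runs-⟶ s 0 false

-- The termination measure: `root` makes the middle one of its three runs even.
odd-runs : ∀ {j n} → Code j n → ℕ
odd-runs end = 0
odd-runs (N w) = odd-runs w
odd-runs (C w) = odd-runs w
odd-runs (D w) = suc (odd-runs w)
odd-runs (C′ w) = odd-runs w

odd-runs-⟶ : ∀ {j n} {w w′ : Code j n} → w ⟶ w′ → odd-runs w ≡ suc (odd-runs w′)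
odd-runs-⟶ (root u) = refl
odd-runs-⟶ (in-N s) = odd-runs-⟶ s
odd-runs-⟶ (in-C s) = odd-runs-⟶ s
odd-runs-⟶ (in-D s) = cong suc (odd-runs-⟶ s)
odd-runs-⟶ (in-C′ s) = odd-runs-⟶ s

reducible : ∀ {n} → Code 2 n → Bool
reducible (C′ (C′ (D (C′ (C′ (N (C (C (N u))))))))) = true
reducible _ = false

reduced : ∀ {j n} → Code j n → Bool
reduced end = true
reduced (N w) = reduced w
reduced (C w) = reduced w
reduced (D w) = reduced w ∧ not (reducible w)
reduced (C′ w) = reduced w

reducible⇒⟶ : ∀ {n} (w : Code 2 n) → reducible w ≡ true → ∃[ w′ ] D w ⟶ w′
reducible⇒⟶ (C′ (C′ (D (C′ (C′ (N (C (C (N u))))))))) _ = _ , root u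

reduce : ∀ {j n} (w : Code j n) → reduced w ≡ true ⊎ ∃[ w′ ] w ⟶ w′
reduce end = inj₁ refl
reduce (N w) with reduce w
... | inj₁ r = inj₁ r
... | inj₂ (w′ , s) = inj₂ (N w′ , in-N s)
reduce (C w) with reduce w
... | inj₁ r = inj₁ r
... | inj₂ (w′ , s) = inj₂ (C w′ , in-C s)
reduce (C′ w) with reduce w
... | inj₁ r = inj₁ r
... | inj₂ (w′ , s) = inj₂ (C′ w′ , in-C′ s)
reduce (D w) with reduce w | reducible w in eq
... | inj₂ (w′ , s) | _ = inj₂ (D w′ , in-D s)
... | inj₁ r | true = inj₂ (reducible⇒⟶ w eq)
... | inj₁ r | false = inj₁ (cong (_∧ true) r)

normal-form : ∀ {n} d (w : Code 0 n) → odd-runs w ≡ d → Σ[ w′ ∈ Code 0 n ] reduced w′ ≡ true × perm w ∼ perm w′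
normal-form d w eq with reduce w
... | inj₁ r = w , r , λ _ → refl
normal-form zero w eq | inj₂ (w′ , s) with () ← trans (sym eq) (odd-runs-⟶ s)
normal-form (suc d) w eq | inj₂ (w′ , s) =
  let w″ , r , ∼″ = normal-form d w′ (ℕ.suc-injective (trans (sym (odd-runs-⟶ s)) eq)) in
  w″ , r , λ m → trans (⟶⇒∼ s m) (∼″ m)

-- Recurrences for reduced codes and for all codes

reducedCodes : ℕ → ℕ
reducedCodes n = count 0 n reduced

allCodes : ℕ → ℕ
allCodes n = count 0 n (λ _ → true)

count-N : ∀ n (p : Code 0 (suc n) → Bool) → count 0 n (p ∘ N) ℕ.≤ count 0 (suc n) p
count-N n p = ℕ.≤-trans (ℕ.m≤m+n (count 0 n (p ∘ N)) (count 0 n (p ∘ C))) (ℕ.m≤m+n _ (count 2 n (p ∘ D)))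

count-C : ∀ n (p : Code 0 (suc n) → Bool) → count 0 n (p ∘ C) ℕ.≤ count 0 (suc n) p
count-C n p = ℕ.≤-trans (ℕ.m≤n+m (count 0 n (p ∘ C)) (count 0 n (p ∘ N))) (ℕ.m≤m+n _ (count 2 n (p ∘ D)))

count-D : ∀ n (p : Code 0 (suc n) → Bool) → count 2 n (p ∘ D) ℕ.≤ count 0 (suc n) p
count-D n p = ℕ.m≤n+m (count 2 n (p ∘ D)) (count 0 n (p ∘ N) + count 0 n (p ∘ C))

count-C′C′ : ∀ n (p : Code 2 (2 + n) → Bool) → count 0 n (λ w → p (C′ (C′ w))) ℕ.≤ count 2 (2 + n) p
count-C′C′ n p = ℕ.≤-refl

AllPairs-lookup : ∀ {A : Set} {R : A → A → Set} {xs : List A} → AllPairs R xs →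
                  ∀ i j → i Fin.< j → R (List.lookup xs i) (List.lookup xs j)
AllPairs-lookup {xs = x ∷ xs} (Rx ∷ _) zero (suc j) _ = All.lookup Rx (∈-lookup {xs = xs} j)
AllPairs-lookup (_ ∷ Rxs) (suc i) (suc j) (s≤s i<j) = AllPairs-lookup Rxs i j i<j

SIO-normal-form : ∀ {n} (π : Word n) → SIO π → Σ[ w ∈ Code 0 n ] reduced w ≡ true × π ∼ perm w
SIO-normal-form π sio with w , _ , refl ← perm-surjective sio = normal-form (odd-runs w) w refl

same-normal-form : ∀ {n} {π σ : Word n} (w w′ : Code 0 n) → π ∼ perm w → σ ∼ perm w′ → w ≡ w′ → π ∼ σ
same-normal-form w w′ π∼ σ∼ refl m = trans (π∼ m) (sym (σ∼ m))

injection≤reducedCodes : ∀ {k n} (code : Fin k → Code 0 n) → (∀ i → reduced (code i) ≡ true) →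
                         (∀ i j → i Fin.< j → code i ≢ code j) → k ℕ.≤ reducedCodes n
injection≤reducedCodes {k} {n} code red distinct =
  subst (k ℕ.≤_) (length-select 0 n reduced) (Fin.injective⇒≤ {f = f} f-injective)
  where
  code∈ : ∀ i → code i ∈ select 0 n reduced
  code∈ i = ∈-select⁺ reduced (code i) (red i)
  f : Fin k → Fin (length (select 0 n reduced))
  f i = Any.index (code∈ i)
  code≡ : ∀ i j → f i ≡ f j → code i ≡ code j
  code≡ i j eq = trans (Any.lookup-index (code∈ i))
    (trans (cong (List.lookup (select 0 n reduced)) eq) (sym (Any.lookup-index (code∈ j))))
  f-injective : ∀ {i j} → f i ≡ f j → i ≡ j
  f-injective {i} {j} eq with Fin.<-cmp i j
  ... | tri< i<j _ _ = contradiction (code≡ i j eq) (distinct i j i<j)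
  ... | tri≈ _ i≡j _ = i≡j
  ... | tri> _ _ j<i = contradiction (code≡ j i (sym eq)) (distinct j i j<i)

-- Representatives with the same reduced code would be equivalent, so the representatives inject
-- into the reduced codes.
classes≤reduced : ∀ {n w} → WilfClasses n w → w ℕ.≤ reducedCodes n
classes≤reduced {n} (reps , refl , sio , distinct , _) = injection≤reducedCodes
  (λ i → proj₁ (nf i)) (λ i → proj₁ (proj₂ (nf i)))
  (λ i j i<j eq → AllPairs-lookup distinct i j i<j
    (same-normal-form {π = List.lookup reps i} {List.lookup reps j} (proj₁ (nf i)) (proj₁ (nf j))
      (proj₂ (proj₂ (nf i))) (proj₂ (proj₂ (nf j))) eq))
  where
  nf : ∀ i → Σ[ w ∈ Code 0 n ] reduced w ≡ true × List.lookup reps i ∼ perm w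
  nf i = SIO-normal-form (List.lookup reps i) (All.lookup sio (∈-lookup {xs = reps} i))

c-count : ∀ m → c m ≡ count 0 m (λ w → starts w ∧ true)
c-count m = trans (cong length (sym (List.filter-all R? (All.tabulate {xs = sio m} (λ _ → tt)))))
  (count-sio R? (λ _ → true) (λ _ → mk⇔ (λ _ → tt) (λ _ → refl)))
  where
  R? : (π : Word m) → Dec ⊤
  R? _ = yes tt

-- After a leading `N` any code may follow.
allCodes≤c : ∀ n → allCodes n ℕ.≤ c (suc n)
allCodes≤c n = subst (allCodes n ℕ.≤_) (sym (c-count (suc n)))
  (count-N n (λ w → starts w ∧ true))

reducedCodes≤allCodes : ∀ n → reducedCodes n ℕ.≤ allCodes n
reducedCodes≤allCodes n = ℕ.≤-trans (ℕ.m≤n+m _ _) (ℕ.≤-reflexive (count-split 0 n (λ _ → true) reduced))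

reducedCodes-mono : ∀ n → reducedCodes n ℕ.≤ reducedCodes (suc n)
reducedCodes-mono n = ℕ.≤-trans (ℕ.m≤m+n _ _) (ℕ.m≤m+n _ _)

allCodes-mono : ∀ n → allCodes n ℕ.≤ allCodes (suc n)
allCodes-mono n = ℕ.≤-trans (ℕ.m≤m+n _ _) (ℕ.m≤m+n _ _)

triple-bound : ∀ {x y} → y ℕ.≤ x → x + x + y ℕ.≤ 3 ℕ.* x
triple-bound {x} {y} y≤x = ℕ.≤-trans (ℕ.+-monoʳ-≤ (x + x) y≤x) (ℕ.≤-reflexive (eq x))
  where
  eq : ∀ x → x + x + x ≡ 3 ℕ.* x
  eq = solve-∀

allCodes-growth : ∀ n → allCodes (suc n) ℕ.≤ 3 ℕ.* allCodes n
allCodes-growth n = triple-bound (forced n)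
  where
  forced : ∀ n → count 2 n (λ _ → true) ℕ.≤ allCodes n
  forced 0 = z≤n
  forced 1 = z≤n
  forced (suc (suc n)) = ℕ.≤-trans (allCodes-mono n) (allCodes-mono (suc n))

reducedCodes-forced : ∀ n → count 2 n reduced ℕ.≤ reducedCodes n
reducedCodes-forced 0 = z≤n
reducedCodes-forced 1 = z≤n
reducedCodes-forced (suc (suc n)) = ℕ.≤-trans (reducedCodes-mono n) (reducedCodes-mono (suc n))

reducedCodes-growth : ∀ n → reducedCodes (suc n) ℕ.≤ 3 ℕ.* reducedCodes n
reducedCodes-growth n = triple-bound (ℕ.≤-trans
  (ℕ.≤-trans (ℕ.m≤m+n _ _) (ℕ.≤-reflexive (count-split 2 n reduced reducible))) (reducedCodes-forced n))

redexes : ∀ {n} → Code 2 n → Bool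
redexes w = reduced w ∧ reducible w

-- A new first letter spoils a reduced code only if it is `D` and completes a redex; these codes are
-- added back on the left.
reducedCodes-suc : ∀ n → reducedCodes (suc n) + count 2 n redexes ≡ 2 ℕ.* reducedCodes n + count 2 n reduced
reducedCodes-suc n = trans (ℕ.+-assoc (A + A) _ _)
  (cong₂ _+_ (cong (A +_) (sym (ℕ.+-identityʳ A))) (count-split 2 n reduced reducible))
  where
  A = reducedCodes n

-- Redexes do not overlap, so prefixing one to a reduced code creates no other.
redexes≥ : ∀ n → reducedCodes n ℕ.≤ count 2 (9 + n) redexes
redexes≥ n = begin
  count 0 n reduced       ≡⟨ count-cong 0 n (λ w → sym (trans (Bool.∧-identityʳ (reduced w ∧ true)) (Bool.∧-identityʳ (reduced w)))) ⟩
  count 0 n (p₄ ∘ N)      ≤⟨ count-N n p₄ ⟩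
  count 0 (1 + n) p₄      ≤⟨ count-C (1 + n) p₃ ⟩
  count 0 (2 + n) p₃      ≤⟨ count-C (2 + n) p₂ ⟩
  count 0 (3 + n) p₂      ≤⟨ count-N (3 + n) p₁ ⟩
  count 0 (4 + n) p₁      ≤⟨ count-C′C′ (4 + n) p₀ ⟩
  count 2 (6 + n) p₀      ≤⟨ count-D (6 + n) p ⟩
  count 0 (7 + n) p       ≤⟨ count-C′C′ (7 + n) redexes ⟩
  count 2 (9 + n) redexes ∎
  where
  open ℕ.≤-Reasoning
  p : Code 0 (7 + n) → Bool
  p w = redexes (C′ (C′ w))
  p₀ : Code 2 (6 + n) → Bool
  p₀ = p ∘ D
  p₁ : Code 0 (4 + n) → Bool
  p₁ w = p₀ (C′ (C′ w))
  p₂ : Code 0 (3 + n) → Bool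
  p₂ = p₁ ∘ N
  p₃ : Code 0 (2 + n) → Bool
  p₃ = p₂ ∘ C
  p₄ : Code 0 (1 + n) → Bool
  p₄ = p₃ ∘ C

allCodes-suc : ∀ n → allCodes (3 + n) ≡ allCodes (2 + n) + allCodes (2 + n) + allCodes n
allCodes-suc n = refl

-- A redex has ten letters: `D` and nine more, before an arbitrary reduced code.
reducedCodes-recurrence : ∀ n →
  reducedCodes (10 + n) + reducedCodes n ℕ.≤ 2 ℕ.* reducedCodes (9 + n) + reducedCodes (7 + n)
reducedCodes-recurrence n = ℕ.≤-trans (ℕ.+-monoʳ-≤ (reducedCodes (10 + n)) (redexes≥ n))
  (ℕ.≤-reflexive (trans (reducedCodes-suc (9 + n))
    (cong (2 ℕ.* reducedCodes (9 + n) +_) (forced (7 + n)))))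
  where
  forced : ∀ n → count 2 (2 + n) reduced ≡ reducedCodes n
  forced n = refl

-- Growth rates

-- The loss on the right is at most 5 d u² A, since u³ - v³ ≤ 3 d u².
recurrence-step : ∀ {a₁₀ a₀ A B} g v d → a₁₀ + a₀ ℕ.≤ 2 ℕ.* A + B → B ℕ.≤ A → A ℕ.≤ g ℕ.* a₀ →
  5 ℕ.* (g ℕ.* d) ℕ.≤ v + d → let u = v + d in
  a₁₀ ℕ.* (u ℕ.* u ℕ.* u) ℕ.≤ 2 ℕ.* v ℕ.* (u ℕ.* u) ℕ.* A + v ℕ.* v ℕ.* v ℕ.* B
recurrence-step {a₁₀} {a₀} {A} {B} g v d rec B≤A A≤ga₀ small = ℕ.+-cancelʳ-≤ (u ℕ.* u ℕ.* u ℕ.* a₀) _ _ (begin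
  a₁₀ ℕ.* (u ℕ.* u ℕ.* u) + u ℕ.* u ℕ.* u ℕ.* a₀
    ≡⟨ factor a₁₀ a₀ (u ℕ.* u ℕ.* u) ⟩
  u ℕ.* u ℕ.* u ℕ.* (a₁₀ + a₀)
    ≤⟨ ℕ.*-monoʳ-≤ (u ℕ.* u ℕ.* u) rec ⟩
  u ℕ.* u ℕ.* u ℕ.* (2 ℕ.* A + B)
    -- The added coefficient is the slack 3 d u² - (u³ - v³), which makes the next step an identity.
    ≤⟨ ℕ.m≤m+n _ ((3 ℕ.* v ℕ.* d ℕ.* d + 2 ℕ.* d ℕ.* d ℕ.* d) ℕ.* B) ⟩
  u ℕ.* u ℕ.* u ℕ.* (2 ℕ.* A + B) + (3 ℕ.* v ℕ.* d ℕ.* d + 2 ℕ.* d ℕ.* d ℕ.* d) ℕ.* B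
    ≡⟨ expand v d A B ⟩
  main + (2 ℕ.* d ℕ.* (u ℕ.* u) ℕ.* A + 3 ℕ.* d ℕ.* (u ℕ.* u) ℕ.* B)
    ≤⟨ ℕ.+-monoʳ-≤ main (ℕ.+-monoʳ-≤ (2 ℕ.* d ℕ.* (u ℕ.* u) ℕ.* A) (ℕ.*-monoʳ-≤ (3 ℕ.* d ℕ.* (u ℕ.* u)) B≤A)) ⟩
  main + (2 ℕ.* d ℕ.* (u ℕ.* u) ℕ.* A + 3 ℕ.* d ℕ.* (u ℕ.* u) ℕ.* A)
    ≡⟨ cong (main +_) (collect d (u ℕ.* u) A) ⟩
  main + 5 ℕ.* d ℕ.* (u ℕ.* u) ℕ.* A
    ≤⟨ ℕ.+-monoʳ-≤ main (ℕ.*-monoʳ-≤ (5 ℕ.* d ℕ.* (u ℕ.* u)) A≤ga₀) ⟩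
  main + 5 ℕ.* d ℕ.* (u ℕ.* u) ℕ.* (g ℕ.* a₀)
    ≡⟨ cong (main +_) (regroup d (u ℕ.* u) g a₀) ⟩
  main + u ℕ.* u ℕ.* (5 ℕ.* (g ℕ.* d)) ℕ.* a₀
    ≤⟨ ℕ.+-monoʳ-≤ main (ℕ.*-monoˡ-≤ a₀ (ℕ.*-monoʳ-≤ (u ℕ.* u) small)) ⟩
  main + u ℕ.* u ℕ.* u ℕ.* a₀ ∎)
  where
  open ℕ.≤-Reasoning
  u = v + d
  main = 2 ℕ.* v ℕ.* (u ℕ.* u) ℕ.* A + v ℕ.* v ℕ.* v ℕ.* B
  factor : ∀ x y z → x ℕ.* z + z ℕ.* y ≡ z ℕ.* (x + y)
  factor = solve-∀
  expand : ∀ v d A B → (v + d) ℕ.* (v + d) ℕ.* (v + d) ℕ.* (2 ℕ.* A + B) + (3 ℕ.* v ℕ.* d ℕ.* d + 2 ℕ.* d ℕ.* d ℕ.* d) ℕ.* B ≡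
    2 ℕ.* v ℕ.* ((v + d) ℕ.* (v + d)) ℕ.* A + v ℕ.* v ℕ.* v ℕ.* B +
    (2 ℕ.* d ℕ.* ((v + d) ℕ.* (v + d)) ℕ.* A + 3 ℕ.* d ℕ.* ((v + d) ℕ.* (v + d)) ℕ.* B)
  expand = solve-∀
  collect : ∀ d w A → 2 ℕ.* d ℕ.* w ℕ.* A + 3 ℕ.* d ℕ.* w ℕ.* A ≡ 5 ℕ.* d ℕ.* w ℕ.* A
  collect = solve-∀
  regroup : ∀ d w g a → 5 ℕ.* d ℕ.* w ℕ.* (g ℕ.* a) ≡ w ℕ.* (5 ℕ.* (g ℕ.* d)) ℕ.* a
  regroup = solve-∀

reducedCodes-iterated : ∀ k n → reducedCodes (k + n) ℕ.≤ 3 ℕ.^ k ℕ.* reducedCodes n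
reducedCodes-iterated zero n = ℕ.≤-reflexive (sym (ℕ.*-identityˡ _))
reducedCodes-iterated (suc k) n = ℕ.≤-trans (reducedCodes-growth (k + n))
  (ℕ.≤-trans (ℕ.*-monoʳ-≤ 3 (reducedCodes-iterated k n)) (ℕ.≤-reflexive (sym (ℕ.*-assoc 3 (3 ℕ.^ k) _))))

-- With u = v + d, the sequence `reducedCodes n` times (u/v)ⁿ satisfies the recurrence of `allCodes`
-- as an inequality, by `recurrence-step`; `K` covers the ten initial values.
decay : ∀ v d K .{{_ : NonZero v}} → 5 ℕ.* (3 ℕ.^ 9 ℕ.* d) ℕ.≤ v + d →
  (∀ n → n ℕ.< 10 → (v + d) ℕ.^ n ℕ.≤ K) → ∀ n →
  reducedCodes n ℕ.* (v + d) ℕ.^ n ℕ.≤ K ℕ.* (v ℕ.^ n ℕ.* allCodes n)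
decay v d K small K-large = <-rec Bounded step
  where
  open ℕ.≤-Reasoning
  u = v + d
  Bounded : ℕ → Set
  Bounded n = reducedCodes n ℕ.* u ℕ.^ n ℕ.≤ K ℕ.* (v ℕ.^ n ℕ.* allCodes n)
  from-earlier : ∀ m → Bounded (7 + m) → Bounded (9 + m) → Bounded (10 + m)
  from-earlier m ih₇ ih₉ = begin
    a₁₀ ℕ.* u ℕ.^ (10 + m)                                 ≡⟨ shift a₁₀ u x ⟩
    a₁₀ ℕ.* (u ℕ.* u ℕ.* u) ℕ.* x
      ≤⟨ ℕ.*-monoˡ-≤ x (recurrence-step {a₁₀} {reducedCodes m} {A} {B} (3 ℕ.^ 9) v d (reducedCodes-recurrence m)
           (ℕ.≤-trans (reducedCodes-mono (7 + m)) (reducedCodes-mono (8 + m)))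
           (reducedCodes-iterated 9 m) small) ⟩
    (2 ℕ.* v ℕ.* (u ℕ.* u) ℕ.* A + v ℕ.* v ℕ.* v ℕ.* B) ℕ.* x          ≡⟨ distribute v u A B x ⟩
    2 ℕ.* v ℕ.* (A ℕ.* (u ℕ.* (u ℕ.* x))) + v ℕ.* v ℕ.* v ℕ.* (B ℕ.* x)
      ≤⟨ ℕ.+-mono-≤ (ℕ.*-monoʳ-≤ (2 ℕ.* v) ih₉) (ℕ.*-monoʳ-≤ (v ℕ.* v ℕ.* v) ih₇) ⟩
    2 ℕ.* v ℕ.* (K ℕ.* (v ℕ.* (v ℕ.* y) ℕ.* f₉)) + v ℕ.* v ℕ.* v ℕ.* (K ℕ.* (y ℕ.* f₇))
      ≡⟨ collect v K y f₉ f₇ ⟩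
    K ℕ.* (v ℕ.* (v ℕ.* (v ℕ.* y)) ℕ.* (f₉ + f₉ + f₇))
      ≡⟨ cong (λ f → K ℕ.* (v ℕ.* (v ℕ.* (v ℕ.* y)) ℕ.* f)) (sym (allCodes-suc (7 + m))) ⟩
    K ℕ.* (v ℕ.^ (10 + m) ℕ.* allCodes (10 + m))             ∎
    where
    a₁₀ = reducedCodes (10 + m)
    A = reducedCodes (9 + m)
    B = reducedCodes (7 + m)
    f₉ = allCodes (9 + m)
    f₇ = allCodes (7 + m)
    x = u ℕ.^ (7 + m)
    y = v ℕ.^ (7 + m)
    shift : ∀ a u x → a ℕ.* (u ℕ.* (u ℕ.* (u ℕ.* x))) ≡ a ℕ.* (u ℕ.* u ℕ.* u) ℕ.* x
    shift = solve-∀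
    distribute : ∀ v u A B x → (2 ℕ.* v ℕ.* (u ℕ.* u) ℕ.* A + v ℕ.* v ℕ.* v ℕ.* B) ℕ.* x ≡
      2 ℕ.* v ℕ.* (A ℕ.* (u ℕ.* (u ℕ.* x))) + v ℕ.* v ℕ.* v ℕ.* (B ℕ.* x)
    distribute = solve-∀
    collect : ∀ v K y f g → 2 ℕ.* v ℕ.* (K ℕ.* (v ℕ.* (v ℕ.* y) ℕ.* f)) + v ℕ.* v ℕ.* v ℕ.* (K ℕ.* (y ℕ.* g)) ≡
      K ℕ.* (v ℕ.* (v ℕ.* (v ℕ.* y)) ℕ.* (f + f + g))
    collect = solve-∀
  base : ∀ n → n ℕ.< 10 → Bounded n
  base n n<10 = begin
    reducedCodes n ℕ.* u ℕ.^ n        ≤⟨ ℕ.*-mono-≤ (reducedCodes≤allCodes n) (K-large n n<10) ⟩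
    allCodes n ℕ.* K                ≡⟨ ℕ.*-comm (allCodes n) K ⟩
    K ℕ.* allCodes n                ≤⟨ ℕ.*-monoʳ-≤ K (ℕ.m≤n*m (allCodes n) (v ℕ.^ n) {{ℕ.m^n≢0 v n}}) ⟩
    K ℕ.* (v ℕ.^ n ℕ.* allCodes n)      ∎
  shifted : ∀ m n → 10 + m ≡ n → (∀ {k} → k ℕ.< n → Bounded k) → Bounded n
  shifted m _ refl ih = from-earlier m (ih (s≤s (ℕ.m≤n+m (7 + m) 2))) (ih ℕ.≤-refl)
  step : ∀ n → (∀ {k} → k ℕ.< n → Bounded k) → Bounded n
  step n ih = [ base n , (λ 10≤n → let m , eq = ℕ.m≤n⇒∃[o]m+o≡n 10≤n in shifted m n eq ih) ]′ (ℕ.<-≤-connex n 10)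

-- Bernoulli's inequality 1 + n/l ≤ (1 + 1/l)ⁿ, multiplied by the power n + 1 of l.
bernoulli : ∀ l n → l ℕ.^ n ℕ.* (l + n) ℕ.≤ l ℕ.* suc l ℕ.^ n
bernoulli l zero = ℕ.≤-reflexive (eq l)
  where
  eq : ∀ l → 1 ℕ.* (l + 0) ≡ l ℕ.* 1
  eq = solve-∀
bernoulli l (suc n) = begin
  l ℕ.* l ℕ.^ n ℕ.* (l + suc n)              ≡⟨ expand l (l ℕ.^ n) n ⟩
  l ℕ.* (l ℕ.^ n ℕ.* (l + n)) + l ℕ.* l ℕ.^ n    ≤⟨ ℕ.+-mono-≤ (ℕ.*-monoʳ-≤ l (bernoulli l n)) (ℕ.*-monoʳ-≤ l (ℕ.^-monoˡ-≤ n (ℕ.n≤1+n l))) ⟩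
  l ℕ.* (l ℕ.* suc l ℕ.^ n) + l ℕ.* suc l ℕ.^ n  ≡⟨ collect l (suc l ℕ.^ n) ⟩
  l ℕ.* (suc l ℕ.* suc l ℕ.^ n)              ∎
  where
  open ℕ.≤-Reasoning
  expand : ∀ l x n → l ℕ.* x ℕ.* (l + suc n) ≡ l ℕ.* (x ℕ.* (l + n)) + l ℕ.* x
  expand = solve-∀
  collect : ∀ l x → l ℕ.* (l ℕ.* x) + l ℕ.* x ≡ l ℕ.* (suc l ℕ.* x)
  collect = solve-∀

exponential-beats : ∀ l .{{_ : NonZero l}} K n → K ℕ.* l ℕ.≤ n → K ℕ.* l ℕ.^ n ℕ.≤ suc l ℕ.^ n
exponential-beats l K n Kl≤n = ℕ.*-cancelˡ-≤ l (begin
  l ℕ.* (K ℕ.* l ℕ.^ n)  ≡⟨ swap l K (l ℕ.^ n) ⟩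
  l ℕ.^ n ℕ.* (K ℕ.* l)  ≤⟨ ℕ.*-monoʳ-≤ (l ℕ.^ n) (ℕ.≤-trans Kl≤n (ℕ.m≤n+m n l)) ⟩
  l ℕ.^ n ℕ.* (l + n)  ≤⟨ bernoulli l n ⟩
  l ℕ.* suc l ℕ.^ n    ∎)
  where
  open ℕ.≤-Reasoning
  swap : ∀ l K x → l ℕ.* (K ℕ.* x) ≡ x ℕ.* (K ℕ.* l)
  swap = solve-∀

^-square : ∀ x n → (x ℕ.* x) ℕ.^ n ≡ x ℕ.^ n ℕ.* x ℕ.^ n
^-square x zero = refl
^-square x (suc n) rewrite ^-square x n = eq x (x ℕ.^ n)
  where
  eq : ∀ x y → x ℕ.* x ℕ.* (y ℕ.* y) ≡ x ℕ.* y ℕ.* (x ℕ.* y)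
  eq = solve-∀

-- `decay` with v = l² and u = (l+1)² gives the ratio l/(l+1) to the power 2n. Half of it is the
-- claimed rate; the other half outweighs 3 K q, where 1/q stands for ε. The factor 3 pays for
-- passing from `allCodes n` to `c n`.
few-classes : ∀ l .{{_ : NonZero l}} → 10 ℕ.* 3 ℕ.^ 9 ℕ.≤ suc l →
  ∀ K → (∀ n → n ℕ.< 10 → (l ℕ.* l + (2 ℕ.* l + 1)) ℕ.^ n ℕ.≤ K) → ∀ q →
  ∃[ N ] ∀ n → N ℕ.≤ n → ∀ w → WilfClasses n w → w ℕ.* (q ℕ.* suc l ℕ.^ n) ℕ.≤ l ℕ.^ n ℕ.* c n
few-classes l large K K-large q = suc (q ℕ.* (3 ℕ.* K) ℕ.* l) , bound
  where
  open ℕ.≤-Reasoning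
  v = l ℕ.* l
  d = 2 ℕ.* l + 1
  u≡ : v + d ≡ suc l ℕ.* suc l
  u≡ = eq l
    where
    eq : ∀ l → l ℕ.* l + (2 ℕ.* l + 1) ≡ suc l ℕ.* suc l
    eq = solve-∀
  -- As d = 2 l + 1 is below 2 (l+1), it is enough that 10 · 3⁹ ≤ l + 1.
  small : 5 ℕ.* (3 ℕ.^ 9 ℕ.* d) ℕ.≤ v + d
  small = begin
    5 ℕ.* (3 ℕ.^ 9 ℕ.* d)      ≤⟨ ℕ.m≤m+n _ (5 ℕ.* 3 ℕ.^ 9) ⟩
    5 ℕ.* (3 ℕ.^ 9 ℕ.* d) + 5 ℕ.* 3 ℕ.^ 9 ≡⟨ eq (3 ℕ.^ 9) l ⟩
    10 ℕ.* 3 ℕ.^ 9 ℕ.* suc l   ≤⟨ ℕ.*-monoˡ-≤ (suc l) large ⟩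
    suc l ℕ.* suc l        ≡⟨ sym u≡ ⟩
    v + d                ∎
    where
    eq : ∀ g l → 5 ℕ.* (g ℕ.* (2 ℕ.* l + 1)) + 5 ℕ.* g ≡ 10 ℕ.* g ℕ.* suc l
    eq = solve-∀
  bound : ∀ n → suc (q ℕ.* (3 ℕ.* K) ℕ.* l) ℕ.≤ n → ∀ w → WilfClasses n w → w ℕ.* (q ℕ.* suc l ℕ.^ n) ℕ.≤ l ℕ.^ n ℕ.* c n
  bound n@(suc m) (s≤s N≤m) w classes = ℕ.*-cancelʳ-≤ _ _ (suc l ℕ.^ n) {{ℕ.m^n≢0 (suc l) n}} (begin
    w ℕ.* (q ℕ.* suc l ℕ.^ n) ℕ.* suc l ℕ.^ n       ≡⟨ shift w q (suc l ℕ.^ n) ⟩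
    q ℕ.* (w ℕ.* (suc l ℕ.^ n ℕ.* suc l ℕ.^ n))     ≡⟨ cong (λ x → q ℕ.* (w ℕ.* x)) (sym (trans (cong (ℕ._^ n) u≡) (^-square (suc l) n))) ⟩
    q ℕ.* (w ℕ.* (v + d) ℕ.^ n)                 ≤⟨ ℕ.*-monoʳ-≤ q (ℕ.*-monoˡ-≤ ((v + d) ℕ.^ n) (classes≤reduced classes)) ⟩
    q ℕ.* (reducedCodes n ℕ.* (v + d) ℕ.^ n)    ≤⟨ ℕ.*-monoʳ-≤ q (decay v d K {{ℕ.m*n≢0 l l}} small K-large n) ⟩
    q ℕ.* (K ℕ.* (v ℕ.^ n ℕ.* allCodes n))
      ≤⟨ ℕ.*-monoʳ-≤ q (ℕ.*-monoʳ-≤ K (ℕ.*-monoʳ-≤ (v ℕ.^ n) (ℕ.≤-trans (allCodes-growth m) (ℕ.*-monoʳ-≤ 3 (allCodes≤c m))))) ⟩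
    q ℕ.* (K ℕ.* (v ℕ.^ n ℕ.* (3 ℕ.* c n)))         ≡⟨ cong (λ x → q ℕ.* (K ℕ.* (x ℕ.* (3 ℕ.* c n)))) (^-square l n) ⟩
    q ℕ.* (K ℕ.* (l ℕ.^ n ℕ.* l ℕ.^ n ℕ.* (3 ℕ.* c n))) ≡⟨ regroup q K (l ℕ.^ n) (c n) ⟩
    q ℕ.* (3 ℕ.* K) ℕ.* l ℕ.^ n ℕ.* (l ℕ.^ n ℕ.* c n)
      ≤⟨ ℕ.*-monoˡ-≤ (l ℕ.^ n ℕ.* c n) (exponential-beats l (q ℕ.* (3 ℕ.* K)) n (ℕ.m≤n⇒m≤1+n N≤m)) ⟩
    suc l ℕ.^ n ℕ.* (l ℕ.^ n ℕ.* c n)             ≡⟨ ℕ.*-comm (suc l ℕ.^ n) (l ℕ.^ n ℕ.* c n) ⟩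
    l ℕ.^ n ℕ.* c n ℕ.* suc l ℕ.^ n               ∎)
    where
    shift : ∀ w q x → w ℕ.* (q ℕ.* x) ℕ.* x ≡ q ℕ.* (w ℕ.* (x ℕ.* x))
    shift = solve-∀
    regroup : ∀ q K y z → q ℕ.* (K ℕ.* (y ℕ.* y ℕ.* (3 ℕ.* z))) ≡ q ℕ.* (3 ℕ.* K) ℕ.* y ℕ.* (y ℕ.* z)
    regroup = solve-∀

-- Rational bounds

/-toℚᵘ : ∀ i n → ℚ.toℚᵘ (i ℚ./ suc n) ℚᵘ.≃ mkℚᵘ i n
/-toℚᵘ i n = ℚ.toℚᵘ-fromℚᵘ (mkℚᵘ i n)

fromℕ-* : ∀ m n → fromℕ (m ℕ.* n) ≡ fromℕ m * fromℕ n
fromℕ-* m n = ℚ.toℚᵘ-injective (begin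
  ℚ.toℚᵘ (fromℕ (m ℕ.* n))                     ≈⟨ /-toℚᵘ (ℤ.+ (m ℕ.* n)) 0 ⟩
  mkℚᵘ (ℤ.+ (m ℕ.* n)) 0                       ≡⟨ cong (λ i → mkℚᵘ i 0) (ℤ.pos-* m n) ⟩
  mkℚᵘ (ℤ.+ m) 0 ℚᵘ.* mkℚᵘ (ℤ.+ n) 0         ≈⟨ ℚᵘ.*-cong (/-toℚᵘ (ℤ.+ m) 0) (/-toℚᵘ (ℤ.+ n) 0) ⟨
  ℚ.toℚᵘ (fromℕ m) ℚᵘ.* ℚ.toℚᵘ (fromℕ n)     ≈⟨ ℚ.toℚᵘ-homo-* (fromℕ m) (fromℕ n) ⟨
  ℚ.toℚᵘ (fromℕ m * fromℕ n)               ∎)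
  where open ℚᵘ.≃-Reasoning

fromℕ-mono-≤ : ∀ {m n} → m ℕ.≤ n → fromℕ m ≤ fromℕ n
fromℕ-mono-≤ {m} {n} m≤n = ℚ.toℚᵘ-cancel-≤
  (ℚᵘ.≤-respˡ-≃ (ℚᵘ.≃-sym (/-toℚᵘ (ℤ.+ m) 0)) (ℚᵘ.≤-respʳ-≃ (ℚᵘ.≃-sym (/-toℚᵘ (ℤ.+ n) 0))
    (*≤* (ℤ.*-monoʳ-≤-nonNeg (ℤ.+ 1) (ℤ.+≤+ m≤n)))))

fromℕ-mono-< : ∀ {m n} → m ℕ.< n → fromℕ m < fromℕ n
fromℕ-mono-< {m} {n} m<n = ℚ.toℚᵘ-cancel-<
  (ℚᵘ.<-respˡ-≃ (ℚᵘ.≃-sym (/-toℚᵘ (ℤ.+ m) 0)) (ℚᵘ.<-respʳ-≃ (ℚᵘ.≃-sym (/-toℚᵘ (ℤ.+ n) 0))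
    (*<* (ℤ.*-monoʳ-<-pos (ℤ.+ 1) (ℤ.+<+ m<n)))))

fromℕ-positive : ∀ n .{{_ : NonZero n}} → ℚ.Positive (fromℕ n)
fromℕ-positive n = ℚ.positive (fromℕ-mono-< (ℕ.>-nonZero⁻¹ n))

ratio-* : ∀ l → ((ℤ.+ l) ℚ./ suc l) * fromℕ (suc l) ≡ fromℕ l
ratio-* l = ℚ.toℚᵘ-injective (begin
  ℚ.toℚᵘ (((ℤ.+ l) ℚ./ suc l) * fromℕ (suc l))
    ≈⟨ ℚ.toℚᵘ-homo-* ((ℤ.+ l) ℚ./ suc l) (fromℕ (suc l)) ⟩
  ℚ.toℚᵘ ((ℤ.+ l) ℚ./ suc l) ℚᵘ.* ℚ.toℚᵘ (fromℕ (suc l))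
    ≈⟨ ℚᵘ.*-cong (/-toℚᵘ (ℤ.+ l) l) (/-toℚᵘ (ℤ.+ suc l) 0) ⟩
  mkℚᵘ (ℤ.+ l) l ℚᵘ.* mkℚᵘ (ℤ.+ suc l) 0
    ≈⟨ *≡* (trans (ℤ.*-identityʳ _) (cong (ℤ.+ l ℤ.*_) (cong ℤ.+_ (sym (ℕ.*-identityʳ (suc l)))))) ⟩
  mkℚᵘ (ℤ.+ l) 0
    ≈⟨ /-toℚᵘ (ℤ.+ l) 0 ⟨
  ℚ.toℚᵘ (fromℕ l) ∎)
  where open ℚᵘ.≃-Reasoning

-- The denominator of `ε` serves as `q`, because the numerator is at least 1.
archimedean : ∀ ε → 0ℚ < ε → ∃[ q ] NonZero q × 1ℚ ≤ ε * fromℕ q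
archimedean ε@(mkℚ (ℤ.+ suc p) d _) _ = suc d , _ , ℚ.toℚᵘ-cancel-≤ (begin
  mkℚᵘ (ℤ.+ 1) 0
    ≤⟨ *≤* (ℤ.+≤+ (ℕ.≤-trans (ℕ.≤-reflexive (trans (ℕ.*-identityˡ _) (ℕ.*-identityʳ (suc d))))
         (ℕ.≤-trans (ℕ.m≤n*m (suc d) (suc p)) (ℕ.≤-reflexive (sym (ℕ.*-identityʳ (suc p ℕ.* suc d))))))) ⟩
  mkℚᵘ (ℤ.+ suc p) d ℚᵘ.* mkℚᵘ (ℤ.+ suc d) 0
    ≃⟨ ℚᵘ.*-cong (ℚᵘ.≃-refl {mkℚᵘ (ℤ.+ suc p) d}) (/-toℚᵘ (ℤ.+ suc d) 0) ⟨
  ℚ.toℚᵘ ε ℚᵘ.* ℚ.toℚᵘ (fromℕ (suc d))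
    ≃⟨ ℚ.toℚᵘ-homo-* ε (fromℕ (suc d)) ⟨
  ℚ.toℚᵘ (ε * fromℕ (suc d)) ∎)
  where open ℚᵘ.≤-Reasoning
archimedean (mkℚ (ℤ.+ zero) d _) 0<ε = contradiction (ℚ.positive 0<ε) λ ()
archimedean (mkℚ ℤ.-[1+ p ] d _) 0<ε = contradiction (ℚ.positive 0<ε) λ ()

ratio-^ : ∀ l n → ((ℤ.+ l) ℚ./ suc l) ^ n * fromℕ (suc l ℕ.^ n) ≡ fromℕ (l ℕ.^ n)
ratio-^ l zero = ℚ.*-identityˡ 1ℚ
ratio-^ l (suc n) = begin
  r * r ^ n * fromℕ (suc l ℕ.* suc l ℕ.^ n)              ≡⟨ cong (r * r ^ n *_) (fromℕ-* (suc l) (suc l ℕ.^ n)) ⟩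
  r * r ^ n * (fromℕ (suc l) * fromℕ (suc l ℕ.^ n))  ≡⟨ interchange r (r ^ n) (fromℕ (suc l)) (fromℕ (suc l ℕ.^ n)) ⟩
  (r * fromℕ (suc l)) * (r ^ n * fromℕ (suc l ℕ.^ n)) ≡⟨ cong₂ _*_ (ratio-* l) (ratio-^ l n) ⟩
  fromℕ l * fromℕ (l ℕ.^ n)                               ≡⟨ sym (fromℕ-* l (l ℕ.^ n)) ⟩
  fromℕ (l ℕ.* l ℕ.^ n)                                       ∎
  where
  open ≡-Reasoning
  r = (ℤ.+ l) ℚ./ suc l

exponential-collapse : ∀ l .{{_ : NonZero l}} → 10 ℕ.* 3 ℕ.^ 9 ℕ.≤ suc l →
  ∃[ r ] 0ℚ < r × r < 1ℚ ×
  (∀ (ε : ℚ) → 0ℚ < ε →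
  ∃[ N ] (∀ (n : ℕ) → n ≥ N → ∀ (w : ℕ) → WilfClasses n w →
  fromℕ w ≤ ε * (r ^ n * fromℕ (c n))))
exponential-collapse l large = r , 0<r , r<1 , bound
  where
  r = (ℤ.+ l) ℚ./ suc l
  instance
    L-positive : ℚ.Positive (fromℕ (suc l))
    L-positive = fromℕ-positive (suc l)
    L-nonNegative : ℚ.NonNegative (fromℕ (suc l))
    L-nonNegative = ℚ.pos⇒nonNeg (fromℕ (suc l))
  u = l ℕ.* l + (2 ℕ.* l + 1)
  u≢0 : NonZero u
  u≢0 = ℕ.>-nonZero (ℕ.≤-trans (s≤s z≤n) (ℕ.≤-trans (ℕ.m≤n+m 1 (2 ℕ.* l)) (ℕ.m≤n+m (2 ℕ.* l + 1) (l ℕ.* l))))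
  0<r : 0ℚ < r
  0<r = ℚ.*-cancelʳ-<-nonNeg (fromℕ (suc l)) (subst₂ _<_ (sym (ℚ.*-zeroˡ (fromℕ (suc l)))) (sym (ratio-* l))
    (fromℕ-mono-< (ℕ.>-nonZero⁻¹ l)))
  r<1 : r < 1ℚ
  r<1 = ℚ.*-cancelʳ-<-nonNeg (fromℕ (suc l)) (subst₂ _<_ (sym (ratio-* l)) (sym (ℚ.*-identityˡ (fromℕ (suc l))))
    (fromℕ-mono-< (ℕ.n<1+n l)))
  bound : ∀ ε → 0ℚ < ε → ∃[ N ] (∀ n → n ≥ N → ∀ w → WilfClasses n w →
    fromℕ w ≤ ε * (r ^ n * fromℕ (c n)))
  bound ε 0<ε =
    let q , q≢0 , 1≤εq = archimedean ε 0<ε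
        -- The power `u ^ 10` dominates the powers in the ten base cases of `decay`.
        n₀ , few = few-classes l large (u ℕ.^ 10) (λ n n<10 → ℕ.^-monoʳ-≤ u {{u≢0}} (ℕ.<⇒≤ n<10)) q in
    n₀ , λ n n≥n₀ w classes → ℚ.*-cancelʳ-≤-pos (fromℕ (q ℕ.* suc l ℕ.^ n))
      {{fromℕ-positive _ {{ℕ.m*n≢0 q (suc l ℕ.^ n) {{q≢0}} {{ℕ.m^n≢0 (suc l) n}}}}}} (begin
      fromℕ w * fromℕ (q ℕ.* suc l ℕ.^ n)
        ≡⟨ sym (fromℕ-* w (q ℕ.* suc l ℕ.^ n)) ⟩
      fromℕ (w ℕ.* (q ℕ.* suc l ℕ.^ n))
        ≤⟨ fromℕ-mono-≤ (few n n≥n₀ w classes) ⟩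
      fromℕ (l ℕ.^ n ℕ.* c n)
        ≡⟨ sym (ℚ.*-identityˡ (fromℕ (l ℕ.^ n ℕ.* c n))) ⟩
      1ℚ * fromℕ (l ℕ.^ n ℕ.* c n)
        ≤⟨ ℚ.*-monoʳ-≤-nonNeg (fromℕ (l ℕ.^ n ℕ.* c n)) {{ℚ.nonNegative (fromℕ-mono-≤ {0} {l ℕ.^ n ℕ.* c n} z≤n)}} 1≤εq ⟩
      ε * fromℕ q * fromℕ (l ℕ.^ n ℕ.* c n)
        ≡⟨ cong (ε * fromℕ q *_) (trans (fromℕ-* (l ℕ.^ n) (c n)) (cong (_* fromℕ (c n)) (sym (ratio-^ l n)))) ⟩
      ε * fromℕ q * (r ^ n * fromℕ (suc l ℕ.^ n) * fromℕ (c n))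
        ≡⟨ cong (ε * fromℕ q *_) (xy∙z≈xz∙y (r ^ n) (fromℕ (suc l ℕ.^ n)) (fromℕ (c n))) ⟩
      ε * fromℕ q * (r ^ n * fromℕ (c n) * fromℕ (suc l ℕ.^ n))
        ≡⟨ interchange ε (fromℕ q) (r ^ n * fromℕ (c n)) (fromℕ (suc l ℕ.^ n)) ⟩
      ε * (r ^ n * fromℕ (c n)) * (fromℕ q * fromℕ (suc l ℕ.^ n))
        ≡⟨ cong (ε * (r ^ n * fromℕ (c n)) *_) (sym (fromℕ-* q (suc l ℕ.^ n))) ⟩
      ε * (r ^ n * fromℕ (c n)) * fromℕ (q ℕ.* suc l ℕ.^ n) ∎)
    where open ℚ.≤-Reasoning

theorem3p4 : ∃[ r ] 0ℚ < r × r < 1ℚ ×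
    (∀ (ε : ℚ) → 0ℚ < ε →
    ∃[ N ] (∀ (n : ℕ) → n ≥ N → ∀ (w : ℕ) → WilfClasses n w →
    fromℕ w ≤ ε * (r ^ n * fromℕ (c n))))
-- The rate obtained is r = 196830/196831, as 10 · 3⁹ = 196830.
theorem3p4 = exponential-collapse (10 ℕ.* 3 ℕ.^ 9) (ℕ.n≤1+n (10 ℕ.* 3 ℕ.^ 9))
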